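{- Let $\mathcal{F}$ be a $(70,22)$-minihyper in $\operatorname{PG}(4,3)$. Then $\mathcal{F}$ is one of the following: (A) the sum $\chi_S+\mathcal{F}'$ of (the characteristic function of) a solid $S$ and a $(30,9)$-minihyper $\mathcal{F}'$ in $\operatorname{PG}(4,3)$; (B) the sum $\mathcal{F}''+\chi_L$ of a $(66,21)$-minihyper $\mathcal{F}''$ in $\operatorname{PG}(4,3)$ and (the characteristic function of) a line $L$.
   Context: A multiset in $\operatorname{PG}(r,q)$ is a map $\mathcal{K}$ from the point set to the non-negative integers; for a set of points $\mathcal{Q}$, $\mathcal{K}(\mathcal{Q})=\sum_{P\in\mathcal{Q}}\mathcal{K}(P)$, and $\chi_{\mathcal{Q}}$ denotes the characteristic function of $\mathcal{Q}$. An $(n,w)$-minihyper in $\operatorname{PG}(r,q)$ is a multiset $\mathcal{K}$ with $\mathcal{K}(\text{all points})=n$, $\mathcal{K}(H)\ge w$ for every hyperplane $H$, and $\mathcal{K}(H_0)=w$ for some hyperplane $H_0$. In $\operatorname{PG}(4,3)$, a solid is a 3-dimensional subspace (a hyperplane). -}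

module Defs where

open import Data.Nat using (ℕ; zero; suc; _+_; _≤_)
open import Data.Nat.DivMod using (_mod_)
open import Data.Fin as F using (Fin; toℕ)
open import Data.Bool using (Bool; true; false; if_then_else_; _∨_)
open import Data.Vec as V using (Vec; []; _∷_)
open import Data.Vec.Properties using (≡-dec)
open import Data.List as L using (List; []; _∷_; allFin; concatMap; mapMaybe)
open import Data.Nat.ListAction using (sum)
open import Data.Bool.ListAction using (any)
open import Data.Maybe using (Maybe; just; nothing)
open import Data.Product using (Σ; _×_; ∃; proj₁; _,_)
open import Relation.Nullary using (does; ¬_)
open import Relation.Binary.PropositionalEquality using (_≡_; refl)

F₃ : Set
F₃ = Fin 3

_+₃_ : F₃ → F₃ → F₃
a +₃ b = (toℕ a + toℕ b) mod 3

_*₃_ : F₃ → F₃ → F₃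
a *₃ b = (toℕ a Data.Nat.* toℕ b) mod 3

V₅ : Set
V₅ = Vec F₃ 5

allVecs : (n : ℕ) → List (Vec F₃ n)
allVecs zero = [] ∷ []
allVecs (suc n) = concatMap (λ x → L.map (x ∷_) (allVecs n)) (allFin 3)

-- A nonzero vector is normalized if its first nonzero coordinate is 1.
-- Every point of PG(n-1,3) has exactly one normalized representative.
normalized : {n : ℕ} → Vec F₃ n → Bool
normalized [] = false
normalized (F.zero ∷ v) = normalized v
normalized (F.suc F.zero ∷ v) = true
normalized (F.suc (F.suc F.zero) ∷ v) = false

Point : Set
Point = Σ V₅ (λ v → normalized v ≡ true)

vec : Point → V₅
vec = proj₁

toPoint : V₅ → Maybe Point
toPoint v with normalized v in eq
... | true = just (v , eq)
... | false = nothing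

allPoints : List Point
allPoints = mapMaybe toPoint (allVecs 5)

dot : {n : ℕ} → Vec F₃ n → Vec F₃ n → F₃
dot [] [] = F.zero
dot (a ∷ u) (b ∷ v) = (a *₃ b) +₃ dot u v

scale : {n : ℕ} → F₃ → Vec F₃ n → Vec F₃ n
scale c = V.map (c *₃_)

vadd : {n : ℕ} → Vec F₃ n → Vec F₃ n → Vec F₃ n
vadd = V.zipWith _+₃_

_≟v_ : (u v : V₅) → Bool
u ≟v v = does (≡-dec F._≟_ u v)

PointSet : Set
PointSet = Point → Bool

-- Hyperplanes (= solids in PG(4,3)) are given by a point of the dual
-- space, i.e. a normalized nonzero linear form a : H_a = {P | a·P = 0}.
Hyperplane : Set
Hyperplane = Point

Solid : Set
Solid = Hyperplane

hyperplanePts : Hyperplane → PointSet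
hyperplanePts a P = does (dot (vec a) (vec P) F.≟ F.zero)

Line : Set
Line = Σ (Point × Point) (λ { (P , Q) → ¬ (vec P ≡ vec Q) })

linePts : Line → PointSet
linePts ((P , Q) , _) R =
  any (λ α → any (λ β → vec R ≟v vadd (scale α (vec P)) (scale β (vec Q)))
                 (allFin 3))
      (allFin 3)

Multiset : Set
Multiset = Point → ℕ

mass : Multiset → PointSet → ℕ
mass K Q = sum (L.map (λ P → if Q P then K P else 0) allPoints)

total : Multiset → ℕ
total K = sum (L.map K allPoints)

χ : PointSet → Multiset
χ Q P = if Q P then 1 else 0

IsMinihyper : ℕ → ℕ → Multiset → Set
IsMinihyper n w K =
  (total K ≡ n) ×
  ((H : Hyperplane) → w ≤ mass K (hyperplanePts H)) ×
  ∃ (λ (H₀ : Hyperplane) → mass K (hyperplanePts H₀) ≡ w)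

{-# OPTIONS --safe #-}

-- Let F be the multiplicity function, and 22 + k(H) the mass of H. Modulo 3, k is a quadratic form on the dual
-- space, because counting points off a hyperplane is; the hyperplanes with k = 0 are so numerous around one of
-- them that the polar form vanishes, and k = 3b. With b(0) = 16, double counting shows that F and b determine each
-- other, the dual hyperplane of a point x having b-weight 36 + 18 F(x).
--
-- Let x be a point of multiplicity zero on a hyperplane y with b(y) ≥ 3. Then b ≤ 7 on the hyperplanes through x,
-- and those with b ≡ 1 modulo 3 form, with 0, a two-dimensional subspace, the section at x. So if b(S) ≥ 9, the
-- solid S has only points of positive multiplicity, and χ_S can be subtracted: case (A).
--
-- Otherwise b is shown to be positive on a three-dimensional subspace of the dual space. Its annihilator is then a
-- line of points of positive multiplicity, all hyperplanes through the line have mass at least 25, and χ_L can be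
-- subtracted: case (B). The subspace is spanned by the intersections of three sections. A hyperplane e of it with
-- b(e) = 0 contains no such point x, which forces any two heavy hyperplanes (b ≥ 3) to be collinear with e in the
-- dual space; comparing the second moments of F and b then leaves no room for the heavy hyperplanes.

module Submission where

-- All counts run over F₃⁵ instead of points: incidence is then symmetric between vectors and forms,
-- the zero form acts as a hyperplane carrying the whole mass, and masses are doubled. The main
-- engine is a linear identity for the four hyperplanes of a pencil.
--
-- The section at x comes from projecting from x into PG(3,3): mass 70, planes of mass 22 + 3b.
-- Subtracting the whole space (40 points, 13 in each plane) and the plane y leaves mass 17 and
-- planes of mass at least 5. From this a second plane q can be subtracted, which leaves mass 4 and
-- planes of mass 1 or 4, in effect a line; the planes containing it are those with b ≡ 1. As the
-- congruence does not mention y or q, sections at different points can be compared.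
--
-- Three sections yield a three-dimensional space only if no hyperplane with b ≡ 1 contains all
-- points x of this kind; excluding that is an obstacle of its own. If some b is 3, 4 or 5, then q
-- is a second heavy hyperplane through x and the argument is short. Otherwise q coincides with y,
-- and the values 6, 7 and 8 call for weighing F² against b².

open import Defs
open import Data.Nat using (ℕ; zero; suc; NonZero; _+_; _*_; _∸_; _^_; _≤_; _<_; z≤n; s≤s; _≤?_; _≟_; _≤ᵇ_)
open import Data.Nat.Properties
open import Data.Nat.Tactic.RingSolver using (solve-∀)
open import Data.Fin as F using (Fin)
open import Data.Fin.Properties using (all?)
open import Data.Bool using (Bool; true; false; if_then_else_; T; _∧_; _∨_)
open import Data.Vec as V using (Vec; []; _∷_; replicate; lookup)
open import Data.Vec.Properties using (≡-dec)
open import Data.List as L using (List; []; _∷_)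
open import Data.Product using (Σ; _×_; ∃; proj₁; proj₂; _,_)
open import Data.Sum using (_⊎_; inj₁; inj₂; [_,_]′)
open import Data.Empty using (⊥; ⊥-elim)
open import Data.Unit using (tt)
open import Function using (_∘_; id; case_of_)
open import Relation.Nullary using (Dec; yes; no; ¬_; does; ¬?)
open import Relation.Nullary.Decidable using (from-yes; _×-dec_; _→-dec_; dec-true; dec-false)
open import Relation.Binary.PropositionalEquality hiding ([_])
open import Axiom.UniquenessOfIdentityProofs using (module Decidable⇒UIP)
import Data.Bool.Properties as Boolₚ
open import Data.List.Properties using (map-∘; map-++)
open import Data.Maybe using (Maybe; just; nothing; maybe′)
open import Data.Nat.ListAction using (sum)
open import Data.Nat.ListAction.Properties using (sum-++)
open import Data.Bool.ListAction using (any)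

-- Linear arithmetic over ℕ by Farkas certificates

data Lin (n : ℕ) : Set where
  var  : Fin n → Lin n
  con  : ℕ → Lin n
  _:+_ : Lin n → Lin n → Lin n
  _:*_ : ℕ → Lin n → Lin n

infixl 6 _:+_
infixr 7 _:*_

⟦_⟧ : ∀ {n} → Lin n → Vec ℕ n → ℕ
⟦ var i ⟧ ρ = lookup ρ i
⟦ con c ⟧ ρ = c
⟦ e :+ f ⟧ ρ = ⟦ e ⟧ ρ + ⟦ f ⟧ ρ
⟦ k :* e ⟧ ρ = k * ⟦ e ⟧ ρ

-- The head is the constant term, so coefficient vectors are evaluated against `1 ∷ ρ`.
coeffs : ∀ {n} → Lin n → Vec ℕ (suc n)
coeffs (var i) = 0 ∷ V.updateAt (replicate _ 0) i (λ _ → 1)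
coeffs (con c) = c ∷ replicate _ 0
coeffs (e :+ f) = V.zipWith _+_ (coeffs e) (coeffs f)
coeffs (k :* e) = V.map (k *_) (coeffs e)

evalᶜ : ∀ {n} → Vec ℕ n → Vec ℕ n → ℕ
evalᶜ [] [] = 0
evalᶜ (c ∷ cs) (x ∷ ρ) = c * x + evalᶜ cs ρ

evalᶜ-0 : ∀ {n} (ρ : Vec ℕ n) → evalᶜ (replicate n 0) ρ ≡ 0
evalᶜ-0 [] = refl
evalᶜ-0 (x ∷ ρ) = evalᶜ-0 ρ

evalᶜ-var : ∀ {n} (ρ : Vec ℕ n) i → evalᶜ (V.updateAt (replicate n 0) i (λ _ → 1)) ρ ≡ lookup ρ i
evalᶜ-var (x ∷ ρ) F.zero = trans (cong (x + 0 +_) (evalᶜ-0 ρ)) (trans (+-identityʳ _) (+-identityʳ x))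
evalᶜ-var (x ∷ ρ) (F.suc i) = evalᶜ-var ρ i

evalᶜ-+ : ∀ {n} (cs ds ρ : Vec ℕ n) → evalᶜ (V.zipWith _+_ cs ds) ρ ≡ evalᶜ cs ρ + evalᶜ ds ρ
evalᶜ-+ [] [] [] = refl
evalᶜ-+ (c ∷ cs) (d ∷ ds) (x ∷ ρ) rewrite evalᶜ-+ cs ds ρ = lemma c d x (evalᶜ cs ρ) (evalᶜ ds ρ)
  where
  lemma : ∀ c d x r s → (c + d) * x + (r + s) ≡ c * x + r + (d * x + s)
  lemma = solve-∀

evalᶜ-* : ∀ {n} k (cs ρ : Vec ℕ n) → evalᶜ (V.map (k *_) cs) ρ ≡ k * evalᶜ cs ρ
evalᶜ-* k [] [] = sym (*-zeroʳ k)
evalᶜ-* k (c ∷ cs) (x ∷ ρ) rewrite evalᶜ-* k cs ρ = lemma k c x (evalᶜ cs ρ)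
  where
  lemma : ∀ k c x r → k * c * x + k * r ≡ k * (c * x + r)
  lemma = solve-∀

coeffs-correct : ∀ {n} (e : Lin n) ρ → evalᶜ (coeffs e) (1 ∷ ρ) ≡ ⟦ e ⟧ ρ
coeffs-correct (var i) ρ = evalᶜ-var ρ i
coeffs-correct (con c) ρ = trans (cong (c * 1 +_) (evalᶜ-0 ρ)) (trans (+-identityʳ _) (*-identityʳ c))
coeffs-correct (e :+ f) ρ =
  trans (evalᶜ-+ (coeffs e) (coeffs f) (1 ∷ ρ)) (cong₂ _+_ (coeffs-correct e ρ) (coeffs-correct f ρ))
coeffs-correct (k :* e) ρ = trans (evalᶜ-* k (coeffs e) (1 ∷ ρ)) (cong (k *_) (coeffs-correct e ρ))

data Hyp {n : ℕ} (ρ : Vec ℕ n) : Set where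
  hyp : (k : ℕ) (l r : Lin n) → ⟦ l ⟧ ρ ≤ ⟦ r ⟧ ρ → Hyp ρ

lhs rhs : ∀ {n} {ρ : Vec ℕ n} → List (Hyp ρ) → Lin n
lhs [] = con 0
lhs (hyp k l r _ ∷ hs) = k :* l :+ lhs hs
rhs [] = con 0
rhs (hyp k l r _ ∷ hs) = k :* r :+ rhs hs

_≥ᶜ_ : ∀ {n} → Vec ℕ n → Vec ℕ n → Bool
[] ≥ᶜ [] = true
(c ∷ cs) ≥ᶜ (d ∷ ds) = (d ≤ᵇ c) ∧ (cs ≥ᶜ ds)

contradictory : ∀ {n} {ρ : Vec ℕ n} → List (Hyp ρ) → Bool
contradictory hs = coeffs (lhs hs) ≥ᶜ coeffs (con 1 :+ rhs hs)

T-∧ : ∀ {a b} → T (a ∧ b) → T a × T b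
T-∧ {true} {true} _ = tt , tt

≥ᶜ-sound : ∀ {n} (cs ds ρ : Vec ℕ n) → T (cs ≥ᶜ ds) → evalᶜ ds ρ ≤ evalᶜ cs ρ
≥ᶜ-sound [] [] [] _ = z≤n
≥ᶜ-sound (c ∷ cs) (d ∷ ds) (x ∷ ρ) p =
  +-mono-≤ (*-monoˡ-≤ x (≤ᵇ⇒≤ d c (proj₁ (T-∧ {d ≤ᵇ c} p)))) (≥ᶜ-sound cs ds ρ (proj₂ (T-∧ {d ≤ᵇ c} p)))

lhs≤rhs : ∀ {n} {ρ : Vec ℕ n} (hs : List (Hyp ρ)) → ⟦ lhs hs ⟧ ρ ≤ ⟦ rhs hs ⟧ ρ
lhs≤rhs [] = z≤n
lhs≤rhs (hyp k l r p ∷ hs) = +-mono-≤ (*-monoʳ-≤ k p) (lhs≤rhs hs)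

-- The nonnegative combination of the inequalities hs with the recorded multipliers reads c ≤ d with c > d.
farkas : ∀ {n} {ρ : Vec ℕ n} (hs : List (Hyp ρ)) → {T (contradictory hs)} → ⊥
farkas {ρ = ρ} hs {c} = 1+n≰n (≤-trans
  (subst₂ _≤_ (coeffs-correct (con 1 :+ rhs hs) ρ) (coeffs-correct (lhs hs) ρ)
    (≥ᶜ-sound (coeffs (lhs hs)) (coeffs (con 1 :+ rhs hs)) (1 ∷ ρ) c))
  (lhs≤rhs hs))

data Eqn {n : ℕ} (ρ : Vec ℕ n) : Set where
  eqn : (k : ℕ) (l r : Lin n) → ⟦ l ⟧ ρ ≡ ⟦ r ⟧ ρ → Eqn ρ

lhs≡ rhs≡ : ∀ {n} {ρ : Vec ℕ n} → List (Eqn ρ) → Lin n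
lhs≡ [] = con 0
lhs≡ (eqn k l r _ ∷ es) = k :* l :+ lhs≡ es
rhs≡ [] = con 0
rhs≡ (eqn k l r _ ∷ es) = k :* r :+ rhs≡ es

lhs≡rhs : ∀ {n} {ρ : Vec ℕ n} (es : List (Eqn ρ)) → ⟦ lhs≡ es ⟧ ρ ≡ ⟦ rhs≡ es ⟧ ρ
lhs≡rhs [] = refl
lhs≡rhs (eqn k l r p ∷ es) = cong₂ _+_ (cong (k *_) p) (lhs≡rhs es)

-- k times the difference of l and r is the combination of the equations es with the recorded multipliers.
linear : ∀ {n} {ρ : Vec ℕ n} k .{{_ : NonZero k}} l r (es : List (Eqn ρ)) → coeffs (k :* l :+ rhs≡ es) ≡ coeffs (k :* r :+ lhs≡ es) → ⟦ l ⟧ ρ ≡ ⟦ r ⟧ ρ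
linear {ρ = ρ} k l r es p = *-cancelˡ-≡ (⟦ l ⟧ ρ) (⟦ r ⟧ ρ) k (+-cancelʳ-≡ (⟦ rhs≡ es ⟧ ρ) _ _ (begin
  ⟦ k :* l :+ rhs≡ es ⟧ ρ                    ≡⟨ sym (coeffs-correct (k :* l :+ rhs≡ es) ρ) ⟩
  evalᶜ (coeffs (k :* l :+ rhs≡ es)) (1 ∷ ρ) ≡⟨ cong (λ cs → evalᶜ cs (1 ∷ ρ)) p ⟩
  evalᶜ (coeffs (k :* r :+ lhs≡ es)) (1 ∷ ρ) ≡⟨ coeffs-correct (k :* r :+ lhs≡ es) ρ ⟩
  k * ⟦ r ⟧ ρ + ⟦ lhs≡ es ⟧ ρ                ≡⟨ cong (k * ⟦ r ⟧ ρ +_) (lhs≡rhs es) ⟩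
  k * ⟦ r ⟧ ρ + ⟦ rhs≡ es ⟧ ρ                ∎))
  where open ≡-Reasoning

by-contra : ∀ {a b} → (suc b ≤ a → ⊥) → a ≤ b
by-contra f = ≮⇒≥ f

≤-of : ∀ {a b : ℕ} → a ≡ b → a ≤ b
≤-of = ≤-reflexive

≥-of : ∀ {a b : ℕ} → a ≡ b → b ≤ a
≥-of p = ≤-reflexive (sym p)

v0 : ∀ {n} → Lin (1 + n)
v0 = var F.zero
v1 : ∀ {n} → Lin (2 + n)
v1 = var (F.suc F.zero)
v2 : ∀ {n} → Lin (3 + n)
v2 = var (F.suc (F.suc F.zero))
v3 : ∀ {n} → Lin (4 + n)
v3 = var (F.suc (F.suc (F.suc F.zero)))
v4 : ∀ {n} → Lin (5 + n)
v4 = var (F.suc (F.suc (F.suc (F.suc F.zero))))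
v5 : ∀ {n} → Lin (6 + n)
v5 = var (F.suc (F.suc (F.suc (F.suc (F.suc F.zero)))))

v6 : ∀ {n} → Lin (7 + n)
v6 = var (F.suc (F.suc (F.suc (F.suc (F.suc (F.suc F.zero))))))
v7 : ∀ {n} → Lin (8 + n)
v7 = var (F.suc (F.suc (F.suc (F.suc (F.suc (F.suc (F.suc F.zero)))))))
v8 : ∀ {n} → Lin (9 + n)
v8 = var (F.suc (F.suc (F.suc (F.suc (F.suc (F.suc (F.suc (F.suc F.zero))))))))
v9 : ∀ {n} → Lin (10 + n)
v9 = var (F.suc (F.suc (F.suc (F.suc (F.suc (F.suc (F.suc (F.suc (F.suc F.zero)))))))))

-- The field F₃

pattern 0₃ = F.zero
pattern 1₃ = F.suc F.zero
pattern 2₃ = F.suc (F.suc F.zero)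

-₃_ : F₃ → F₃
-₃ a = 2₃ *₃ a

+₃-comm : ∀ a b → a +₃ b ≡ b +₃ a
+₃-comm = from-yes (all? λ a → all? λ b → (a +₃ b) F.≟ (b +₃ a))

+₃-assoc : ∀ a b c → (a +₃ b) +₃ c ≡ a +₃ (b +₃ c)
+₃-assoc = from-yes (all? λ a → all? λ b → all? λ c → ((a +₃ b) +₃ c) F.≟ (a +₃ (b +₃ c)))

+₃-idˡ : ∀ a → 0₃ +₃ a ≡ a
+₃-idˡ = from-yes (all? λ a → (0₃ +₃ a) F.≟ a)

+₃-idʳ : ∀ a → a +₃ 0₃ ≡ a
+₃-idʳ = from-yes (all? λ a → (a +₃ 0₃) F.≟ a)

+₃-cancel : ∀ a b → (a +₃ b) +₃ (-₃ b) ≡ a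
+₃-cancel = from-yes (all? λ a → all? λ b → ((a +₃ b) +₃ (-₃ b)) F.≟ a)

*₃-comm : ∀ a b → a *₃ b ≡ b *₃ a
*₃-comm = from-yes (all? λ a → all? λ b → (a *₃ b) F.≟ (b *₃ a))

*₃-assoc : ∀ a b c → (a *₃ b) *₃ c ≡ a *₃ (b *₃ c)
*₃-assoc = from-yes (all? λ a → all? λ b → all? λ c → ((a *₃ b) *₃ c) F.≟ (a *₃ (b *₃ c)))

*₃-idˡ : ∀ a → 1₃ *₃ a ≡ a
*₃-idˡ = from-yes (all? λ a → (1₃ *₃ a) F.≟ a)

*₃-zeroˡ : ∀ a → 0₃ *₃ a ≡ 0₃
*₃-zeroˡ = from-yes (all? λ a → (0₃ *₃ a) F.≟ 0₃)

*₃-zeroʳ : ∀ a → a *₃ 0₃ ≡ 0₃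
*₃-zeroʳ = from-yes (all? λ a → (a *₃ 0₃) F.≟ 0₃)

*₃-cancel : ∀ c t → ¬ c ≡ 0₃ → c *₃ t ≡ 0₃ → t ≡ 0₃
*₃-cancel = from-yes (all? λ c → all? λ t → ¬? (c F.≟ 0₃) →-dec ((c *₃ t) F.≟ 0₃) →-dec (t F.≟ 0₃))

*₃-distribˡ : ∀ a b c → a *₃ (b +₃ c) ≡ (a *₃ b) +₃ (a *₃ c)
*₃-distribˡ = from-yes (all? λ a → all? λ b → all? λ c → (a *₃ (b +₃ c)) F.≟ ((a *₃ b) +₃ (a *₃ c)))

*₃-distribʳ : ∀ a b c → (b +₃ c) *₃ a ≡ (b *₃ a) +₃ (c *₃ a)
*₃-distribʳ = from-yes (all? λ a → all? λ b → all? λ c → ((b +₃ c) *₃ a) F.≟ ((b *₃ a) +₃ (c *₃ a)))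

+₃-interchange : ∀ a b c d → (a +₃ b) +₃ (c +₃ d) ≡ (a +₃ c) +₃ (b +₃ d)
+₃-interchange = from-yes (all? λ a → all? λ b → all? λ c → all? λ d →
  ((a +₃ b) +₃ (c +₃ d)) F.≟ ((a +₃ c) +₃ (b +₃ d)))

δ : F₃ → ℕ
δ 0₃ = 1
δ (F.suc _) = 0

-- Vectors over F₃

0ᵥ : ∀ {n} → Vec F₃ n
0ᵥ = replicate _ 0₃

infixl 6 _⊕_ _⊝_
infix 7 _·_

_⊕_ : ∀ {n} → Vec F₃ n → Vec F₃ n → Vec F₃ n
_⊕_ = vadd

⊖_ : ∀ {n} → Vec F₃ n → Vec F₃ n
⊖ v = scale 2₃ v

_⊝_ : ∀ {n} → Vec F₃ n → Vec F₃ n → Vec F₃ n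
u ⊝ v = u ⊕ (⊖ v)

_·_ : ∀ {n} → Vec F₃ n → Vec F₃ n → F₃
_·_ = dot

_≟ᵥ_ : ∀ {n} (u v : Vec F₃ n) → Dec (u ≡ v)
_≟ᵥ_ = ≡-dec F._≟_

⊕-comm : ∀ {n} (u v : Vec F₃ n) → u ⊕ v ≡ v ⊕ u
⊕-comm [] [] = refl
⊕-comm (a ∷ u) (b ∷ v) = cong₂ _∷_ (+₃-comm a b) (⊕-comm u v)

⊕-idˡ : ∀ {n} (v : Vec F₃ n) → 0ᵥ ⊕ v ≡ v
⊕-idˡ [] = refl
⊕-idˡ (a ∷ v) = cong₂ _∷_ (+₃-idˡ a) (⊕-idˡ v)

⊕-idʳ : ∀ {n} (v : Vec F₃ n) → v ⊕ 0ᵥ ≡ v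
⊕-idʳ v = trans (⊕-comm v 0ᵥ) (⊕-idˡ v)

⊕-cancel : ∀ {n} (u v : Vec F₃ n) → (u ⊕ v) ⊝ v ≡ u
⊕-cancel [] [] = refl
⊕-cancel (a ∷ u) (b ∷ v) = cong₂ _∷_ (+₃-cancel a b) (⊕-cancel u v)

scale-⊕ : ∀ {n} c (u v : Vec F₃ n) → scale c (u ⊕ v) ≡ scale c u ⊕ scale c v
scale-⊕ c [] [] = refl
scale-⊕ c (a ∷ u) (b ∷ v) = cong₂ _∷_ (*₃-distribˡ c a b) (scale-⊕ c u v)

scale-+ : ∀ {n} c d (u : Vec F₃ n) → scale (c +₃ d) u ≡ scale c u ⊕ scale d u
scale-+ c d [] = refl
scale-+ c d (a ∷ u) = cong₂ _∷_ (*₃-distribʳ a c d) (scale-+ c d u)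

scale-scale : ∀ {n} c d (u : Vec F₃ n) → scale c (scale d u) ≡ scale (c *₃ d) u
scale-scale c d [] = refl
scale-scale c d (a ∷ u) = cong₂ _∷_ (sym (*₃-assoc c d a)) (scale-scale c d u)

scale-1 : ∀ {n} (u : Vec F₃ n) → scale 1₃ u ≡ u
scale-1 [] = refl
scale-1 (a ∷ u) = cong₂ _∷_ (*₃-idˡ a) (scale-1 u)

scale-0 : ∀ {n} (u : Vec F₃ n) → scale 0₃ u ≡ 0ᵥ
scale-0 [] = refl
scale-0 (a ∷ u) = cong₂ _∷_ (*₃-zeroˡ a) (scale-0 u)

scale-0ᵥ : ∀ {n} c → scale c (0ᵥ {n}) ≡ 0ᵥ
scale-0ᵥ {zero} c = refl
scale-0ᵥ {suc n} c = cong₂ _∷_ (*₃-zeroʳ c) (scale-0ᵥ c)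

⊖⊖ : ∀ {n} (u : Vec F₃ n) → ⊖ (⊖ u) ≡ u
⊖⊖ u = trans (scale-scale 2₃ 2₃ u) (scale-1 u)

⊝-self : ∀ {n} (u : Vec F₃ n) → u ⊝ u ≡ 0ᵥ
⊝-self u = trans (cong (_⊝ u) (sym (⊕-idˡ u))) (⊕-cancel 0ᵥ u)

·-comm : ∀ {n} (u v : Vec F₃ n) → u · v ≡ v · u
·-comm [] [] = refl
·-comm (a ∷ u) (b ∷ v) = cong₂ _+₃_ (*₃-comm a b) (·-comm u v)

·-⊕ˡ : ∀ {n} (u v w : Vec F₃ n) → (u ⊕ v) · w ≡ (u · w) +₃ (v · w)
·-⊕ˡ [] [] [] = refl
·-⊕ˡ (a ∷ u) (b ∷ v) (c ∷ w) =
  trans (cong₂ _+₃_ (*₃-distribʳ c a b) (·-⊕ˡ u v w)) (+₃-interchange (a *₃ c) (b *₃ c) (u · w) (v · w))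

·-scaleˡ : ∀ {n} c (u w : Vec F₃ n) → scale c u · w ≡ c *₃ (u · w)
·-scaleˡ c [] [] = sym (*₃-zeroʳ c)
·-scaleˡ c (a ∷ u) (b ∷ w) =
  trans (cong₂ _+₃_ (*₃-assoc c a b) (·-scaleˡ c u w)) (sym (*₃-distribˡ c (a *₃ b) (u · w)))

·-⊕ʳ : ∀ {n} (w u v : Vec F₃ n) → w · (u ⊕ v) ≡ (w · u) +₃ (w · v)
·-⊕ʳ w u v = trans (·-comm w (u ⊕ v)) (trans (·-⊕ˡ u v w) (cong₂ _+₃_ (·-comm u w) (·-comm v w)))

·-scaleʳ : ∀ {n} c (w u : Vec F₃ n) → w · scale c u ≡ c *₃ (w · u)
·-scaleʳ c w u = trans (·-comm w (scale c u)) (trans (·-scaleˡ c u w) (cong (c *₃_) (·-comm u w)))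

·-0ˡ : ∀ {n} (w : Vec F₃ n) → 0ᵥ · w ≡ 0₃
·-0ˡ [] = refl
·-0ˡ (a ∷ w) = cong₂ _+₃_ (*₃-zeroˡ a) (·-0ˡ w)

·-0ʳ : ∀ {n} (w : Vec F₃ n) → w · 0ᵥ ≡ 0₃
·-0ʳ w = trans (·-comm w 0ᵥ) (·-0ˡ w)

-- Finiteness of F₃ⁿ makes the dichotomy "a witness exists, or none does" constructive; the
-- arguments by contradiction below start from it.
search : ∀ {n} {P : Vec F₃ n → Set} → (∀ v → Dec (P v)) → (∃ P) ⊎ (∀ v → ¬ P v)
search {zero} P? with P? []
... | yes p = inj₁ ([] , p)
... | no ¬p = inj₂ λ { [] → ¬p }
search {suc n} {P} P? with search (λ v → P? (0₃ ∷ v)) | search (λ v → P? (1₃ ∷ v)) | search (λ v → P? (2₃ ∷ v))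
... | inj₁ (v , p) | _ | _ = inj₁ (0₃ ∷ v , p)
... | inj₂ _ | inj₁ (v , p) | _ = inj₁ (1₃ ∷ v , p)
... | inj₂ _ | inj₂ _ | inj₁ (v , p) = inj₁ (2₃ ∷ v , p)
... | inj₂ f | inj₂ g | inj₂ h = inj₂ λ { (0₃ ∷ v) → f v ; (1₃ ∷ v) → g v ; (2₃ ∷ v) → h v }

-- Sums over F₃ⁿ

𝟙 : ∀ {n} → Vec F₃ n → Vec F₃ n → ℕ
𝟙 v w = if does (v ≟ᵥ w) then 1 else 0

𝟙-refl : ∀ {n} (v : Vec F₃ n) → 𝟙 v v ≡ 1
𝟙-refl v rewrite dec-true (v ≟ᵥ v) refl = refl

𝟙-≢ : ∀ {n} {v w : Vec F₃ n} → ¬ v ≡ w → 𝟙 v w ≡ 0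
𝟙-≢ {v = v} {w} p rewrite dec-false (v ≟ᵥ w) p = refl

𝟙-∷ : ∀ {n} a b (v w : Vec F₃ n) → 𝟙 (a ∷ v) (b ∷ w) ≡ (if does (a F.≟ b) then 𝟙 v w else 0)
𝟙-∷ a b v w with does (a F.≟ b)
... | true = refl
... | false = refl

sum₃ : (F₃ → ℕ) → ℕ
sum₃ h = h 0₃ + (h 1₃ + h 2₃)

sum₃-cong : ∀ {f g : F₃ → ℕ} → (∀ a → f a ≡ g a) → sum₃ f ≡ sum₃ g
sum₃-cong p = cong₂ _+_ (p 0₃) (cong₂ _+_ (p 1₃) (p 2₃))

sum₃-+ : ∀ f g → sum₃ (λ a → f a + g a) ≡ sum₃ f + sum₃ g
sum₃-+ f g = lemma (f 0₃) (f 1₃) (f 2₃) (g 0₃) (g 1₃) (g 2₃)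
  where
  lemma : ∀ a b c d e h → a + d + (b + e + (c + h)) ≡ a + (b + c) + (d + (e + h))
  lemma = solve-∀

sum₃-* : ∀ k f → sum₃ (λ a → k * f a) ≡ k * sum₃ f
sum₃-* k f = lemma k (f 0₃) (f 1₃) (f 2₃)
  where
  lemma : ∀ k a b c → k * a + (k * b + k * c) ≡ k * (a + (b + c))
  lemma = solve-∀

rotate₁ : ∀ a b c → b + (c + a) ≡ a + (b + c)
rotate₁ = solve-∀

rotate₂ : ∀ a b c → c + (a + b) ≡ a + (b + c)
rotate₂ = solve-∀

swap₂₃ : ∀ a b c → a + (c + b) ≡ a + (b + c)
swap₂₃ = solve-∀

sum₃-shift : ∀ (h : F₃ → ℕ) c → sum₃ (λ a → h (a +₃ c)) ≡ sum₃ h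
sum₃-shift h 0₃ = refl
sum₃-shift h 1₃ = rotate₁ (h 0₃) (h 1₃) (h 2₃)
sum₃-shift h 2₃ = rotate₂ (h 0₃) (h 1₃) (h 2₃)

sum₃-scale : ∀ (h : F₃ → ℕ) c → ¬ c ≡ 0₃ → sum₃ (λ a → h (a *₃ c)) ≡ sum₃ h
sum₃-scale h 0₃ p = ⊥-elim (p refl)
sum₃-scale h 1₃ p = refl
sum₃-scale h 2₃ p = swap₂₃ (h 0₃) (h 1₃) (h 2₃)

sum₃-scaleˡ : ∀ (h : F₃ → ℕ) c → ¬ c ≡ 0₃ → sum₃ (λ a → h (c *₃ a)) ≡ sum₃ h
sum₃-scaleˡ h c p = trans (sum₃-cong λ a → cong h (*₃-comm c a)) (sum₃-scale h c p)

sum₃-mono : ∀ {f g : F₃ → ℕ} → (∀ a → f a ≤ g a) → sum₃ f ≤ sum₃ g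
sum₃-mono p = +-mono-≤ (p 0₃) (+-mono-≤ (p 1₃) (p 2₃))

abstract
  -- Abstract, because a sum over F₃⁵ would unfold to 243 terms; `∑-[]` and `∑-∷` give the recursion
  -- back where it is needed.
  ∑ : ∀ {n} → (Vec F₃ n → ℕ) → ℕ
  ∑ {zero} f = f []
  ∑ {suc n} f = sum₃ λ a → ∑ λ v → f (a ∷ v)

  ∑-[] : ∀ (f : Vec F₃ 0 → ℕ) → ∑ f ≡ f []
  ∑-[] f = refl

  ∑-∷ : ∀ {n} (f : Vec F₃ (suc n) → ℕ) → ∑ f ≡ sum₃ λ a → ∑ λ v → f (a ∷ v)
  ∑-∷ f = refl

  ∑-cong : ∀ {n} {f g : Vec F₃ n → ℕ} → (∀ v → f v ≡ g v) → ∑ f ≡ ∑ g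
  ∑-cong {zero} p = p []
  ∑-cong {suc n} p = sum₃-cong λ a → ∑-cong λ v → p (a ∷ v)

  ∑-mono : ∀ {n} {f g : Vec F₃ n → ℕ} → (∀ v → f v ≤ g v) → ∑ f ≤ ∑ g
  ∑-mono {zero} p = p []
  ∑-mono {suc n} p = sum₃-mono λ a → ∑-mono λ v → p (a ∷ v)

  ∑-+ : ∀ {n} (f g : Vec F₃ n → ℕ) → ∑ (λ v → f v + g v) ≡ ∑ f + ∑ g
  ∑-+ {zero} f g = refl
  ∑-+ {suc n} f g = trans (sum₃-cong λ a → ∑-+ (λ v → f (a ∷ v)) (λ v → g (a ∷ v)))
                          (sum₃-+ (λ a → ∑ λ v → f (a ∷ v)) (λ a → ∑ λ v → g (a ∷ v)))

  ∑-* : ∀ {n} k (f : Vec F₃ n → ℕ) → ∑ (λ v → k * f v) ≡ k * ∑ f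
  ∑-* {zero} k f = refl
  ∑-* {suc n} k f = trans (sum₃-cong λ a → ∑-* k λ v → f (a ∷ v)) (sum₃-* k λ a → ∑ λ v → f (a ∷ v))

  ∑-const : ∀ n c → ∑ {n} (λ _ → c) ≡ 3 ^ n * c
  ∑-const zero c = sym (+-identityʳ c)
  ∑-const (suc n) c rewrite ∑-const n c = lemma (3 ^ n) c
    where
    lemma : ∀ a c → a * c + (a * c + a * c) ≡ (a + (a + (a + 0))) * c
    lemma = solve-∀

  ∑-sum₃ : ∀ {n} (f : F₃ → Vec F₃ n → ℕ) → ∑ (λ v → sum₃ λ a → f a v) ≡ sum₃ λ a → ∑ (f a)
  ∑-sum₃ f = trans (∑-+ (f 0₃) _) (cong (∑ (f 0₃) +_) (∑-+ (f 1₃) (f 2₃)))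

  ∑-swap : ∀ {n m} (f : Vec F₃ n → Vec F₃ m → ℕ) → ∑ (λ v → ∑ λ w → f v w) ≡ ∑ λ w → ∑ λ v → f v w
  ∑-swap {zero} f = refl
  ∑-swap {suc n} f = trans (sum₃-cong λ a → ∑-swap λ v → f (a ∷ v)) (sym (∑-sum₃ λ a w → ∑ λ v → f (a ∷ v) w))

  ∑-shift : ∀ {n} (f : Vec F₃ n → ℕ) w → ∑ (λ v → f (v ⊕ w)) ≡ ∑ f
  ∑-shift f [] = refl
  ∑-shift f (b ∷ w) = trans (sum₃-cong λ a → ∑-shift (λ v → f ((a +₃ b) ∷ v)) w)
                            (sum₃-shift (λ a → ∑ λ v → f (a ∷ v)) b)

  ∑-scale : ∀ {n} c → ¬ c ≡ 0₃ → (f : Vec F₃ n → ℕ) → ∑ (λ v → f (scale c v)) ≡ ∑ f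
  ∑-scale {zero} c p f = refl
  ∑-scale {suc n} c p f = trans (sum₃-cong λ a → ∑-scale c p λ v → f ((c *₃ a) ∷ v))
                                (sum₃-scaleˡ (λ a → ∑ λ v → f (a ∷ v)) c p)

  ∑-point : ∀ {n} w (g : Vec F₃ n → ℕ) → ∑ (λ v → 𝟙 v w * g v) ≡ g w
  ∑-point [] g = +-identityʳ (g [])
  ∑-point {suc n} (b ∷ w) g = trans (sum₃-cong step) (pick b λ a → g (a ∷ w))
    where
    step : ∀ a → ∑ (λ v → 𝟙 (a ∷ v) (b ∷ w) * g (a ∷ v)) ≡ (if does (a F.≟ b) then 1 else 0) * g (a ∷ w)
    step a with does (a F.≟ b) | 𝟙-∷ a b
    ... | true | p = trans (∑-cong λ v → cong (_* g (a ∷ v)) (p v w))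
                           (trans (∑-point w λ v → g (a ∷ v)) (sym (+-identityʳ _)))
    ... | false | p = trans (∑-cong λ v → cong (_* g (a ∷ v)) (p v w)) (trans (∑-const n 0) (*-zeroʳ (3 ^ n)))
    pick : ∀ b (h : F₃ → ℕ) → sum₃ (λ a → (if does (a F.≟ b) then 1 else 0) * h a) ≡ h b
    pick 0₃ h = trans (+-identityʳ _) (+-identityʳ _)
    pick 1₃ h = trans (+-identityʳ _) (+-identityʳ _)
    pick 2₃ h = +-identityʳ _

  -- A nonzero linear form takes each value equally often. If the tail of the vector vanishes, its
  -- head permutes F₃ by scaling; otherwise the tail already equidistributes and the head only
  -- shifts.
  ∑-dot : ∀ {n} (x : Vec F₃ (suc n)) → ¬ x ≡ 0ᵥ → (h : F₃ → ℕ) → ∑ (λ v → h (v · x)) ≡ 3 ^ n * sum₃ h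
  ∑-dot {n} (b ∷ x) p h with x ≟ᵥ 0ᵥ
  ... | yes refl = trans
    (sum₃-cong λ a → trans (∑-cong {n} λ v → cong h (trans (cong ((a *₃ b) +₃_) (·-0ʳ v)) (+₃-idʳ (a *₃ b))))
                           (∑-const n (h (a *₃ b))))
    (trans (sum₃-* (3 ^ n) λ a → h (a *₃ b)) (cong (3 ^ n *_) (sum₃-scale h b λ q → p (cong (_∷ 0ᵥ) q))))
  ∑-dot {zero} (b ∷ []) p h | no q = ⊥-elim (q refl)
  ∑-dot {suc n} (b ∷ x) p h | no q = trans
    (sum₃-cong λ a → trans (∑-dot x q λ c → h ((a *₃ b) +₃ c))
      (cong (3 ^ n *_) (trans (sum₃-cong λ c → cong h (+₃-comm (a *₃ b) c)) (sum₃-shift h (a *₃ b)))))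
    (lemma (3 ^ n) (sum₃ h))
    where
    lemma : ∀ a c → a * c + (a * c + a * c) ≡ (a + (a + (a + 0))) * c
    lemma = solve-∀

∑-*ʳ : ∀ {n} (f : Vec F₃ n → ℕ) k → ∑ (λ v → f v * k) ≡ ∑ f * k
∑-*ʳ f k = trans (∑-cong λ v → *-comm (f v) k) (trans (∑-* k f) (*-comm k (∑ f)))

∑-0 : ∀ {n} → ∑ {n} (λ _ → 0) ≡ 0
∑-0 {n} = trans (∑-const n 0) (*-zeroʳ (3 ^ n))

-- Were the inequality strict at w, a unit mass at w could be added to f while staying below g,
-- against the totals. This turns a tight count into a pointwise identity.
∑-squeeze : ∀ {n} {f g : Vec F₃ n → ℕ} → (∀ v → f v ≤ g v) → ∑ g ≤ ∑ f → ∀ v → f v ≡ g v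
∑-squeeze {n} {f} {g} f≤g ∑g≤∑f w = ≤-antisym (f≤g w) (by-contra λ fw<gw → 1+n≰n (begin
  suc (∑ f)                       ≡⟨ cong suc (sym (+-identityʳ (∑ f))) ⟩
  suc (∑ f + 0)                   ≡⟨ sym (+-suc (∑ f) 0) ⟩
  ∑ f + 1                         ≡⟨ cong (∑ f +_) (sym (∑-point w λ _ → 1)) ⟩
  ∑ f + ∑ (λ v → 𝟙 v w * 1)       ≡⟨ sym (∑-+ f _) ⟩
  ∑ (λ v → f v + 𝟙 v w * 1)       ≤⟨ ∑-mono (bound fw<gw) ⟩
  ∑ g                             ≤⟨ ∑g≤∑f ⟩
  ∑ f                             ∎))
  where
  open ≤-Reasoning
  bound : suc (f w) ≤ g w → ∀ v → f v + 𝟙 v w * 1 ≤ g v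
  bound q v with v ≟ᵥ w
  ... | yes refl = ≤-trans (≤-of (+-comm (f v) 1)) q
  ... | no _ = ≤-trans (≤-of (+-identityʳ (f v))) (f≤g v)

-- Masses of subspaces given by linear equations

M : ∀ {n} → (Vec F₃ n → ℕ) → Vec F₃ n → ℕ
M f u = ∑ λ x → δ (u · x) * f x

on : ∀ {n} → Vec F₃ n → (Vec F₃ n → ℕ) → Vec F₃ n → ℕ
on u f x = δ (u · x) * f x

M₂ : ∀ {n} → (Vec F₃ n → ℕ) → Vec F₃ n → Vec F₃ n → ℕ
M₂ f u v = M (on u f) v

M₃ : ∀ {n} → (Vec F₃ n → ℕ) → Vec F₃ n → Vec F₃ n → Vec F₃ n → ℕ
M₃ f u v w = M₂ (on u f) v w

δ-≤ : ∀ t m → δ t * m ≤ m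
δ-≤ 0₃ m = ≤-of (+-identityʳ m)
δ-≤ (F.suc t) m = z≤n

δ≤1 : ∀ t → δ t ≤ 1
δ≤1 0₃ = ≤-refl
δ≤1 (F.suc _) = z≤n

δ-pencil : ∀ s t → δ s + δ t + δ (s +₃ t) + δ (s +₃ (-₃ t)) ≡ 1 + 3 * (δ s * δ t)
δ-pencil = from-yes (all? λ s → all? λ t → (δ s + δ t + δ (s +₃ t) + δ (s +₃ (-₃ t))) ≟ (1 + 3 * (δ s * δ t)))

·-⊝ˡ : ∀ {n} (u v x : Vec F₃ n) → (u ⊝ v) · x ≡ (u · x) +₃ (-₃ (v · x))
·-⊝ˡ u v x = trans (·-⊕ˡ u (⊖ v) x) (cong ((u · x) +₃_) (·-scaleˡ 2₃ v x))

-- A vector on both hyperplanes lies on all four of the pencil, any other vector on exactly one. The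
-- identity is pointwise, so u and v may be dependent or zero.
M-pencil : ∀ {n} (f : Vec F₃ n → ℕ) u v →
  M f u + M f v + M f (u ⊕ v) + M f (u ⊝ v) ≡ ∑ f + 3 * M₂ f u v
M-pencil f u v = begin
  M f u + M f v + M f (u ⊕ v) + M f (u ⊝ v)
    ≡⟨ cong (λ m → m + M f (u ⊕ v) + M f (u ⊝ v)) (sym (∑-+ (on u f) (on v f))) ⟩
  ∑ (λ x → on u f x + on v f x) + M f (u ⊕ v) + M f (u ⊝ v)
    ≡⟨ cong (_+ M f (u ⊝ v)) (sym (∑-+ (λ x → on u f x + on v f x) (on (u ⊕ v) f))) ⟩
  ∑ (λ x → on u f x + on v f x + on (u ⊕ v) f x) + M f (u ⊝ v)
    ≡⟨ sym (∑-+ (λ x → on u f x + on v f x + on (u ⊕ v) f x) (on (u ⊝ v) f)) ⟩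
  ∑ (λ x → on u f x + on v f x + on (u ⊕ v) f x + on (u ⊝ v) f x)
    ≡⟨ ∑-cong pointwise ⟩
  ∑ (λ x → f x + 3 * (δ (v · x) * (δ (u · x) * f x)))
    ≡⟨ ∑-+ f _ ⟩
  ∑ f + ∑ (λ x → 3 * (δ (v · x) * (δ (u · x) * f x)))
    ≡⟨ cong (∑ f +_) (∑-* 3 _) ⟩
  ∑ f + 3 * M₂ f u v ∎
  where
  open ≡-Reasoning
  collect : ∀ a b c d m → a * m + b * m + c * m + d * m ≡ (a + b + c + d) * m
  collect = solve-∀
  spread : ∀ a b m → (1 + 3 * (a * b)) * m ≡ m + 3 * (b * (a * m))
  spread = solve-∀
  pointwise : ∀ x → on u f x + on v f x + on (u ⊕ v) f x + on (u ⊝ v) f x ≡ f x + 3 * (δ (v · x) * (δ (u · x) * f x))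
  pointwise x rewrite ·-⊕ˡ u v x | ·-⊝ˡ u v x =
    trans (collect (δ (u · x)) (δ (v · x)) _ _ (f x))
    (trans (cong (_* f x) (δ-pencil (u · x) (v · x))) (spread (δ (u · x)) (δ (v · x)) (f x)))

M₂-pencil : ∀ {n} (f : Vec F₃ n → ℕ) u v w →
  M₂ f u v + M₂ f u w + M₂ f u (v ⊕ w) + M₂ f u (v ⊝ w) ≡ M f u + 3 * M₃ f u v w
M₂-pencil f u v w = M-pencil (on u f) v w

M-cong : ∀ {n} {f g : Vec F₃ n → ℕ} → (∀ x → f x ≡ g x) → ∀ u → M f u ≡ M g u
M-cong p u = ∑-cong λ x → cong (δ (u · x) *_) (p x)

on-comm : ∀ {n} (f : Vec F₃ n → ℕ) u v x → on v (on u f) x ≡ on u (on v f) x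
on-comm f u v x = lemma (δ (v · x)) (δ (u · x)) (f x)
  where
  lemma : ∀ a b c → a * (b * c) ≡ b * (a * c)
  lemma = solve-∀

M₂-comm : ∀ {n} (f : Vec F₃ n → ℕ) u v → M₂ f u v ≡ M₂ f v u
M₂-comm f u v = ∑-cong (on-comm f u v)

M-+ : ∀ {n} (f g : Vec F₃ n → ℕ) u → M (λ x → f x + g x) u ≡ M f u + M g u
M-+ f g u = trans (∑-cong λ x → *-distribˡ-+ (δ (u · x)) (f x) (g x)) (∑-+ (on u f) (on u g))

M-* : ∀ {n} k (f : Vec F₃ n → ℕ) u → M (λ x → k * f x) u ≡ k * M f u
M-* k f u = trans (∑-cong λ x → lemma (δ (u · x)) k (f x)) (∑-* k (on u f))
  where
  lemma : ∀ a b c → a * (b * c) ≡ b * (a * c)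
  lemma = solve-∀

M-mono : ∀ {n} {f g : Vec F₃ n → ℕ} u → (∀ x → u · x ≡ 0₃ → f x ≤ g x) → M f u ≤ M g u
M-mono {f = f} {g} u p = ∑-mono step
  where
  step : ∀ x → on u f x ≤ on u g x
  step x with u · x in eq
  ... | 0₃ = +-monoˡ-≤ 0 (p x eq)
  ... | F.suc _ = z≤n

-- Double counting of incident pairs; the averaging arguments below are instances of it.
M-swap : ∀ {n} (f g : Vec F₃ n → ℕ) → ∑ (λ v → g v * M f v) ≡ ∑ λ x → f x * M g x
M-swap f g = begin
  ∑ (λ v → g v * M f v)                       ≡⟨ ∑-cong (λ v → sym (∑-* (g v) (on v f))) ⟩
  ∑ (λ v → ∑ λ x → g v * (δ (v · x) * f x))   ≡⟨ ∑-swap (λ v x → g v * (δ (v · x) * f x)) ⟩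
  ∑ (λ x → ∑ λ v → g v * (δ (v · x) * f x))   ≡⟨ ∑-cong (λ x → ∑-cong λ v → term x v) ⟩
  ∑ (λ x → ∑ λ v → f x * (δ (x · v) * g v))   ≡⟨ ∑-cong (λ x → ∑-* (f x) (on x g)) ⟩
  ∑ (λ x → f x * M g x)                       ∎
  where
  open ≡-Reasoning
  lemma : ∀ a b c → a * (b * c) ≡ c * (b * a)
  lemma = solve-∀
  term : ∀ x v → g v * (δ (v · x) * f x) ≡ f x * (δ (x · v) * g v)
  term x v rewrite ·-comm v x = lemma (g v) (δ (x · v)) (f x)

-- Linear combinations and independence

comb : ∀ {n k} → Vec F₃ k → Vec (Vec F₃ n) k → Vec F₃ n
comb [] [] = 0ᵥ
comb (c ∷ cs) (u ∷ us) = scale c u ⊕ comb cs us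

Independent : ∀ {n k} → Vec (Vec F₃ n) k → Set
Independent us = ∀ cs → comb cs us ≡ 0ᵥ → cs ≡ 0ᵥ

⊕-interchange : ∀ {n} (a b c d : Vec F₃ n) → (a ⊕ b) ⊕ (c ⊕ d) ≡ (a ⊕ c) ⊕ (b ⊕ d)
⊕-interchange [] [] [] [] = refl
⊕-interchange (a ∷ as) (b ∷ bs) (c ∷ cs) (d ∷ ds) = cong₂ _∷_ (+₃-interchange a b c d) (⊕-interchange as bs cs ds)

comb-⊕ : ∀ {n k} (cs ds : Vec F₃ k) (us : Vec (Vec F₃ n) k) → comb (cs ⊕ ds) us ≡ comb cs us ⊕ comb ds us
comb-⊕ [] [] [] = sym (⊕-idˡ 0ᵥ)
comb-⊕ (c ∷ cs) (d ∷ ds) (u ∷ us) =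
  trans (cong₂ _⊕_ (scale-+ c d u) (comb-⊕ cs ds us)) (⊕-interchange _ _ _ _)

comb-scale : ∀ {n k} c (cs : Vec F₃ k) (us : Vec (Vec F₃ n) k) → comb (scale c cs) us ≡ scale c (comb cs us)
comb-scale c [] [] = sym (scale-0ᵥ c)
comb-scale c (d ∷ cs) (u ∷ us) =
  trans (cong₂ _⊕_ (sym (scale-scale c d u)) (comb-scale c cs us)) (sym (scale-⊕ c (scale d u) (comb cs us)))

⊝-≡0 : ∀ {n} (u v : Vec F₃ n) → u ⊝ v ≡ 0ᵥ → u ≡ v
⊝-≡0 [] [] p = refl
⊝-≡0 (a ∷ u) (b ∷ v) p = cong₂ _∷_ (lemma a b (cong V.head p)) (⊝-≡0 u v (cong V.tail p))
  where
  lemma : ∀ a b → a +₃ (-₃ b) ≡ 0₃ → a ≡ b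
  lemma 0₃ 0₃ q = refl
  lemma 1₃ 1₃ q = refl
  lemma 2₃ 2₃ q = refl
  lemma 0₃ 1₃ ()
  lemma 0₃ 2₃ ()
  lemma 1₃ 0₃ ()
  lemma 1₃ 2₃ ()
  lemma 2₃ 0₃ ()
  lemma 2₃ 1₃ ()

comb-injective : ∀ {n k} (us : Vec (Vec F₃ n) k) → Independent us → ∀ cs ds → comb cs us ≡ comb ds us → cs ≡ ds
comb-injective us ind cs ds p = ⊝-≡0 cs ds (ind (cs ⊝ ds) (trans (comb-⊕ cs (⊖ ds) us)
  (trans (cong (comb cs us ⊕_) (comb-scale 2₃ ds us)) (trans (cong (_⊝ comb ds us) p) (⊝-self _)))))

InSpan : ∀ {n k} → Vec (Vec F₃ n) k → Vec F₃ n → Set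
InSpan us v = ∃ λ cs → v ≡ comb cs us

InSpan? : ∀ {n k} (us : Vec (Vec F₃ n) k) v → Dec (InSpan us v)
InSpan? us v with search (λ cs → v ≟ᵥ comb cs us)
... | inj₁ p = yes p
... | inj₂ f = no λ { (cs , p) → f cs p }

-- For independent vectors this is the characteristic function of their span, in a form that turns
-- sums over the span into sums over coefficients. `mult []` is the indicator of the origin.
mult : ∀ {n k} → Vec (Vec F₃ n) k → Vec F₃ n → ℕ
mult us v = ∑ λ cs → 𝟙 v (comb cs us)

∑-mult : ∀ {n k} (us : Vec (Vec F₃ n) k) (g : Vec F₃ n → ℕ) → ∑ (λ v → mult us v * g v) ≡ ∑ λ cs → g (comb cs us)
∑-mult us g = trans (∑-cong λ v → sym (∑-*ʳ (λ cs → 𝟙 v (comb cs us)) (g v)))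
  (trans (∑-swap λ v cs → 𝟙 v (comb cs us) * g v) (∑-cong λ cs → ∑-point (comb cs us) g))

mult-∉ : ∀ {n k} (us : Vec (Vec F₃ n) k) {v} → ¬ InSpan us v → mult us v ≡ 0
mult-∉ us p = trans (∑-cong λ cs → 𝟙-≢ λ q → p (cs , q)) ∑-0

mult-∈ : ∀ {n k} (us : Vec (Vec F₃ n) k) → Independent us → ∀ {v} → InSpan us v → mult us v ≡ 1
mult-∈ us ind (ds , refl) = trans (∑-cong same) (∑-point ds λ _ → 1)
  where
  same : ∀ cs → 𝟙 (comb ds us) (comb cs us) ≡ 𝟙 cs ds * 1
  same cs with cs ≟ᵥ ds
  ... | yes refl = 𝟙-refl (comb cs us)
  ... | no p = 𝟙-≢ λ q → p (comb-injective us ind cs ds (sym q))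

-- The span already uses up the total weight 3 ^ k, which leaves nothing for a vector outside.
span-fills : ∀ {n k} (us : Vec (Vec F₃ n) k) → Independent us → (χ : Vec F₃ n → ℕ) →
  (∀ cs → 1 ≤ χ (comb cs us)) → ∑ χ ≤ 3 ^ k → ∀ v → 1 ≤ χ v → InSpan us v
span-fills {k = k} us ind χ pos small v 1≤χv with InSpan? us v
... | yes p = p
... | no p = ⊥-elim (1+n≰n (≤-trans 1≤χv (≤-of (trans (sym (eq v)) (mult-∉ us p)))))
  where
  below : ∀ v → mult us v ≤ χ v
  below v with InSpan? us v
  ... | yes q@(cs , refl) = ≤-trans (≤-of (mult-∈ us ind q)) (pos cs)
  ... | no q = ≤-trans (≤-of (mult-∉ us q)) z≤n
  size : ∑ (mult us) ≡ 3 ^ k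
  size = trans (∑-cong λ v → sym (*-identityʳ (mult us v))) (trans (∑-mult us λ _ → 1)
    (trans (∑-const k 1) (*-identityʳ (3 ^ k))))
  eq : ∀ v → mult us v ≡ χ v
  eq = ∑-squeeze below (≤-trans small (≥-of size))

-- Residues modulo 3

ρ₃ : ℕ → F₃
ρ₃ zero = 0₃
ρ₃ (suc n) = 1₃ +₃ ρ₃ n

ρ₃-+ : ∀ m n → ρ₃ (m + n) ≡ ρ₃ m +₃ ρ₃ n
ρ₃-+ zero n = sym (+₃-idˡ (ρ₃ n))
ρ₃-+ (suc m) n = trans (cong (1₃ +₃_) (ρ₃-+ m n)) (sym (+₃-assoc 1₃ (ρ₃ m) (ρ₃ n)))

ρ₃-* : ∀ m n → ρ₃ (m * n) ≡ ρ₃ m *₃ ρ₃ n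
ρ₃-* zero n = sym (*₃-zeroˡ (ρ₃ n))
ρ₃-* (suc m) n = trans (ρ₃-+ n (m * n)) (trans (cong (ρ₃ n +₃_) (ρ₃-* m n))
  (trans (cong (_+₃ (ρ₃ m *₃ ρ₃ n)) (sym (*₃-idˡ (ρ₃ n)))) (sym (*₃-distribʳ (ρ₃ n) 1₃ (ρ₃ m)))))

ρ₃-3+ : ∀ n → ρ₃ (3 + n) ≡ ρ₃ n
ρ₃-3+ n = lemma (ρ₃ n)
  where
  lemma : ∀ a → 1₃ +₃ (1₃ +₃ (1₃ +₃ a)) ≡ a
  lemma = from-yes (all? λ a → (1₃ +₃ (1₃ +₃ (1₃ +₃ a))) F.≟ a)

ρ₃-0 : ∀ n → ρ₃ n ≡ 0₃ → ∃ λ b → n ≡ 3 * b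
ρ₃-0 zero p = 0 , refl
ρ₃-0 (suc zero) ()
ρ₃-0 (suc (suc zero)) ()
ρ₃-0 (suc (suc (suc n))) p with ρ₃-0 n (trans (sym (ρ₃-3+ n)) p)
... | b , refl = suc b , sym (*-suc 3 b)

-- Identities between linear combinations of vectors, decided on coefficients

data Vexp (k : ℕ) : Set where
  atom : Fin k → Vexp k
  _⟨+⟩_ : Vexp k → Vexp k → Vexp k
  _⟨-⟩_ : Vexp k → Vexp k → Vexp k
  _⟨*⟩_ : F₃ → Vexp k → Vexp k

infixl 6 _⟨+⟩_ _⟨-⟩_
infixr 7 _⟨*⟩_

evalᵥ : ∀ {n k} → Vec (Vec F₃ n) k → Vexp k → Vec F₃ n
evalᵥ us (atom i) = lookup us i
evalᵥ us (e ⟨+⟩ f) = evalᵥ us e ⊕ evalᵥ us f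
evalᵥ us (e ⟨-⟩ f) = evalᵥ us e ⊝ evalᵥ us f
evalᵥ us (c ⟨*⟩ e) = scale c (evalᵥ us e)

coef : ∀ {k} → Vexp k → Vec F₃ k
coef (atom i) = V.updateAt 0ᵥ i (λ _ → 1₃)
coef (e ⟨+⟩ f) = coef e ⊕ coef f
coef (e ⟨-⟩ f) = coef e ⊝ coef f
coef (c ⟨*⟩ e) = scale c (coef e)

comb-0 : ∀ {n k} (us : Vec (Vec F₃ n) k) → comb 0ᵥ us ≡ 0ᵥ
comb-0 [] = refl
comb-0 (u ∷ us) = trans (cong₂ _⊕_ (scale-0 u) (comb-0 us)) (⊕-idˡ 0ᵥ)

comb-at : ∀ {n k} (us : Vec (Vec F₃ n) k) i → comb (V.updateAt 0ᵥ i (λ _ → 1₃)) us ≡ lookup us i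
comb-at (u ∷ us) F.zero = trans (cong₂ _⊕_ (scale-1 u) (comb-0 us)) (⊕-idʳ u)
comb-at (u ∷ us) (F.suc i) = trans (cong₂ _⊕_ (scale-0 u) (comb-at us i)) (⊕-idˡ _)

comb-⊝ : ∀ {n k} (cs ds : Vec F₃ k) (us : Vec (Vec F₃ n) k) → comb (cs ⊝ ds) us ≡ comb cs us ⊝ comb ds us
comb-⊝ cs ds us = trans (comb-⊕ cs (⊖ ds) us) (cong (comb cs us ⊕_) (comb-scale 2₃ ds us))

coef-correct : ∀ {n k} (us : Vec (Vec F₃ n) k) e → evalᵥ us e ≡ comb (coef e) us
coef-correct us (atom i) = sym (comb-at us i)
coef-correct us (e ⟨+⟩ f) = trans (cong₂ _⊕_ (coef-correct us e) (coef-correct us f)) (sym (comb-⊕ (coef e) (coef f) us))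
coef-correct us (e ⟨-⟩ f) = trans (cong₂ _⊝_ (coef-correct us e) (coef-correct us f)) (sym (comb-⊝ (coef e) (coef f) us))
coef-correct us (c ⟨*⟩ e) = trans (cong (scale c) (coef-correct us e)) (sym (comb-scale c (coef e) us))

by-coef : ∀ {n k} (us : Vec (Vec F₃ n) k) (e f : Vexp k) → coef e ≡ coef f → evalᵥ us e ≡ evalᵥ us f
by-coef us e f p = trans (coef-correct us e) (trans (cong (λ c → comb c us) p) (sym (coef-correct us f)))

a0 : ∀ {k} → Vexp (1 + k)
a0 = atom F.zero
a1 : ∀ {k} → Vexp (2 + k)
a1 = atom (F.suc F.zero)
a2 : ∀ {k} → Vexp (3 + k)
a2 = atom (F.suc (F.suc F.zero))
a3 : ∀ {k} → Vexp (4 + k)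
a3 = atom (F.suc (F.suc (F.suc F.zero)))

independent-≢ : ∀ {n k} {us : Vec (Vec F₃ n) k} → Independent us → (e : Vexp k) → ¬ coef e ≡ 0ᵥ → ¬ evalᵥ us e ≡ 0ᵥ
independent-≢ {us = us} ind e p q = p (ind (coef e) (trans (sym (coef-correct us e)) q))

independent-[] : ∀ {n} → Independent {n} []
independent-[] [] _ = refl

independent-∷ : ∀ {n k} {us : Vec (Vec F₃ n) k} {u} → Independent us → ¬ InSpan us u → Independent (u ∷ us)
independent-∷ {us = us} {u} ind out (0₃ ∷ cs) p =
  cong (0₃ ∷_) (ind cs (trans (sym (trans (cong (_⊕ comb cs us) (scale-0 u)) (⊕-idˡ _))) p))
independent-∷ {us = us} {u} ind out (1₃ ∷ cs) p = ⊥-elim (out (scale 2₃ cs , (begin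
  u                                  ≡⟨ by-coef (u ∷ comb cs us ∷ []) a0 (a0 ⟨+⟩ a1 ⟨-⟩ a1) refl ⟩
  u ⊕ comb cs us ⊝ comb cs us        ≡⟨ cong (λ w → w ⊕ comb cs us ⊝ comb cs us) (sym (scale-1 u)) ⟩
  scale 1₃ u ⊕ comb cs us ⊝ comb cs us ≡⟨ cong (_⊝ comb cs us) p ⟩
  0ᵥ ⊝ comb cs us                    ≡⟨ ⊕-idˡ _ ⟩
  ⊖ comb cs us                       ≡⟨ sym (comb-scale 2₃ cs us) ⟩
  comb (scale 2₃ cs) us              ∎)))
  where open ≡-Reasoning
independent-∷ {us = us} {u} ind out (2₃ ∷ cs) p = ⊥-elim (out (cs , (begin
  u                                  ≡⟨ by-coef (u ∷ comb cs us ∷ []) a0 (a1 ⟨-⟩ (2₃ ⟨*⟩ a0 ⟨+⟩ a1)) refl ⟩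
  comb cs us ⊝ (scale 2₃ u ⊕ comb cs us) ≡⟨ cong (comb cs us ⊝_) p ⟩
  comb cs us ⊝ 0ᵥ                    ≡⟨ cong (comb cs us ⊕_) (scale-0ᵥ 2₃) ⟩
  comb cs us ⊕ 0ᵥ                    ≡⟨ ⊕-idʳ _ ⟩
  comb cs us                         ∎)))
  where open ≡-Reasoning

⊥-comb : ∀ {n k} (us : Vec (Vec F₃ n) k) x → (∀ i → lookup us i · x ≡ 0₃) → ∀ cs → comb cs us · x ≡ 0₃
⊥-comb [] x p [] = ·-0ˡ x
⊥-comb (u ∷ us) x p (c ∷ cs) = trans (·-⊕ˡ (scale c u) (comb cs us) x)
  (cong₂ _+₃_ (trans (·-scaleˡ c u x) (trans (cong (c *₃_) (p F.zero)) (*₃-zeroʳ c))) (⊥-comb us x (λ i → p (F.suc i)) cs))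

∉-span : ∀ {n k} {us : Vec (Vec F₃ n) k} {u} x → (∀ i → lookup us i · x ≡ 0₃) → ¬ u · x ≡ 0₃ → ¬ InSpan us u
∉-span {us = us} x p q (cs , refl) = q (⊥-comb us x p cs)

⊥₁ : ∀ {n} {u x : Vec F₃ n} → u · x ≡ 0₃ → ∀ i → lookup (u ∷ []) i · x ≡ 0₃
⊥₁ p F.zero = p

⊥₂ : ∀ {n} {u v x : Vec F₃ n} → u · x ≡ 0₃ → v · x ≡ 0₃ → ∀ i → lookup (u ∷ v ∷ []) i · x ≡ 0₃
⊥₂ p q F.zero = p
⊥₂ p q (F.suc F.zero) = q

⊥₃ : ∀ {n} {u v w x : Vec F₃ n} → u · x ≡ 0₃ → v · x ≡ 0₃ → w · x ≡ 0₃ → ∀ i → lookup (u ∷ v ∷ w ∷ []) i · x ≡ 0₃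
⊥₃ p q r F.zero = p
⊥₃ p q r (F.suc F.zero) = q
⊥₃ p q r (F.suc (F.suc F.zero)) = r

∉-[] : ∀ {n} {u : Vec F₃ n} → ¬ u ≡ 0ᵥ → ¬ InSpan [] u
∉-[] p ([] , q) = p q

independent₁ : ∀ {n} {u : Vec F₃ n} → ¬ u ≡ 0ᵥ → Independent (u ∷ [])
independent₁ p = independent-∷ independent-[] (∉-[] p)

∉-span₁ : ∀ {n} {u v : Vec F₃ n} → ¬ u ≡ 0ᵥ → ¬ u ≡ v → ¬ u ≡ ⊖ v → ¬ InSpan (v ∷ []) u
∉-span₁ {v = v} p q r (0₃ ∷ [] , s) = p (trans s (trans (⊕-idʳ _) (scale-0 v)))
∉-span₁ {v = v} p q r (1₃ ∷ [] , s) = q (trans s (trans (⊕-idʳ _) (scale-1 v)))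
∉-span₁ {v = v} p q r (2₃ ∷ [] , s) = r (trans s (⊕-idʳ _))

-- Numbers of solutions of linear equations in F₃⁵

one : V₅ → ℕ
one _ = 1

∑-one : ∑ one ≡ 243
∑-one = ∑-const 5 1

M-one : ∀ u → ¬ u ≡ 0ᵥ → M one u ≡ 81
M-one u p = trans (∑-cong λ x → trans (*-identityʳ _) (cong δ (·-comm u x))) (∑-dot u p δ)

M-0ᵥ : ∀ (f : V₅ → ℕ) → M f 0ᵥ ≡ ∑ f
M-0ᵥ f = ∑-cong λ x → trans (cong (λ t → δ t * f x) (·-0ˡ x)) (+-identityʳ (f x))

M-one-≥ : ∀ u → 81 ≤ M one u
M-one-≥ u with u ≟ᵥ 0ᵥ
... | yes refl = ≤-trans (≤ᵇ⇒≤ 81 243 tt) (≥-of (trans (M-0ᵥ one) ∑-one))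
... | no p = ≥-of (M-one u p)

M₂-one-≥ : ∀ u v → 27 ≤ M₂ one u v
M₂-one-≥ u v = by-contra λ p → farkas {ρ = M one u ∷ M one v ∷ M one (u ⊕ v) ∷ M one (u ⊝ v) ∷ M₂ one u v ∷ ∑ one ∷ []}
  ( hyp 1 (con 81) v0 (M-one-≥ u) ∷ hyp 1 (con 81) v1 (M-one-≥ v)
  ∷ hyp 1 (con 81) v2 (M-one-≥ (u ⊕ v)) ∷ hyp 1 (con 81) v3 (M-one-≥ (u ⊝ v))
  ∷ hyp 1 (v0 :+ v1 :+ v2 :+ v3) (v5 :+ 3 :* v4) (≤-of (M-pencil one u v))
  ∷ hyp 3 (con 1 :+ v4) (con 27) p ∷ hyp 1 v5 (con 243) (≤-of ∑-one) ∷ [])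

M₂-one : ∀ {u v} → Independent (u ∷ v ∷ []) → M₂ one u v ≡ 27
M₂-one {u} {v} ind = ≤-antisym (by-contra λ p →
  farkas {ρ = M one u ∷ M one v ∷ M one (u ⊕ v) ∷ M one (u ⊝ v) ∷ M₂ one u v ∷ ∑ one ∷ []}
  ( hyp 1 v0 (con 81) (≤-of (M-one u (nz a0 λ ()))) ∷ hyp 1 v1 (con 81) (≤-of (M-one v (nz a1 λ ())))
  ∷ hyp 1 v2 (con 81) (≤-of (M-one _ (nz (a0 ⟨+⟩ a1) λ ()))) ∷ hyp 1 v3 (con 81) (≤-of (M-one _ (nz (a0 ⟨-⟩ a1) λ ())))
  ∷ hyp 1 (v5 :+ 3 :* v4) (v0 :+ v1 :+ v2 :+ v3) (≥-of (M-pencil one u v))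
  ∷ hyp 3 (con 28) v4 p ∷ hyp 1 (con 243) v5 (≥-of ∑-one) ∷ [])) (M₂-one-≥ u v)
  where
  nz = independent-≢ ind

independent-pair : ∀ {n k} {us : Vec (Vec F₃ n) k} → Independent us → (e f : Vexp k) →
  ¬ coef e ≡ 0ᵥ → ¬ coef f ≡ 0ᵥ → ¬ coef (e ⟨+⟩ f) ≡ 0ᵥ → ¬ coef (e ⟨-⟩ f) ≡ 0ᵥ →
  Independent (evalᵥ us e ∷ evalᵥ us f ∷ [])
independent-pair {us = us} ind e f p q r s = independent-∷ (independent₁ (independent-≢ ind f q))
  (∉-span₁ (independent-≢ ind e p)
    (λ t → independent-≢ ind (e ⟨-⟩ f) s (trans (cong (_⊝ evalᵥ us f) t) (⊝-self _)))
    (λ t → independent-≢ ind (e ⟨+⟩ f) r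
      (trans (cong (_⊕ evalᵥ us f) t) (trans (⊕-comm _ _) (⊝-self _)))))

M₃-one-≥ : ∀ u v w → M one u ≡ 81 → 9 ≤ M₃ one u v w
M₃-one-≥ u v w q = by-contra λ p →
  farkas {ρ = M₂ one u v ∷ M₂ one u w ∷ M₂ one u (v ⊕ w) ∷ M₂ one u (v ⊝ w) ∷ M₃ one u v w ∷ M one u ∷ []}
  ( hyp 1 (con 27) v0 (M₂-one-≥ u v) ∷ hyp 1 (con 27) v1 (M₂-one-≥ u w)
  ∷ hyp 1 (con 27) v2 (M₂-one-≥ u (v ⊕ w)) ∷ hyp 1 (con 27) v3 (M₂-one-≥ u (v ⊝ w))
  ∷ hyp 1 (v0 :+ v1 :+ v2 :+ v3) (v5 :+ 3 :* v4) (≤-of (M₂-pencil one u v w))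
  ∷ hyp 3 (con 1 :+ v4) (con 9) p ∷ hyp 1 v5 (con 81) (≤-of q) ∷ [])

M₃-one : ∀ {u v w} → Independent (u ∷ v ∷ w ∷ []) → M₃ one u v w ≡ 9
M₃-one {u} {v} {w} ind = ≤-antisym (by-contra λ p →
  farkas {ρ = M₂ one u v ∷ M₂ one u w ∷ M₂ one u (v ⊕ w) ∷ M₂ one u (v ⊝ w) ∷ M₃ one u v w ∷ M one u ∷ []}
  ( hyp 1 v0 (con 27) (≤-of (M₂-one (pair a1 (λ ()) (λ ()) (λ ()))))
  ∷ hyp 1 v1 (con 27) (≤-of (M₂-one (pair a2 (λ ()) (λ ()) (λ ()))))
  ∷ hyp 1 v2 (con 27) (≤-of (M₂-one (pair (a1 ⟨+⟩ a2) (λ ()) (λ ()) (λ ()))))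
  ∷ hyp 1 v3 (con 27) (≤-of (M₂-one (pair (a1 ⟨-⟩ a2) (λ ()) (λ ()) (λ ()))))
  ∷ hyp 1 (v5 :+ 3 :* v4) (v0 :+ v1 :+ v2 :+ v3) (≥-of (M₂-pencil one u v w))
  ∷ hyp 3 (con 10) v4 p ∷ hyp 1 (con 81) v5 (M-one-≥ u) ∷ [])) (M₃-one-≥ u v w (M-one u (independent-≢ ind a0 λ ())))
  where
  pair = λ f → independent-pair ind a0 f (λ ())

-- Additive functionals

additive-zero : ∀ {n} (φ : Vec F₃ n → F₃) → (∀ u v → φ (u ⊕ v) ≡ φ u +₃ φ v) → φ 0ᵥ ≡ 0₃
additive-zero φ add = lemma (φ 0ᵥ) (trans (cong φ (sym (⊕-idˡ 0ᵥ))) (add 0ᵥ 0ᵥ))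
  where
  lemma : ∀ a → a ≡ a +₃ a → a ≡ 0₃
  lemma 0₃ _ = refl
  lemma 1₃ ()
  lemma 2₃ ()

additive-dot : ∀ {n} (φ : Vec F₃ n → F₃) → (∀ u v → φ (u ⊕ v) ≡ φ u +₃ φ v) → ∃ λ w → ∀ v → φ v ≡ w · v
additive-dot {zero} φ add = [] , λ { [] → additive-zero φ add }
additive-dot {suc n} φ add with additive-dot (λ v → φ (0₃ ∷ v)) (λ u v → add (0₃ ∷ u) (0₃ ∷ v))
... | w , p = φ (1₃ ∷ 0ᵥ) ∷ w , λ { (b ∷ v) → begin
  φ (b ∷ v)                          ≡⟨ cong φ (cong₂ _∷_ (sym (+₃-idʳ b)) (sym (⊕-idˡ v))) ⟩
  φ ((b ∷ 0ᵥ) ⊕ (0₃ ∷ v))            ≡⟨ add (b ∷ 0ᵥ) (0₃ ∷ v) ⟩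
  φ (b ∷ 0ᵥ) +₃ φ (0₃ ∷ v)           ≡⟨ cong₂ _+₃_ (trans (head b) (*₃-comm b _)) (p v) ⟩
  (φ (1₃ ∷ 0ᵥ) *₃ b) +₃ (w · v)      ∎ }
  where
  open ≡-Reasoning
  head : ∀ b → φ (b ∷ 0ᵥ) ≡ b *₃ φ (1₃ ∷ 0ᵥ)
  head 0₃ = trans (additive-zero φ add) (sym (*₃-zeroˡ (φ (1₃ ∷ 0ᵥ))))
  head 1₃ = sym (*₃-idˡ _)
  head 2₃ = trans (cong φ (cong (2₃ ∷_) (sym (⊕-idˡ 0ᵥ)))) (trans (add (1₃ ∷ 0ᵥ) (1₃ ∷ 0ᵥ)) (lemma (φ (1₃ ∷ 0ᵥ))))
    where
    lemma : ∀ a → a +₃ a ≡ 2₃ *₃ a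
    lemma = from-yes (all? λ a → (a +₃ a) F.≟ (2₃ *₃ a))

η : F₃ → ℕ
η 0₃ = 0
η (F.suc _) = 1

val : F₃ → ℕ
val 0₃ = 0
val 1₃ = 1
val 2₃ = 2

ρ₃-val : ∀ a → ρ₃ (val a) ≡ a
ρ₃-val 0₃ = refl
ρ₃-val 1₃ = refl
ρ₃-val 2₃ = refl

δ-neg : ∀ t → δ (2₃ *₃ t) ≡ δ t
δ-neg 0₃ = refl
δ-neg 1₃ = refl
δ-neg 2₃ = refl

M-⊖ : ∀ {n} (f : Vec F₃ n → ℕ) u → M f (⊖ u) ≡ M f u
M-⊖ f u = ∑-cong λ x → cong (_* f x) (trans (cong δ (·-scaleˡ 2₃ u x)) (δ-neg (u · x)))

abstract
  ∑-ρ₃ : ∀ {n} (f g : Vec F₃ n → ℕ) → (∀ v → ρ₃ (f v) ≡ ρ₃ (g v)) → ρ₃ (∑ f) ≡ ρ₃ (∑ g)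
  ∑-ρ₃ {zero} f g p = trans (cong ρ₃ (∑-[] f)) (trans (p []) (cong ρ₃ (sym (∑-[] g))))
  ∑-ρ₃ {suc n} f g p = trans (cong ρ₃ (∑-∷ f)) (trans (split (inner f)) (trans
    (cong₂ _+₃_ (step 0₃) (cong₂ _+₃_ (step 1₃) (step 2₃))) (sym (trans (cong ρ₃ (∑-∷ g)) (split (inner g))))))
    where
    inner : (Vec F₃ (suc n) → ℕ) → F₃ → ℕ
    inner h a = ∑ λ v → h (a ∷ v)
    split : ∀ h → ρ₃ (sum₃ h) ≡ ρ₃ (h 0₃) +₃ (ρ₃ (h 1₃) +₃ ρ₃ (h 2₃))
    split h = trans (ρ₃-+ (h 0₃) _) (cong (ρ₃ (h 0₃) +₃_) (ρ₃-+ (h 1₃) (h 2₃)))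
    step : ∀ a → ρ₃ (inner f a) ≡ ρ₃ (inner g a)
    step a = ∑-ρ₃ (λ v → f (a ∷ v)) (λ v → g (a ∷ v)) λ v → p (a ∷ v)

-- Lines through the origin

∑-F₃¹ : (h : Vec F₃ 1 → ℕ) → ∑ h ≡ sum₃ λ a → h (a ∷ [])
∑-F₃¹ h = trans (∑-∷ h) (sum₃-cong λ a → ∑-[] λ v → h (a ∷ v))

comb₁ : ∀ {n} a (y : Vec F₃ n) → comb (a ∷ []) (y ∷ []) ≡ scale a y
comb₁ a y = ⊕-idʳ (scale a y)

InSpan-⊕ : ∀ {n k} {us : Vec (Vec F₃ n) k} {u v} → InSpan us u → InSpan us v → InSpan us (u ⊕ v)
InSpan-⊕ {us = us} (cs , p) (ds , q) = cs ⊕ ds , trans (cong₂ _⊕_ p q) (sym (comb-⊕ cs ds us))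

InSpan-scale : ∀ {n k} {us : Vec (Vec F₃ n) k} {u} c → InSpan us u → InSpan us (scale c u)
InSpan-scale {us = us} c (cs , p) = scale c cs , trans (cong (scale c) p) (sym (comb-scale c cs us))

span₁-self : ∀ {n} (u : Vec F₃ n) → InSpan (u ∷ []) u
span₁-self u = 1₃ ∷ [] , sym (trans (comb₁ 1₃ u) (scale-1 u))

span₁-⊆ : ∀ {n k} {us : Vec (Vec F₃ n) k} {v u} → InSpan us v → InSpan (v ∷ []) u → InSpan us u
span₁-⊆ {us = us} {v} p (c ∷ [] , q) = subst (InSpan us) (sym (trans q (comb₁ c v))) (InSpan-scale c p)

span₁-sym : ∀ {n} {u v : Vec F₃ n} → ¬ v ≡ 0ᵥ → InSpan (u ∷ []) v → InSpan (v ∷ []) u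
span₁-sym {u = u} v≢0 (0₃ ∷ [] , p) = ⊥-elim (v≢0 (trans p (trans (comb₁ 0₃ u) (scale-0 u))))
span₁-sym {u = u} {v} v≢0 (1₃ ∷ [] , p) = subst (InSpan (v ∷ [])) (trans p (trans (comb₁ 1₃ u) (scale-1 u))) (span₁-self v)
span₁-sym {u = u} {v} v≢0 (2₃ ∷ [] , p) = 2₃ ∷ [] , trans (sym (⊖⊖ u)) (trans (cong ⊖_ (sym (trans p (comb₁ 2₃ u)))) (sym (comb₁ 2₃ v)))

span₁-trans : ∀ {n} {u v w : Vec F₃ n} → ¬ v ≡ 0ᵥ → InSpan (w ∷ []) v → InSpan (w ∷ []) u → InSpan (v ∷ []) u
span₁-trans v≢0 p q = span₁-⊆ (span₁-sym v≢0 p) q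

even-scale : ∀ {n} {f : Vec F₃ n → ℕ} → (∀ x → f (⊖ x) ≡ f x) → ∀ c → ¬ c ≡ 0₃ → ∀ x → f (scale c x) ≡ f x
even-scale even 0₃ p x = ⊥-elim (p refl)
even-scale {f = f} even 1₃ _ x = cong f (scale-1 x)
even-scale even 2₃ _ x = even x

M-mult₁ : ∀ (y u : V₅) → M (mult (y ∷ [])) u ≡ 1 + 2 * δ (u · y)
M-mult₁ y u = begin
  ∑ (λ v → δ (u · v) * mult (y ∷ []) v)            ≡⟨ ∑-cong (λ v → *-comm (δ (u · v)) _) ⟩
  ∑ (λ v → mult (y ∷ []) v * δ (u · v))            ≡⟨ ∑-mult (y ∷ []) (λ v → δ (u · v)) ⟩
  ∑ (λ cs → δ (u · comb cs (y ∷ [])))              ≡⟨ ∑-F₃¹ _ ⟩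
  sum₃ (λ a → δ (u · comb (a ∷ []) (y ∷ [])))      ≡⟨ sum₃-cong (λ a → cong δ (trans (cong (u ·_) (comb₁ a y)) (·-scaleʳ a u y))) ⟩
  sum₃ (λ a → δ (a *₃ (u · y)))                    ≡⟨ lemma (u · y) ⟩
  1 + 2 * δ (u · y)                                ∎
  where
  open ≡-Reasoning
  lemma : ∀ t → sum₃ (λ a → δ (a *₃ t)) ≡ 1 + 2 * δ t
  lemma 0₃ = refl
  lemma 1₃ = refl
  lemma 2₃ = refl

on-mult : ∀ {k} (us : Vec V₅ k) x → (∀ i → lookup us i · x ≡ 0₃) → ∀ v → on x (mult us) v ≡ mult us v
on-mult us x p v = decide (InSpan? us v)
  where
  decide : Dec (InSpan us v) → on x (mult us) v ≡ mult us v
  decide (yes (cs , q)) = trans (cong (λ t → δ t * mult us v)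
    (trans (cong (x ·_) q) (trans (·-comm x (comb cs us)) (⊥-comb us x p cs)))) (+-identityʳ _)
  decide (no q) = trans (cong (δ (x · v) *_) (mult-∉ us q)) (trans (*-zeroʳ (δ (x · v))) (sym (mult-∉ us q)))

∑-mult-one : ∀ {k} (us : Vec V₅ k) → ∑ (mult us) ≡ 3 ^ k
∑-mult-one {k} us = trans (∑-cong λ v → sym (*-identityʳ (mult us v))) (trans (∑-mult us λ _ → 1)
  (trans (∑-const k 1) (*-identityʳ (3 ^ k))))

escape-span : ∀ {k} (us : Vec V₅ k) → Independent us → (g : V₅ → ℕ) → (∀ v → g v ≤ 1) → 3 ^ k < ∑ g → ∃ λ v → 1 ≤ g v × ¬ InSpan us v
escape-span {k} us ind g bit big = [ id , (λ none → ⊥-elim (absurd none)) ]′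
  (search λ v → (1 ≤? g v) ×-dec ¬? (InSpan? us v))
  where
  absurd : (∀ v → ¬ (1 ≤ g v × ¬ InSpan us v)) → ⊥
  absurd none = 1+n≰n (≤-trans big (≤-trans (∑-mono λ v → bound v (1 ≤? g v) (InSpan? us v)) (≤-of (∑-mult-one us))))
    where
    bound : ∀ v → Dec (1 ≤ g v) → Dec (InSpan us v) → g v ≤ mult us v
    bound v (no i) _ = ≤-trans (≤-pred (≰⇒> i)) z≤n
    bound v (yes i) (yes j) = ≤-trans (bit v) (≥-of (mult-∈ us ind j))
    bound v (yes i) (no j) = ⊥-elim (none v (i , j))

M-mult-⊥ : ∀ {k} (us : Vec V₅ k) x → (∀ i → lookup us i · x ≡ 0₃) → M (mult us) x ≡ 3 ^ k
M-mult-⊥ us x p = trans (∑-cong (on-mult us x p)) (∑-mult-one us)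

M₂-one-same : ∀ y a → ¬ y ≡ 0ᵥ → M₂ one y (scale a y) ≡ 81
M₂-one-same y a y≢0 = trans (∑-cong same) (M-one y y≢0)
  where
  lemma : ∀ a t → δ (a *₃ t) * (δ t * 1) ≡ δ t * 1
  lemma a 0₃ = cong (λ t → δ t * 1) (*₃-zeroʳ a)
  lemma a (F.suc t) = *-zeroʳ (δ (a *₃ F.suc t))
  same : ∀ x → on (scale a y) (on y one) x ≡ on y one x
  same x = trans (cong (λ t → δ t * (δ (y · x) * 1)) (·-scaleˡ a y x)) (lemma a (y · x))

-- Generically two equations leave 27 vectors; if c is a multiple of y, zero included, its equation
-- adds nothing and 81 remain. One formula for both cases keeps the later counts linear.
M₂-one-mult : ∀ y c → ¬ y ≡ 0ᵥ → M₂ one y c ≡ 27 + 54 * mult (y ∷ []) c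
M₂-one-mult y c y≢0 = decide (InSpan? (y ∷ []) c)
  where
  decide : Dec (InSpan (y ∷ []) c) → M₂ one y c ≡ 27 + 54 * mult (y ∷ []) c
  decide (yes i@(a ∷ [] , q)) = trans (cong (M₂ one y) (trans q (comb₁ a y))) (trans (M₂-one-same y a y≢0)
    (cong (λ m → 27 + 54 * m) (sym (mult-∈ (y ∷ []) (independent₁ y≢0) i))))
  decide (no i) = trans (trans (M₂-comm one y c) (M₂-one (independent-∷ (independent₁ y≢0) i)))
    (cong (λ m → 27 + 54 * m) (sym (mult-∉ (y ∷ []) i)))

mult-self : ∀ {y : V₅} → ¬ y ≡ 0ᵥ → mult (y ∷ []) y ≡ 1
mult-self {y} y≢0 = mult-∈ (y ∷ []) (independent₁ y≢0) (span₁-self y)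

mult-0 : ∀ {k} {us : Vec V₅ k} → Independent us → mult us 0ᵥ ≡ 1
mult-0 {us = us} ind = mult-∈ us ind (0ᵥ , sym (comb-0 us))

-- Weighing f along the vectors orthogonal to X, with those in the span of u and a, where f is fully supported, apart.
spread : ∀ (F : V₅ → ℕ) u a {X} m → F 0ᵥ ≡ 0 → (∀ x → F (⊖ x) ≡ F x) → Independent (u ∷ a ∷ []) → ¬ X ≡ 0ᵥ → u · X ≡ 0₃ → a · X ≡ 0₃ →
  (∀ v → m ≤ M₃ F a u v) → 4 * m ≤ M₂ F a u + 6 * F X
spread F u a {X} m F-0 F-⊖ ind X≢0 u⊥X a⊥X low = by-contra λ r → farkas
  {ρ = m ∷ ∑ f ∷ F X ∷ ∑ (λ v → g v * M f v) ∷ []}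
  ( hyp 18 (con 1 :+ (v1 :+ 6 :* v2)) (4 :* v0) r ∷ hyp 1 v3 (27 :* v1 :+ 108 :* v2) upper
  ∷ hyp 1 (81 :* v0 :+ 9 :* v1) (v3 :+ 9 :* v0) lower ∷ [])
  where
  us : Vec V₅ 2
  us = u ∷ a ∷ []
  f : V₅ → ℕ
  f = on u (on a F)
  g : V₅ → ℕ
  g v = δ (X · v) * 1
  Xs : Vec V₅ 1
  Xs = X ∷ []
  f≤F : ∀ x → f x ≤ F x
  f≤F x = ≤-trans (δ-≤ (u · x) (on a F x)) (δ-≤ (a · x) (F x))
  -- Of the 81 forms vanishing at X, 27 vanish at a vector y off the line of X and all 81 at a
  -- multiple of X: 54 extra for each of X and its negative.
  upper : ∑ (λ v → g v * M f v) ≤ 27 * ∑ f + 108 * F X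
  upper = begin
    ∑ (λ v → g v * M f v)                                        ≡⟨ M-swap f g ⟩
    ∑ (λ y → f y * M g y)                                        ≡⟨ ∑-cong (λ y → trans (cong (f y *_) (M₂-one-mult X y X≢0)) (expand (f y) (mult Xs y))) ⟩
    ∑ (λ y → 27 * f y + mult Xs y * (54 * f y))                  ≡⟨ ∑-+ (λ y → 27 * f y) (λ y → mult Xs y * (54 * f y)) ⟩
    ∑ (λ y → 27 * f y) + ∑ (λ y → mult Xs y * (54 * f y))        ≡⟨ cong₂ _+_ (∑-* 27 f) (trans (∑-mult Xs (λ y → 54 * f y)) (∑-F₃¹ _)) ⟩
    27 * ∑ f + sum₃ (λ c → 54 * f (comb (c ∷ []) Xs))            ≤⟨ +-monoʳ-≤ (27 * ∑ f) (≤-trans (+-mono-≤ (at 0₃) (+-mono-≤ (at 1₃) (at 2₃))) (≤-of (collect (F X)))) ⟩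
    27 * ∑ f + 108 * F X                                         ∎
    where
    open ≤-Reasoning
    expand : ∀ k m → k * (27 + 54 * m) ≡ 27 * k + m * (54 * k)
    expand = solve-∀
    collect : ∀ m → 0 + (54 * m + 54 * m) ≡ 108 * m
    collect = solve-∀
    bound : F₃ → ℕ
    bound 0₃ = 0
    bound (F.suc _) = 54 * F X
    F-at : ∀ c → 54 * F (scale c X) ≤ bound c
    F-at 0₃ = ≤-of (cong (54 *_) (trans (cong F (scale-0 X)) F-0))
    F-at 1₃ = ≤-of (cong (λ x → 54 * F x) (scale-1 X))
    F-at 2₃ = ≤-of (cong (54 *_) (F-⊖ X))
    at : ∀ c → 54 * f (comb (c ∷ []) Xs) ≤ bound c
    at c = ≤-trans (*-monoʳ-≤ 54 (≤-trans (f≤F (comb (c ∷ []) Xs)) (≤-of (cong F (comb₁ c X))))) (F-at c)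
  full : ∀ cs → M f (comb cs us) ≡ ∑ f
  full cs = ∑-cong λ y → same y (u · y) (a · y) refl refl
    where
    zero-at : ∀ y → f y ≡ 0 → on (comb cs us) f y ≡ f y
    zero-at y z = trans (cong (δ (comb cs us · y) *_) z) (trans (*-zeroʳ (δ (comb cs us · y))) (sym z))
    same : ∀ y s t → u · y ≡ s → a · y ≡ t → on (comb cs us) f y ≡ f y
    same y 0₃ 0₃ p q = trans (cong (λ t → δ t * f y) (⊥-comb us y (⊥₂ {u = u} {a} {y} p q) cs)) (+-identityʳ (f y))
    same y (F.suc s) t p q = zero-at y (cong (λ s → δ s * on a F y) p)
    same y 0₃ (F.suc t) p q = zero-at y (trans (cong (λ t → δ (u · y) * (δ t * F y)) q) (*-zeroʳ (δ (u · y))))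
  us⊥X : ∀ i → lookup us i · X ≡ 0₃
  us⊥X = ⊥₂ {u = u} {a} {X} u⊥X a⊥X
  -- Of the 81 vectors orthogonal to X, the nine in the span of u and a carry all of `∑ f`, the
  -- other 72 at least m. Both corrections are added across, to avoid subtraction.
  lower : 81 * m + 9 * ∑ f ≤ ∑ (λ v → g v * M f v) + 9 * m
  lower = begin
    81 * m + 9 * ∑ f
      ≡⟨ cong₂ _+_ (trans (*-comm 81 m) (sym (trans (∑-* m g) (cong (m *_) (M-one X X≢0))))) (sym (trans (∑-mult us λ _ → ∑ f) (∑-const 2 (∑ f)))) ⟩
    ∑ (λ v → m * g v) + ∑ (λ v → mult us v * ∑ f)
      ≡⟨ sym (∑-+ (λ v → m * g v) (λ v → mult us v * ∑ f)) ⟩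
    ∑ (λ v → m * g v + mult us v * ∑ f)
      ≤⟨ ∑-mono (λ v → decide v (InSpan? us v)) ⟩
    ∑ (λ v → g v * M f v + mult us v * m)
      ≡⟨ ∑-+ (λ v → g v * M f v) (λ v → mult us v * m) ⟩
    ∑ (λ v → g v * M f v) + ∑ (λ v → mult us v * m)
      ≡⟨ cong (∑ (λ v → g v * M f v) +_) (trans (∑-mult us λ _ → m) (∑-const 2 m)) ⟩
    ∑ (λ v → g v * M f v) + 9 * m ∎
    where
    open ≤-Reasoning
    inside : ∀ {t k n} → t ≡ 1 → k ≡ 1 → n ≡ ∑ f → m * t + k * ∑ f ≤ t * n + k * m
    inside refl refl refl = ≤-of (lemma m (∑ f))
      where
      lemma : ∀ m n → m * 1 + (n + 0) ≡ n + 0 + (m + 0)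
      lemma = solve-∀
    outside : ∀ {t k n} → k ≡ 0 → m ≤ n → m * t + k * ∑ f ≤ t * n + k * m
    outside {t} refl p = +-monoˡ-≤ 0 (≤-trans (≤-of (*-comm m t)) (*-monoʳ-≤ t p))
    decide : ∀ v → Dec (InSpan us v) → m * g v + mult us v * ∑ f ≤ g v * M f v + mult us v * m
    decide v (yes i@(cs , p)) = inside (cong (λ t → δ t * 1) (trans (cong (X ·_) p) (trans (·-comm X _) (⊥-comb us X us⊥X cs))))
      (mult-∈ us ind i) (trans (cong (M f) p) (full cs))
    decide v (no i) = outside {g v} (mult-∉ us i) (low v)

-- Divisibility of the excess by three

module Divisibility (F : V₅ → ℕ) (F-⊖ : ∀ x → F (⊖ x) ≡ F x) (F-0 : F 0ᵥ ≡ 0) (∑-F : ∑ F ≡ 140)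
  (k : V₅ → ℕ) (M-F : ∀ v → M F v ≡ 44 + 2 * k v) (a₀ : V₅) (k-a₀ : k a₀ ≡ 0) where

  k-0 : k 0ᵥ ≡ 48
  k-0 = *-cancelˡ-≡ (k 0ᵥ) 48 2 (+-cancelˡ-≡ 44 _ 96 (trans (sym (M-F 0ᵥ)) (trans (M-0ᵥ F) ∑-F)))

  k-⊖ : ∀ v → k (⊖ v) ≡ k v
  k-⊖ v = *-cancelˡ-≡ _ _ 2 (+-cancelˡ-≡ 44 _ _ (trans (sym (M-F (⊖ v))) (trans (M-⊖ F v) (M-F v))))

  k≡0→≢0 : ∀ {v} → k v ≡ 0 → ¬ v ≡ 0ᵥ
  k≡0→≢0 p refl with trans (sym p) k-0
  ... | ()

  -- The assumption `none` says that each plane of the solid a missing the point p lies on a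
  -- hyperplane of positive excess. This raises the masses of such planes, then of the lines in
  -- them, then of the planes again, until their average is too large.
  module NoTransversal (a p : V₅) (k-a : k a ≡ 0) (p≢0 : ¬ p ≡ 0ᵥ) (a⊥p : a · p ≡ 0₃)
    (none : ∀ d → ¬ (¬ d · p ≡ 0₃ × k d ≡ 0 × k (a ⊕ d) ≡ 0 × k (a ⊝ d) ≡ 0)) where

    M₂-≥12 : ∀ d → 12 ≤ M₂ F a d
    M₂-≥12 d = by-contra λ q → farkas {ρ = M F a ∷ M F d ∷ M F (a ⊕ d) ∷ M F (a ⊝ d) ∷ M₂ F a d ∷ ∑ F ∷ []}
      ( hyp 1 (con 44) v0 (above a) ∷ hyp 1 (con 44) v1 (above d)
      ∷ hyp 1 (con 44) v2 (above (a ⊕ d)) ∷ hyp 1 (con 44) v3 (above (a ⊝ d))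
      ∷ hyp 1 (v0 :+ v1 :+ v2 :+ v3) (v5 :+ 3 :* v4) (≤-of (M-pencil F a d))
      ∷ hyp 3 (con 1 :+ v4) (con 12) q ∷ hyp 1 v5 (con 140) (≤-of ∑-F) ∷ [])
      where
      above : ∀ v → 44 ≤ M F v
      above v = ≤-trans (m≤m+n 44 _) (≥-of (M-F v))

    -- 3 M₂ = 36 + 2 Σk over the pencil, so M₂ is even, and it exceeds 12 when Σk > 0.
    M₂-≥14 : ∀ d → ¬ d · p ≡ 0₃ → 14 ≤ M₂ F a d
    M₂-≥14 d d·p≢0 = by-contra λ q → case (k d + k (a ⊕ d) + k (a ⊝ d)) ≤? 1 of λ
      { (yes r) → farkas {ρ = ρ} (hyp 3 (con 13) v0 (low pos)
          ∷ hyp 1 (con 140 :+ 3 :* v0) (con 176 :+ 2 :* vk) (≥-of pencil) ∷ hyp 2 vk con-1 r ∷ [])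
      ; (no r) → farkas {ρ = ρ} (hyp 2 (con 2) vk (≰⇒> r) ∷ hyp 3 (con 1 :+ v0) (con 14) q
          ∷ hyp 1 (con 176 :+ 2 :* vk) (con 140 :+ 3 :* v0) (≤-of pencil) ∷ []) }
      where
      ρ : Vec ℕ 4
      ρ = M₂ F a d ∷ k d ∷ k (a ⊕ d) ∷ k (a ⊝ d) ∷ []
      con-1 : Lin 4
      con-1 = con 1
      vk : Lin 4
      vk = v1 :+ v2 :+ v3
      pos : 1 ≤ k d + k (a ⊕ d) + k (a ⊝ d)
      pos = n≢0⇒n>0 λ z → none d (d·p≢0 , m+n≡0⇒m≡0 (k d) (m+n≡0⇒m≡0 (k d + k (a ⊕ d)) z)
        , m+n≡0⇒n≡0 (k d) (m+n≡0⇒m≡0 (k d + k (a ⊕ d)) z) , m+n≡0⇒n≡0 (k d + k (a ⊕ d)) z)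
      pencil : 176 + 2 * (k d + k (a ⊕ d) + k (a ⊝ d)) ≡ 140 + 3 * M₂ F a d
      pencil with M-pencil F a d
      ... | e rewrite M-F a | M-F d | M-F (a ⊕ d) | M-F (a ⊝ d) | ∑-F | k-a = trans (expand (k d) (k (a ⊕ d)) (k (a ⊝ d))) e
        where
        expand : ∀ x y z → 176 + 2 * (x + y + z) ≡ 44 + (44 + 2 * x) + (44 + 2 * y) + (44 + 2 * z)
        expand = solve-∀
      low : 1 ≤ k d + k (a ⊕ d) + k (a ⊝ d) → 13 ≤ M₂ F a d
      low pos = by-contra λ q → farkas {ρ = ρ} (hyp 3 (con 1 :+ v0) (con 13) q ∷ hyp 2 con-1 vk pos
          ∷ hyp 1 (con 176 :+ 2 :* vk) (con 140 :+ 3 :* v0) (≤-of pencil) ∷ [])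

    M₂-≥ : ∀ d → 12 + 2 * η (d · p) ≤ M₂ F a d
    M₂-≥ d with d · p in eq
    ... | 0₃ = M₂-≥12 d
    ... | F.suc _ = M₂-≥14 d λ q → case trans (sym q) eq of λ ()

    -- Such a line misses p, so three of the four planes of a through it miss p as well, and 3 M₃ is
    -- at least 4 * 12 + 3 * 2 - 44 = 10.
    M₃-≥4 : ∀ u v → ¬ u · p ≡ 0₃ → 4 ≤ M₃ F a u v
    M₃-≥4 u v u·p≢0 = by-contra λ q →
      farkas {ρ = M₂ F a u ∷ M₂ F a v ∷ M₂ F a (u ⊕ v) ∷ M₂ F a (u ⊝ v) ∷ M₃ F a u v ∷ M F a
        ∷ η (u · p) ∷ η (v · p) ∷ η ((u ⊕ v) · p) ∷ η ((u ⊝ v) · p) ∷ []}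
      ( hyp 1 (con 12 :+ 2 :* v6) v0 (M₂-≥ u) ∷ hyp 1 (con 12 :+ 2 :* v7) v1 (M₂-≥ v)
      ∷ hyp 1 (con 12 :+ 2 :* v8) v2 (M₂-≥ (u ⊕ v)) ∷ hyp 1 (con 12 :+ 2 :* v9) v3 (M₂-≥ (u ⊝ v))
      ∷ hyp 1 (v0 :+ v1 :+ v2 :+ v3) (v5 :+ 3 :* v4) (≤-of (M₂-pencil F a u v))
      ∷ hyp 3 (con 1 :+ v4) (con 4) q
      ∷ hyp 1 v5 (con 44) (≤-of (trans (M-F a) (cong (λ t → 44 + 2 * t) k-a)))
      ∷ hyp 2 (con 3) (v6 :+ v7 :+ v8 :+ v9) (≥-of ηs) ∷ [])
      where
      three : ∀ s t → ¬ s ≡ 0₃ → η s + η t + η (s +₃ t) + η (s +₃ (-₃ t)) ≡ 3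
      three 0₃ t r = ⊥-elim (r refl)
      three 1₃ 0₃ r = refl
      three 1₃ 1₃ r = refl
      three 1₃ 2₃ r = refl
      three 2₃ 0₃ r = refl
      three 2₃ 1₃ r = refl
      three 2₃ 2₃ r = refl
      ηs : η (u · p) + η (v · p) + η ((u ⊕ v) · p) + η ((u ⊝ v) · p) ≡ 3
      ηs rewrite ·-⊕ˡ u v p | ·-⊝ˡ u v p = three (u · p) (v · p) u·p≢0

    independent-au : ∀ u → ¬ u · p ≡ 0₃ → Independent (u ∷ a ∷ [])
    independent-au u r = independent-∷ (independent₁ (k≡0→≢0 k-a)) (∉-span p (⊥₁ {u = a} {p} a⊥p) r)

    Hole : V₅ → V₅ → Set
    Hole u x = ¬ x ≡ 0ᵥ × a · x ≡ 0₃ × u · x ≡ 0₃ × F x ≡ 0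

    M₂-≥16-full : ∀ u → (∀ x → ¬ Hole u x) → 16 ≤ M₂ F a u
    M₂-≥16-full u full = by-contra λ q → farkas {ρ = M₂ F a u ∷ ∑ {5} (λ x → 𝟙 x 0ᵥ * 1) ∷ []}
      ( hyp 1 (con 27) (v0 :+ v1) count ∷ hyp 1 (con 1 :+ v0) (con 16) q ∷ hyp 1 v1 (con 1) (≤-of (∑-point 0ᵥ λ _ → 1)) ∷ [])
      where
      bound : ∀ x → on u (on a one) x ≤ on u (on a F) x + 𝟙 x 0ᵥ * 1
      bound x with x ≟ᵥ 0ᵥ
      ... | yes refl = ≤-trans (≤-trans (δ-≤ (u · x) _) (δ-≤ (a · x) 1)) (m≤n+m 1 _)
      ... | no x≢0 with u · x in eu | a · x in ea
      ...   | F.suc _ | _ = z≤n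
      ...   | 0₃ | F.suc _ = z≤n
      ...   | 0₃ | 0₃ = ≤-trans (n≢0⇒n>0 λ Fx≡0 → full x (x≢0 , ea , eu , Fx≡0))
                          (≥-of (trans (+-identityʳ _) (trans (+-identityʳ _) (+-identityʳ _))))
      count : 27 ≤ M₂ F a u + ∑ (λ x → 𝟙 x 0ᵥ * 1)
      count = ≤-trans (M₂-one-≥ a u) (≤-trans (∑-mono bound) (≤-of (∑-+ (on u (on a F)) (λ x → 𝟙 x 0ᵥ * 1))))

    M₂-≥16-hole : ∀ u → ¬ u · p ≡ 0₃ → ∀ x → Hole u x → 16 ≤ M₂ F a u
    M₂-≥16-hole u r x (x≢0 , a⊥x , u⊥x , Fx≡0) = ≤-trans (spread F u a 4 F-0 F-⊖ (independent-au u r) x≢0 u⊥x a⊥x λ v → M₃-≥4 u v r)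
      (≤-of (trans (cong (λ m → M₂ F a u + 6 * m) Fx≡0) (+-identityʳ (M₂ F a u))))

    -- Through a hole of the plane pass four lines that cover it, each of doubled mass at least 4. A
    -- plane without holes has 13 positive points, hence doubled mass at least 26.
    M₂-≥16 : ∀ u → ¬ u · p ≡ 0₃ → 16 ≤ M₂ F a u
    M₂-≥16 u r = [ (λ { (x , h) → M₂-≥16-hole u r x h }) , M₂-≥16-full u ]′
      (search λ x → ¬? (x ≟ᵥ 0ᵥ) ×-dec (a · x) F.≟ 0₃ ×-dec (u · x) F.≟ 0₃ ×-dec (F x ≟ 0))

    -- The 162 forms d not vanishing at p contribute at least 16 each. On the other hand a nonzero
    -- vector lies on at most 81 - 27 = 54 of them, so their sum is at most 54 * 44, and 2376 <
    -- 2592.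
    contradiction : ⊥
    contradiction = farkas {ρ = ∑ g ∷ ∑ (λ d → g d * M f d) ∷ ∑ f ∷ []}
      ( hyp 16 (con 162) v0 total-η ∷ hyp 1 (16 :* v0) v1 lower ∷ hyp 1 v1 (54 :* v2) upper ∷ hyp 54 v2 (con 44) ∑-f ∷ [])
      where
      f = on a F
      g : V₅ → ℕ
      g d = η (p · d) * 1
      ∑-f : ∑ f ≤ 44
      ∑-f = ≤-of (trans (M-F a) (cong (λ t → 44 + 2 * t) k-a))
      η+δ : ∀ y → M g y + M₂ one p y ≡ M one y
      η+δ y = trans (sym (∑-+ (on y g) (on y (on p one)))) (∑-cong λ d → lemma (δ (y · d)) (p · d))
        where
        lemma : ∀ m t → m * (η t * 1) + m * (δ t * 1) ≡ m * 1
        lemma m 0₃ = trans (cong (_+ m * 1) (*-zeroʳ m)) refl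
        lemma m (F.suc _) = trans (cong (m * 1 +_) (*-zeroʳ m)) (+-identityʳ _)
      total-η : 162 ≤ ∑ g
      total-η = by-contra λ q → farkas {ρ = ∑ g ∷ M g 0ᵥ ∷ M₂ one p 0ᵥ ∷ M one p ∷ M one 0ᵥ ∷ ∑ one ∷ []}
        ( hyp 1 (con 1 :+ v0) (con 162) q ∷ hyp 1 v1 v0 (≤-of (M-0ᵥ g)) ∷ hyp 1 v2 v3 (≤-of (M-0ᵥ (on p one)))
        ∷ hyp 1 v3 (con 81) (≤-of (M-one p p≢0)) ∷ hyp 1 v4 (v1 :+ v2) (≥-of (η+δ 0ᵥ))
        ∷ hyp 1 v5 v4 (≥-of (M-0ᵥ one)) ∷ hyp 1 (con 243) v5 (≥-of ∑-one) ∷ [])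
      lower : 16 * ∑ g ≤ ∑ (λ d → g d * M f d)
      lower = ≤-trans (≥-of (∑-* 16 g)) (∑-mono bound)
        where
        bound : ∀ d → 16 * g d ≤ g d * M f d
        bound d with p · d in eq
        ... | 0₃ = z≤n
        ... | F.suc _ = ≤-trans (M₂-≥16 d λ z → case trans (sym eq) (trans (·-comm p d) z) of λ ())
                          (≥-of (+-identityʳ (M₂ F a d)))
      upper : ∑ (λ d → g d * M f d) ≤ 54 * ∑ f
      upper = ≤-trans (≤-of (M-swap f g)) (≤-trans (∑-mono bound) (≤-of (∑-* 54 f)))
        where
        f-0 : f 0ᵥ ≡ 0
        f-0 = trans (cong (δ (a · 0ᵥ) *_) F-0) (*-zeroʳ (δ (a · 0ᵥ)))
        bound : ∀ y → f y * M g y ≤ 54 * f y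
        bound y with y ≟ᵥ 0ᵥ
        ... | yes refl rewrite f-0 = z≤n
        ... | no y≢0 = ≤-trans (*-monoʳ-≤ (f y) small) (≤-of (*-comm (f y) 54))
          where
          small : M g y ≤ 54
          small = by-contra λ q → farkas {ρ = M g y ∷ M₂ one p y ∷ M one y ∷ []}
            ( hyp 1 (con 55) v0 q ∷ hyp 1 (con 27) v1 (M₂-one-≥ p y) ∷ hyp 1 (v0 :+ v1) v2 (≤-of (η+δ y))
            ∷ hyp 1 v2 (con 81) (≤-of (M-one y y≢0)) ∷ [])

  -- Since k vanishes at both a + d and a - d, `φ-zero` gives φ a d = 0 for a form d that does not
  -- vanish at p: no nonzero functional represented by such a p can be φ a.
  transversal : ∀ a p → k a ≡ 0 → ¬ p ≡ 0ᵥ → a · p ≡ 0₃ →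
    ∃ λ d → ¬ d · p ≡ 0₃ × k d ≡ 0 × k (a ⊕ d) ≡ 0 × k (a ⊝ d) ≡ 0
  transversal a p k-a p≢0 a⊥p = [ id , (λ none → ⊥-elim (NoTransversal.contradiction a p k-a p≢0 a⊥p none)) ]′
    (search λ d → ¬? ((d · p) F.≟ 0₃) ×-dec (k d ≟ 0) ×-dec (k (a ⊕ d) ≟ 0) ×-dec (k (a ⊝ d) ≟ 0))

  κ : V₅ → F₃
  κ v = ρ₃ (k v)

  -- The symmetric bilinear form summing F(x)(c·x)(a·x) over F₃, computed in ℕ through the
  -- representatives `val`.
  φ : V₅ → V₅ → F₃
  φ c a = ρ₃ (∑ λ x → F x * val ((c · x) *₃ (a · x)))

  φ-comm : ∀ c a → φ c a ≡ φ a c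
  φ-comm c a = cong ρ₃ (∑-cong λ x → cong (λ t → F x * val t) (*₃-comm (c · x) (a · x)))

  φ-additive : ∀ c a b → φ c (a ⊕ b) ≡ φ c a +₃ φ c b
  φ-additive c a b = trans (∑-ρ₃ _ (λ x → F x * val ((c · x) *₃ (a · x)) + F x * val ((c · x) *₃ (b · x))) pointwise)
    (trans (cong ρ₃ (∑-+ (λ x → F x * val ((c · x) *₃ (a · x))) (λ x → F x * val ((c · x) *₃ (b · x)))))
      (ρ₃-+ (∑ λ x → F x * val ((c · x) *₃ (a · x))) (∑ λ x → F x * val ((c · x) *₃ (b · x)))))
    where
    pointwise : ∀ x → ρ₃ (F x * val ((c · x) *₃ ((a ⊕ b) · x)))
      ≡ ρ₃ (F x * val ((c · x) *₃ (a · x)) + F x * val ((c · x) *₃ (b · x)))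
    pointwise x rewrite ·-⊕ˡ a b x | ρ₃-+ (F x * val ((c · x) *₃ (a · x))) (F x * val ((c · x) *₃ (b · x)))
      | ρ₃-* (F x) (val ((c · x) *₃ ((a · x) +₃ (b · x)))) | ρ₃-* (F x) (val ((c · x) *₃ (a · x)))
      | ρ₃-* (F x) (val ((c · x) *₃ (b · x))) | ρ₃-val ((c · x) *₃ ((a · x) +₃ (b · x)))
      | ρ₃-val ((c · x) *₃ (a · x)) | ρ₃-val ((c · x) *₃ (b · x))
      = trans (cong (ρ₃ (F x) *₃_) (*₃-distribˡ (c · x) (a · x) (b · x))) (*₃-distribˡ (ρ₃ (F x)) _ _)

  -- Modulo 3, the number of points off a hyperplane is a quadratic form, with polar form φ.
  q : V₅ → ℕ
  q v = ∑ λ x → F x * η (v · x)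

  -- On and off a hyperplane there are 140 ≡ 2 in total, and 44 + 2k ≡ 2 + 2κ of them lie on it.
  q≡κ : ∀ v → ρ₃ (q v) ≡ κ v
  q≡κ v = lemma (ρ₃ (q v)) (κ v) (trans (cong (ρ₃ (q v) +₃_) (sym (trans (cong ρ₃ (M-F v))
    (trans (ρ₃-+ 44 (2 * k v)) (cong (2₃ +₃_) (ρ₃-* 2 (k v)))))))
    (trans (sym (ρ₃-+ (q v) (M F v))) (cong ρ₃ (trans (sym (∑-+ (λ x → F x * η (v · x)) (on v F)))
      (trans (∑-cong λ x → split (F x) (v · x)) ∑-F)))))
    where
    split : ∀ m t → m * η t + δ t * m ≡ m
    split m 0₃ = trans (cong (_+ (m + 0)) (*-zeroʳ m)) (+-identityʳ m)
    split m (F.suc _) = trans (+-identityʳ _) (*-identityʳ m)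
    lemma : ∀ a b → a +₃ (2₃ +₃ (2₃ *₃ b)) ≡ 2₃ → a ≡ b
    lemma 0₃ 0₃ _ = refl
    lemma 1₃ 1₃ _ = refl
    lemma 2₃ 2₃ _ = refl
    lemma 0₃ 1₃ ()
    lemma 0₃ 2₃ ()
    lemma 1₃ 0₃ ()
    lemma 1₃ 2₃ ()
    lemma 2₃ 0₃ ()
    lemma 2₃ 1₃ ()

  -- Modulo 3, η(t) is t², and (s + t)² - (s - t)² = 4st = st.
  κ-polar : ∀ c a → κ (c ⊕ a) ≡ κ (c ⊝ a) +₃ φ c a
  κ-polar c a = trans (sym (q≡κ (c ⊕ a))) (trans (∑-ρ₃ _ (λ x → F x * η ((c ⊝ a) · x) + F x * val ((c · x) *₃ (a · x))) pointwise)
    (trans (cong ρ₃ (∑-+ (λ x → F x * η ((c ⊝ a) · x)) (λ x → F x * val ((c · x) *₃ (a · x)))))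
      (trans (ρ₃-+ (q (c ⊝ a)) (∑ λ x → F x * val ((c · x) *₃ (a · x)))) (cong (_+₃ φ c a) (q≡κ (c ⊝ a))))))
    where
    polar : ∀ s t → ρ₃ (η (s +₃ t)) ≡ ρ₃ (η (s +₃ (-₃ t))) +₃ (s *₃ t)
    polar = from-yes (all? λ s → all? λ t → ρ₃ (η (s +₃ t)) F.≟ (ρ₃ (η (s +₃ (-₃ t))) +₃ (s *₃ t)))
    pointwise : ∀ x → ρ₃ (F x * η ((c ⊕ a) · x)) ≡ ρ₃ (F x * η ((c ⊝ a) · x) + F x * val ((c · x) *₃ (a · x)))
    pointwise x rewrite ·-⊕ˡ c a x | ·-⊝ˡ c a x
      | ρ₃-+ (F x * η ((c · x) +₃ (-₃ (a · x)))) (F x * val ((c · x) *₃ (a · x)))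
      | ρ₃-* (F x) (η ((c · x) +₃ (a · x))) | ρ₃-* (F x) (η ((c · x) +₃ (-₃ (a · x))))
      | ρ₃-* (F x) (val ((c · x) *₃ (a · x))) | ρ₃-val ((c · x) *₃ (a · x))
      = trans (cong (ρ₃ (F x) *₃_) (polar (c · x) (a · x))) (*₃-distribˡ (ρ₃ (F x)) _ _)

  φ-zero : ∀ c a → κ (c ⊕ a) ≡ 0₃ → κ (c ⊝ a) ≡ 0₃ → φ c a ≡ 0₃
  φ-zero c a p r = trans (sym (+₃-idˡ (φ c a))) (trans (cong (_+₃ φ c a) (sym r)) (trans (sym (κ-polar c a)) p))

  κ-0 : κ 0ᵥ ≡ 0₃
  κ-0 = cong ρ₃ k-0

  ⊕-self : ∀ (v : V₅) → v ⊕ v ≡ ⊖ v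
  ⊕-self v = by-coef (v ∷ []) (a0 ⟨+⟩ a0) (2₃ ⟨*⟩ a0) refl

  -- A nonzero functional vanishing on all minimal hyperplanes would contradict transversal.
  φ-minimal : ∀ a → k a ≡ 0 → ∀ c → φ a c ≡ 0₃
  φ-minimal a k-a c = step (additive-dot (φ a) (φ-additive a))
    where
    step : (∃ λ w → ∀ v → φ a v ≡ w · v) → φ a c ≡ 0₃
    step (w , φ≡w) = decide (w ≟ᵥ 0ᵥ)
      where
      a⊥w : a · w ≡ 0₃
      a⊥w = trans (·-comm a w) (trans (sym (φ≡w a)) (φ-zero a a
        (cong ρ₃ (trans (cong k (⊕-self a)) (trans (k-⊖ a) k-a))) (trans (cong κ (⊝-self a)) κ-0)))
      absurd : (∃ λ d → ¬ d · w ≡ 0₃ × k d ≡ 0 × k (a ⊕ d) ≡ 0 × k (a ⊝ d) ≡ 0) → ⊥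
      absurd (d , d·w≢0 , _ , k-a+d , k-a-d) = d·w≢0 (trans (·-comm d w) (trans (sym (φ≡w d))
        (φ-zero a d (cong ρ₃ k-a+d) (cong ρ₃ k-a-d))))
      decide : Dec (w ≡ 0ᵥ) → φ a c ≡ 0₃
      decide (yes w≡0) = trans (φ≡w c) (trans (cong (_· c) w≡0) (·-0ˡ c))
      decide (no w≢0) = ⊥-elim (absurd (transversal a w k-a w≢0 a⊥w))

  -- By symmetry and `φ-minimal`, the vector w representing φ c is orthogonal to every minimal
  -- hyperplane. If w were nonzero it would lie on a₀, and `transversal` would supply a minimal
  -- hyperplane off w.
  φ-diagonal : ∀ c → φ c c ≡ 0₃
  φ-diagonal c = step (additive-dot (φ c) (φ-additive c))
    where
    step : (∃ λ w → ∀ v → φ c v ≡ w · v) → φ c c ≡ 0₃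
    step (w , φ≡w) = decide (w ≟ᵥ 0ᵥ)
      where
      orthogonal : ∀ a → k a ≡ 0 → a · w ≡ 0₃
      orthogonal a k-a = trans (·-comm a w) (trans (sym (φ≡w a)) (trans (φ-comm c a) (φ-minimal a k-a c)))
      absurd : (∃ λ d → ¬ d · w ≡ 0₃ × k d ≡ 0 × k (a₀ ⊕ d) ≡ 0 × k (a₀ ⊝ d) ≡ 0) → ⊥
      absurd (d , d·w≢0 , k-d , _) = d·w≢0 (orthogonal d k-d)
      decide : Dec (w ≡ 0ᵥ) → φ c c ≡ 0₃
      decide (yes w≡0) = trans (φ≡w c) (trans (cong (_· c) w≡0) (·-0ˡ c))
      decide (no w≢0) = ⊥-elim (absurd (transversal a₀ w k-a₀ w≢0 (orthogonal a₀ k-a₀)))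

  κ≡0 : ∀ v → κ v ≡ 0₃
  κ≡0 v = begin
    κ v                     ≡⟨ cong ρ₃ (sym (k-⊖ v)) ⟩
    κ (⊖ v)                 ≡⟨ cong κ (sym (⊕-self v)) ⟩
    κ (v ⊕ v)               ≡⟨ κ-polar v v ⟩
    κ (v ⊝ v) +₃ φ v v      ≡⟨ cong (κ (v ⊝ v) +₃_) (φ-diagonal v) ⟩
    κ (v ⊝ v) +₃ 0₃         ≡⟨ +₃-idʳ (κ (v ⊝ v)) ⟩
    κ (v ⊝ v)               ≡⟨ cong κ (⊝-self v) ⟩
    κ 0ᵥ                    ≡⟨ κ-0 ⟩
    0₃                      ∎
    where open ≡-Reasoning

  3∣k : ∀ v → ∃ λ b → k v ≡ 3 * b
  3∣k v = ρ₃-0 (k v) (κ≡0 v)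

-- The dual multiset

-- F counts every point of the multiset twice, at both of its representatives, and 22 + 3 b(v) is the mass of
-- the hyperplane v; the zero form has mass 70, so b(0) = 16.
record Arc : Set where
  field
    F    : V₅ → ℕ
    F-⊖  : ∀ x → F (⊖ x) ≡ F x
    F-0  : F 0ᵥ ≡ 0
    ∑-F  : ∑ F ≡ 140
    b    : V₅ → ℕ
    M-F  : ∀ v → M F v ≡ 44 + 6 * b v

module Dual (D : Arc) where
  open Arc D

  b-0 : b 0ᵥ ≡ 16
  b-0 = *-cancelˡ-≡ (b 0ᵥ) 16 6 (+-cancelˡ-≡ 44 _ 96 (trans (sym (M-F 0ᵥ)) (trans (M-0ᵥ F) ∑-F)))

  b-⊖ : ∀ v → b (⊖ v) ≡ b v
  b-⊖ v = *-cancelˡ-≡ _ _ 6 (+-cancelˡ-≡ 44 _ _ (trans (sym (M-F (⊖ v))) (trans (M-⊖ F v) (M-F v))))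

  F-∙0 : ∀ {h : ℕ} {x} → x ≡ 0ᵥ → F x * h ≡ 0
  F-∙0 {h} p = cong (_* h) (trans (cong F p) F-0)

  ∑-b : ∑ b ≡ 108
  ∑-b = linear {ρ = ρ} 6 v0 (con 108)
    ( eqn 1 v1 (con 11340) upper ∷ eqn 1 (6 :* v0 :+ con 10692) v1 (sym expand) ∷ []) refl
    where
    ρ : Vec ℕ 2
    ρ = ∑ b ∷ ∑ (λ v → 1 * M F v) ∷ []
    expand : ∑ (λ v → 1 * M F v) ≡ 6 * ∑ b + 10692
    expand = trans (∑-cong λ v → trans (+-identityʳ _) (M-F v)) (trans (∑-cong λ v → +-comm 44 (6 * b v)) (trans (∑-+ (λ v → 6 * b v) (λ _ → 44))
      (cong₂ _+_ (∑-* 6 b) (∑-const 5 44))))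
    pointwise : ∀ x → F x * M one x ≡ F x * 81
    pointwise x with x ≟ᵥ 0ᵥ
    ... | yes p = trans (F-∙0 p) (sym (F-∙0 p))
    ... | no p = cong (F x *_) (M-one x p)
    upper : ∑ (λ v → 1 * M F v) ≡ 11340
    upper = trans (M-swap F one) (trans (∑-cong pointwise) (trans (∑-*ʳ F 81) (cong (_* 81) ∑-F)))

  M-b : ∀ x → ¬ x ≡ 0ᵥ → M b x ≡ 36 + 18 * F x
  M-b x x≢0 = linear {ρ = ρ} 6 v0 (con 36 :+ 18 :* v1)
    ( eqn 1 v2 (27 :* v3 :+ 108 :* v1) upper
    ∷ eqn 27 v3 (con 140) ∑-F ∷ eqn 1 (6 :* v0 :+ con 3564) v2 (sym expand) ∷ []) refl
    where
    g : V₅ → ℕ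
    g v = δ (x · v) * 1
    ρ : Vec ℕ 4
    ρ = M b x ∷ F x ∷ ∑ (λ v → g v * M F v) ∷ ∑ F ∷ []
    expand : ∑ (λ v → g v * M F v) ≡ 6 * M b x + 3564
    expand = trans (∑-cong λ v → trans (cong (g v *_) (M-F v)) (lemma (δ (x · v)) (b v)))
      (trans (∑-+ (λ v → 6 * on x b v) (λ v → 44 * g v))
        (cong₂ _+_ (∑-* 6 (on x b)) (trans (∑-* 44 g) (cong (44 *_) (M-one x x≢0)))))
      where
      lemma : ∀ d m → d * 1 * (44 + 6 * m) ≡ 6 * (d * m) + 44 * (d * 1)
      lemma = solve-∀
    xs : Vec V₅ 1
    xs = x ∷ []
    pointwise : ∀ y → F y * M g y ≡ 27 * F y + mult xs y * (54 * F y)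
    pointwise y = trans (cong (F y *_) (M₂-one-mult x y x≢0)) (lemma (F y) (mult xs y))
      where
      lemma : ∀ f m → f * (27 + 54 * m) ≡ 27 * f + m * (54 * f)
      lemma = solve-∀
    upper : ∑ (λ v → g v * M F v) ≡ 27 * ∑ F + 108 * F x
    upper = trans (M-swap F g) (trans (∑-cong pointwise) (trans (∑-+ (λ y → 27 * F y) (λ y → mult xs y * (54 * F y)))
      (cong₂ _+_ (∑-* 27 F) (trans (∑-mult xs (λ y → 54 * F y)) (trans (∑-F₃¹ _) three)))))
      where
      value : ∀ a → comb (a ∷ []) xs ≡ scale a x
      value a = comb₁ a x
      lemma : ∀ f → 54 * 0 + (54 * f + 54 * f) ≡ 108 * f
      lemma = solve-∀
      three : sum₃ (λ a → 54 * F (comb (a ∷ []) xs)) ≡ 108 * F x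
      three = trans (cong₂ (λ p q → 54 * p + q) (trans (cong F (trans (value 0₃) (scale-0 x))) F-0)
        (cong₂ (λ p q → 54 * p + 54 * q) (cong F (trans (value 1₃) (scale-1 x))) (trans (cong F (value 2₃)) (F-⊖ x)))) (lemma (F x))

  M₂-F : ∀ u v → M₂ F u v ≡ 12 + 2 * (b u + b v + b (u ⊕ v) + b (u ⊝ v))
  M₂-F u v = linear {ρ = ρ} 3 v0 (con 12 :+ 2 :* s)
    ( eqn 1 (v1 :+ 3 :* v0) total₁ (sym pencil) ∷ eqn 1 (con 140) v1 (sym ∑-F) ∷ []) refl
    where
    ρ : Vec ℕ 6
    ρ = M₂ F u v ∷ ∑ F ∷ b u ∷ b v ∷ b (u ⊕ v) ∷ b (u ⊝ v) ∷ []
    s total₁ : Lin 6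
    s = v2 :+ v3 :+ v4 :+ v5
    total₁ = con 44 :+ 6 :* v2 :+ (con 44 :+ 6 :* v3) :+ (con 44 :+ 6 :* v4) :+ (con 44 :+ 6 :* v5)
    pencil : 44 + 6 * b u + (44 + 6 * b v) + (44 + 6 * b (u ⊕ v)) + (44 + 6 * b (u ⊝ v)) ≡ ∑ F + 3 * M₂ F u v
    pencil with M-pencil F u v
    ... | e rewrite M-F u | M-F v | M-F (u ⊕ v) | M-F (u ⊝ v) = e

  -- The second moments of F and b determine each other, by counting incident pairs twice.
  second-moments : ∑ (λ v → b v * b v) ≡ 48 + 3 * ∑ (λ x → F x * F x)
  second-moments = linear {ρ = ρ} 6 v0 (con 48 :+ 3 :* v1)
    ( eqn 1 (44 :* v2 :+ 6 :* v0) (36 :* v3 :+ 18 :* v1) eq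
    ∷ eqn 36 v3 (con 140) ∑-F ∷ eqn 44 (con 108) v2 (sym ∑-b) ∷ []) refl
    where
    ρ : Vec ℕ 4
    ρ = ∑ (λ v → b v * b v) ∷ ∑ (λ x → F x * F x) ∷ ∑ b ∷ ∑ F ∷ []
    left : ∀ m → m * (44 + 6 * m) ≡ 44 * m + 6 * (m * m)
    left = solve-∀
    right : ∀ f → f * (36 + 18 * f) ≡ 36 * f + 18 * (f * f)
    right = solve-∀
    pointwise : ∀ x → F x * M b x ≡ 36 * F x + 18 * (F x * F x)
    pointwise x with x ≟ᵥ 0ᵥ
    ... | yes p = trans (F-∙0 p) (sym (trans (sym (right (F x))) (F-∙0 p)))
    ... | no p = trans (cong (F x *_) (M-b x p)) (right (F x))
    eq : 44 * ∑ b + 6 * ∑ (λ v → b v * b v) ≡ 36 * ∑ F + 18 * ∑ (λ x → F x * F x)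
    eq = begin
      44 * ∑ b + 6 * ∑ (λ v → b v * b v)         ≡⟨ sym (cong₂ _+_ (∑-* 44 b) (∑-* 6 (λ v → b v * b v))) ⟩
      ∑ (λ v → 44 * b v) + ∑ (λ v → 6 * (b v * b v)) ≡⟨ sym (∑-+ (λ v → 44 * b v) (λ v → 6 * (b v * b v))) ⟩
      ∑ (λ v → 44 * b v + 6 * (b v * b v))       ≡⟨ ∑-cong (λ v → sym (trans (cong (b v *_) (M-F v)) (left (b v)))) ⟩
      ∑ (λ v → b v * M F v)                      ≡⟨ M-swap F b ⟩
      ∑ (λ x → F x * M b x)                      ≡⟨ ∑-cong pointwise ⟩
      ∑ (λ x → 36 * F x + 18 * (F x * F x))      ≡⟨ ∑-+ (λ x → 36 * F x) (λ x → 18 * (F x * F x)) ⟩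
      ∑ (λ x → 36 * F x) + ∑ (λ x → 18 * (F x * F x)) ≡⟨ cong₂ _+_ (∑-* 36 F) (∑-* 18 (λ x → F x * F x)) ⟩
      36 * ∑ F + 18 * ∑ (λ x → F x * F x)        ∎
      where open ≡-Reasoning

-- Projection from a point of multiplicity zero

M-translate : ∀ (f : V₅ → ℕ) c w → c · w ≡ 0₃ → M (λ x → f (x ⊕ w)) c ≡ M f c
M-translate f c w c⊥w = trans (∑-cong λ x → cong (λ t → δ t * f (x ⊕ w)) (sym (same x))) (∑-shift (on c f) w)
  where
  same : ∀ x → c · (x ⊕ w) ≡ c · x
  same x = trans (·-⊕ʳ c x w) (trans (cong ((c · x) +₃_) c⊥w) (+₃-idʳ (c · x)))

mult-⊖ : ∀ {k} (us : Vec V₅ k) → Independent us → ∀ v → mult us (⊖ v) ≡ mult us v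
mult-⊖ us ind v = decide (InSpan? us v)
  where
  decide : Dec (InSpan us v) → mult us (⊖ v) ≡ mult us v
  decide (yes i@(cs , p)) = trans (mult-∈ us ind (⊖ cs , trans (cong ⊖_ p) (sym (comb-scale 2₃ cs us)))) (sym (mult-∈ us ind i))
  decide (no i) = trans (mult-∉ us λ { (cs , p) → i (⊖ cs , trans (sym (⊖⊖ v)) (trans (cong ⊖_ p) (sym (comb-scale 2₃ cs us)))) })
    (sym (mult-∉ us i))

span-sum-≤ : ∀ {k} (us : Vec V₅ k) → Independent us → ∀ (g : V₅ → ℕ) u v →
  (∀ i → lookup us i · u ≡ 0₃) → (∀ i → lookup us i · v ≡ 0₃) → ∑ (λ cs → g (comb cs us)) ≤ M₂ g u v
span-sum-≤ us ind g u v us⊥u us⊥v = ≤-trans (≥-of (∑-mult us g)) (∑-mono λ w → decide w (InSpan? us w))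
  where
  decide : ∀ w → Dec (InSpan us w) → mult us w * g w ≤ on v (on u g) w
  decide w (no i) = ≤-trans (≤-of (cong (_* g w) (mult-∉ us i))) z≤n
  decide w (yes i@(cs , p)) = ≤-of (trans (cong (_* g w) (mult-∈ us ind i)) (sym
    (trans (cong₂ (λ s t → δ s * (δ t * g w)) (ortho v us⊥v) (ortho u us⊥u)) (+-identityʳ _))))
    where
    ortho : ∀ x → (∀ i → lookup us i · x ≡ 0₃) → x · w ≡ 0₃
    ortho x q = trans (cong (x ·_) p) (trans (·-comm x _) (⊥-comb us x q cs))

M-one-mult : ∀ c → M one c ≡ 81 + 162 * mult [] c
M-one-mult c = decide (c ≟ᵥ 0ᵥ)
  where
  decide : Dec (c ≡ 0ᵥ) → M one c ≡ 81 + 162 * mult [] c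
  decide (yes p) = trans (trans (cong (M one) p) (trans (M-0ᵥ one) ∑-one))
    (cong (λ m → 81 + 162 * m) (sym (mult-∈ [] independent-[] {c} ([] , p))))
  decide (no p) = trans (M-one c p) (cong (λ m → 81 + 162 * m) (sym (mult-∉ [] {c} (∉-[] p))))

M-≤-∑ : ∀ (f : V₅ → ℕ) c → M f c ≤ ∑ f
M-≤-∑ f c = ∑-mono λ x → δ-≤ (c · x) (f x)

∸-split : ∀ {m n} → n ≤ m → m ≡ m ∸ n + n
∸-split p = sym (m∸n+n≡m p)

⊥[] : ∀ {n} {x : Vec F₃ n} → ∀ i → lookup {n = 0} [] i · x ≡ 0₃
⊥[] ()

∑-pair : ∀ (g : V₅ → ℕ) y → (∀ v → g (⊖ v) ≡ g v) → ∑ (λ cs → g (comb cs (y ∷ []))) ≡ g 0ᵥ + 2 * g y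
∑-pair g y even = trans (∑-F₃¹ _) (cong₂ _+_ (cong g (trans (comb₁ 0₃ y) (scale-0 y)))
  (cong₂ _+_ (cong g (trans (comb₁ 1₃ y) (scale-1 y)))
    (trans (cong g (comb₁ 2₃ y)) (trans (even y) (sym (+-identityʳ (g y)))))))

-- The hyperplanes through a point x₀ with F(x₀) = 0, of which one, y, has b(y) ≥ 3: apart from y and one further
-- hyperplane q taken with multiplicity three, b is the characteristic function of a two-dimensional subspace.
module Section (D : Arc) (x₀ y : V₅) (x₀≢0 : ¬ x₀ ≡ 0ᵥ) (F-x₀ : Arc.F D x₀ ≡ 0)
  (y≢0 : ¬ y ≡ 0ᵥ) (y⊥x₀ : y · x₀ ≡ 0₃) (3≤b-y : 3 ≤ Arc.b D y) where
  open Arc D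
  open Dual D

  xs ys : Vec V₅ 1
  xs = x₀ ∷ []
  ys = y ∷ []

  e : V₅ → ℕ
  e = mult xs

  -- The image of F under projection from x₀, pulled back to F₃⁵: the sum over the fibre of x.
  Γ : V₅ → ℕ
  Γ x = F x + F (x ⊕ x₀) + F (x ⊝ x₀)

  M-Γ : ∀ c → c · x₀ ≡ 0₃ → M Γ c ≡ 3 * (44 + 6 * b c)
  M-Γ c c⊥x₀ = begin
    M Γ c                                                  ≡⟨ M-+ (λ x → F x + F (x ⊕ x₀)) (λ x → F (x ⊝ x₀)) c ⟩
    M (λ x → F x + F (x ⊕ x₀)) c + M (λ x → F (x ⊝ x₀)) c  ≡⟨ cong₂ _+_ (M-+ F (λ x → F (x ⊕ x₀)) c) (M-translate F c (⊖ x₀) c⊥-x₀) ⟩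
    M F c + M (λ x → F (x ⊕ x₀)) c + M F c                 ≡⟨ cong (λ m → M F c + m + M F c) (M-translate F c x₀ c⊥x₀) ⟩
    M F c + M F c + M F c                                  ≡⟨ triple (M F c) ⟩
    3 * M F c                                              ≡⟨ cong (3 *_) (M-F c) ⟩
    3 * (44 + 6 * b c)                                     ∎
    where
    open ≡-Reasoning
    triple : ∀ m → m + m + m ≡ 3 * m
    triple = solve-∀
    c⊥-x₀ : c · (⊖ x₀) ≡ 0₃
    c⊥-x₀ = trans (·-scaleʳ 2₃ c x₀) (cong (2₃ *₃_) c⊥x₀)

  F-line : ∀ a → F (scale a x₀) ≡ 0
  F-line 0₃ = trans (cong F (scale-0 x₀)) F-0
  F-line 1₃ = trans (cong F (scale-1 x₀)) F-x₀
  F-line 2₃ = trans (F-⊖ x₀) F-x₀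

  Γ-line : ∀ {x} → InSpan xs x → Γ x ≡ 0
  Γ-line {x} (a ∷ [] , p) = all-zero (trans (cong F x≡) (F-line a))
    (trans (cong F (trans (cong₂ _⊕_ x≡ (sym (scale-1 x₀))) (sym (scale-+ a 1₃ x₀)))) (F-line (a +₃ 1₃)))
    (trans (cong F (trans (cong (_⊝ x₀) x≡) (sym (scale-+ a 2₃ x₀)))) (F-line (a +₃ 2₃)))
    where
    x≡ : x ≡ scale a x₀
    x≡ = trans p (comb₁ a x₀)
    all-zero : ∀ {l m n} → l ≡ 0 → m ≡ 0 → n ≡ 0 → l + m + n ≡ 0
    all-zero refl refl refl = refl

  -- The line joining x₀ and x consists of x₀, where F vanishes, and of the three points collected
  -- in `Γ x`; the pencil identity is applied to b.
  M₂-b : ∀ x → ¬ InSpan xs x → M₂ b x₀ x ≡ 12 + 6 * Γ x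
  M₂-b x x∉ = linear {ρ = ρ} 3 v0 (con 12 :+ 6 :* (v2 :+ v3 :+ v4))
    ( eqn 1 (v1 :+ 3 :* v0) pencil (sym (M-pencil b x₀ x)) ∷ eqn 1 (con 108) v1 (sym ∑-b)
    ∷ eqn 1 v5 (con 36) at-x₀ ∷ eqn 1 v6 (con 36 :+ 18 :* v2) (M-b x x≢0)
    ∷ eqn 1 v7 (con 36 :+ 18 :* v3) at-x+x₀ ∷ eqn 1 v8 (con 36 :+ 18 :* v4) at-x-x₀ ∷ []) refl
    where
    ρ : Vec ℕ 9
    ρ = M₂ b x₀ x ∷ ∑ b ∷ F x ∷ F (x ⊕ x₀) ∷ F (x ⊝ x₀) ∷ M b x₀ ∷ M b x ∷ M b (x₀ ⊕ x) ∷ M b (x₀ ⊝ x) ∷ []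
    pencil : Lin 9
    pencil = v5 :+ v6 :+ v7 :+ v8
    off : ∀ c → x ≡ scale c x₀ → ⊥
    off c p = x∉ (c ∷ [] , trans p (sym (comb₁ c x₀)))
    us : Vec V₅ 2
    us = x ∷ x₀ ∷ []
    x≢0 : ¬ x ≡ 0ᵥ
    x≢0 p = off 0₃ (trans p (sym (scale-0 x₀)))
    x+x₀≢0 : ¬ x ⊕ x₀ ≡ 0ᵥ
    x+x₀≢0 p = off 2₃ (trans (by-coef us a0 (a0 ⟨+⟩ a1 ⟨-⟩ a1) refl) (trans (cong (_⊝ x₀) p) (⊕-idˡ _)))
    x-x₀≢0 : ¬ x ⊝ x₀ ≡ 0ᵥ
    x-x₀≢0 p = off 1₃ (trans (⊝-≡0 x x₀ p) (sym (scale-1 x₀)))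
    at-x₀ : M b x₀ ≡ 36
    at-x₀ = trans (M-b x₀ x₀≢0) (cong (λ m → 36 + 18 * m) F-x₀)
    at-x+x₀ : M b (x₀ ⊕ x) ≡ 36 + 18 * F (x ⊕ x₀)
    at-x+x₀ = trans (cong (M b) (⊕-comm x₀ x)) (M-b (x ⊕ x₀) x+x₀≢0)
    at-x-x₀ : M b (x₀ ⊝ x) ≡ 36 + 18 * F (x ⊝ x₀)
    at-x-x₀ = trans (cong (M b) (by-coef us (a1 ⟨-⟩ a0) (2₃ ⟨*⟩ (a0 ⟨-⟩ a1)) refl)) (trans (M-⊖ b (x ⊝ x₀)) (M-b (x ⊝ x₀) x-x₀≢0))

  -- Dual of the whole space together with the plane y. Removing 40 + 13 points drops the total from
  -- 70 = 22 + 3 * 16 to 17 = 5 + 3 * 4, so the value at the origin drops by 12 = 3 + 9.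
  w″ : V₅ → ℕ
  w″ v = 3 * mult ys v + 9 * mult [] v

  w″-at : ∀ {v m n} → mult ys v ≡ m → mult [] v ≡ n → w″ v ≡ 3 * m + 9 * n
  w″-at p q = cong₂ (λ m n → 3 * m + 9 * n) p q

  w″-0 : w″ 0ᵥ ≡ 12
  w″-0 = w″-at {0ᵥ} (mult-0 (independent₁ y≢0)) (mult-0 {us = []} independent-[])

  w″≤b : ∀ v → w″ v ≤ b v
  w″≤b v = decide (v ≟ᵥ 0ᵥ) (InSpan? ys v)
    where
    decide : Dec (v ≡ 0ᵥ) → Dec (InSpan ys v) → w″ v ≤ b v
    decide (yes p) _ = ≤-trans (≤-of (trans (cong w″ p) w″-0)) (≤-trans (≤ᵇ⇒≤ 12 16 tt) (≥-of (trans (cong b p) b-0)))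
    decide (no p) (no i) = ≤-trans (≤-of (w″-at {v} (mult-∉ ys i) (mult-∉ [] {v} (∉-[] p)))) z≤n
    decide (no p) (yes i@(a ∷ [] , q)) = ≤-trans (≤-of (w″-at {v} (mult-∈ ys (independent₁ y≢0) i) (mult-∉ [] {v} (∉-[] p))))
      (≤-trans 3≤b-y (≥-of (trans (cong b (trans q (comb₁ a y))) (even-scale b-⊖ a (λ { refl → p (trans q (trans (comb₁ 0₃ y) (scale-0 y))) }) y))))

  b″ : V₅ → ℕ
  b″ v = b v ∸ w″ v

  b≡b″ : ∀ v → b v ≡ b″ v + w″ v
  b≡b″ v = ∸-split (w″≤b v)

  b″-0 : b″ 0ᵥ ≡ 4
  b″-0 = cong₂ _∸_ b-0 w″-0

  b″-⊖ : ∀ v → b″ (⊖ v) ≡ b″ v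
  b″-⊖ v = cong₂ _∸_ (b-⊖ v) (w″-at {⊖ v} (mult-⊖ ys (independent₁ y≢0) v) (mult-⊖ [] independent-[] v))

  ys⊥x₀ : ∀ i → lookup ys i · x₀ ≡ 0₃
  ys⊥x₀ = ⊥₁ {u = y} {x₀} y⊥x₀

  on-w″ : ∀ v → on x₀ w″ v ≡ w″ v
  on-w″ v = trans (lemma (δ (x₀ · v)) (mult ys v) (mult [] v)) (cong₂ (λ m n → 3 * m + 9 * n) (on-mult ys x₀ ys⊥x₀ v) (on-mult [] x₀ (⊥[] {x = x₀}) v))
    where
    lemma : ∀ d m n → d * (3 * m + 9 * n) ≡ 3 * (d * m) + 9 * (d * n)
    lemma = solve-∀

  M-w″ : ∀ x → M w″ x ≡ 12 + 6 * δ (x · y)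
  M-w″ x = trans (M-+ (λ v → 3 * mult ys v) (λ v → 9 * mult [] v) x) (trans
    (cong₂ _+_ (trans (M-* 3 (mult ys) x) (cong (3 *_) (M-mult₁ y x))) (trans (M-* 9 (mult []) x) (cong (9 *_) (M-mult-⊥ [] x (⊥[] {x = x})))))
    (lemma (δ (x · y))))
    where
    lemma : ∀ d → 3 * (1 + 2 * d) + 9 ≡ 12 + 6 * d
    lemma = solve-∀

  M-b″ : M b″ x₀ ≡ 18
  M-b″ = +-cancelʳ-≡ 18 (M b″ x₀) 18 (trans (cong (M b″ x₀ +_) (sym M-w″-x₀)) (trans (sym (M-+ b″ w″ x₀))
    (trans (sym (M-cong b≡b″ x₀)) (trans (M-b x₀ x₀≢0) (cong (λ m → 36 + 18 * m) F-x₀)))))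
    where
    M-w″-x₀ : M w″ x₀ ≡ 18
    M-w″-x₀ = trans (M-w″ x₀) (cong (λ t → 12 + 6 * δ t) (trans (·-comm x₀ y) y⊥x₀))

  M₂-b″ : ∀ x → M₂ b x₀ x ≡ M₂ b″ x₀ x + (12 + 6 * δ (x · y))
  M₂-b″ x = trans (M-cong (λ v → trans (cong (δ (x₀ · v) *_) (b≡b″ v)) (trans (*-distribˡ-+ (δ (x₀ · v)) (b″ v) (w″ v))
      (cong (on x₀ b″ v +_) (on-w″ v)))) x)
    (trans (M-+ (on x₀ b″) w″ x) (cong (M₂ b″ x₀ x +_) (M-w″ x)))

  M₂-b″-≥4 : ∀ x → 4 ≤ M₂ b″ x₀ x
  M₂-b″-≥4 x = ≤-trans (≥-of (trans (∑-[] λ cs → b″ (comb cs [])) b″-0)) (span-sum-≤ [] independent-[] b″ x₀ x (⊥[] {x = x₀}) (⊥[] {x = x}))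

  e-∈ : ∀ {x} → InSpan xs x → e x ≡ 1
  e-∈ = mult-∈ xs (independent₁ x₀≢0)

  e-∉ : ∀ {x} → ¬ InSpan xs x → e x ≡ 0
  e-∉ = mult-∉ xs

  ⊥-line : ∀ {x} c → c · x₀ ≡ 0₃ → InSpan xs x → c · x ≡ 0₃
  ⊥-line {x} c c⊥x₀ (cs , p) = trans (cong (c ·_) p) (trans (·-comm c (comb cs xs)) (⊥-comb xs c (⊥₁ {u = x₀} {c} (trans (·-comm x₀ c) c⊥x₀)) cs))

  -- Off the line of x₀, `M₂ b″ x₀ x` equals 6Γ - 6δ and is positive because b″(0) = 4, so Γ exceeds
  -- δ. On the line Γ vanishes while 1 + δ = 2, which the term `2 * e x` makes up for.
  Γ″-bound : ∀ x → 1 + δ (y · x) ≤ Γ x + 2 * e x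
  Γ″-bound x = decide (InSpan? xs x)
    where
    decide : Dec (InSpan xs x) → 1 + δ (y · x) ≤ Γ x + 2 * e x
    decide (yes i) = ≤-trans (+-monoʳ-≤ 1 (δ≤1 (y · x))) (≤-trans (≥-of (cong (λ m → 2 * m) (e-∈ i))) (m≤n+m (2 * e x) (Γ x)))
    decide (no i) = by-contra λ q → farkas {ρ = Γ x ∷ e x ∷ δ (x · y) ∷ M₂ b″ x₀ x ∷ M₂ b x₀ x ∷ δ (y · x) ∷ []}
      ( hyp 6 (con 1 :+ (v0 :+ 2 :* v1)) (con 1 :+ v5) q ∷ hyp 1 (con 4) v3 (M₂-b″-≥4 x)
      ∷ hyp 1 (v3 :+ (con 12 :+ 6 :* v2)) v4 (≥-of (M₂-b″ x)) ∷ hyp 1 v4 (con 12 :+ 6 :* v0) (≤-of (M₂-b x i))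
      ∷ hyp 6 v5 v2 (≤-of (cong δ (·-comm y x))) ∷ [])

  Γ″ : V₅ → ℕ
  Γ″ x = Γ x + 2 * e x ∸ (1 + δ (y · x))

  Γ≡Γ″ : ∀ x → Γ x + 2 * e x ≡ Γ″ x + (1 + δ (y · x))
  Γ≡Γ″ x = ∸-split (Γ″-bound x)

  Γ″-line : ∀ {x} → InSpan xs x → Γ″ x ≡ 0
  Γ″-line {x} i = cong₂ _∸_ (cong₂ (λ m n → m + 2 * n) (Γ-line i) (e-∈ i)) (cong (λ t → 1 + δ t) (⊥-line y y⊥x₀ i))

  M₂-b″-Γ″ : ∀ x → ¬ InSpan xs x → M₂ b″ x₀ x ≡ 6 + 6 * Γ″ x
  M₂-b″-Γ″ x i = linear {ρ = ρ} 1 v3 (con 6 :+ 6 :* v4)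
    ( eqn 1 (v3 :+ (con 12 :+ 6 :* v2)) v5 (sym (M₂-b″ x))
    ∷ eqn 1 v5 (con 12 :+ 6 :* v0) (M₂-b x i) ∷ eqn 12 (con 0) v1 (sym (e-∉ i)) ∷ eqn 6 (v0 :+ 2 :* v1) (v4 :+ (con 1 :+ v2)) Γ≡ ∷ []) refl
    where
    ρ : Vec ℕ 6
    ρ = Γ x ∷ e x ∷ δ (x · y) ∷ M₂ b″ x₀ x ∷ Γ″ x ∷ M₂ b x₀ x ∷ []
    Γ≡ : Γ x + 2 * e x ≡ Γ″ x + (1 + δ (x · y))
    Γ≡ = trans (Γ≡Γ″ x) (cong (λ t → Γ″ x + (1 + δ t)) (·-comm y x))

  M-e : ∀ c → c · x₀ ≡ 0₃ → M e c ≡ 3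
  M-e c p = M-mult-⊥ xs c (⊥₁ {u = x₀} {c} (trans (·-comm x₀ c) p))

  -- This is 6(5 + 3 b″(c)): in the quotient PG(3,3) a multiset of mass 17 with planes of mass 5 +
  -- 3b″. The factor 6 counts three vectors in a fibre and two representatives.
  M-Γ″ : ∀ c → c · x₀ ≡ 0₃ → M Γ″ c ≡ 30 + 18 * b″ c
  M-Γ″ c c⊥x₀ = linear {ρ = ρ} 1 v0 (con 30 :+ 18 :* v2)
    ( eqn 1 (v0 :+ (v5 :+ v6)) (v3 :+ 2 :* v4) (sym eq)
    ∷ eqn 1 v3 (3 :* (con 44 :+ 6 :* v1)) (M-Γ c c⊥x₀) ∷ eqn 2 v4 (con 3) (M-e c c⊥x₀)
    ∷ eqn 1 (con 81 :+ 162 :* v8) v5 (sym (M-one-mult c)) ∷ eqn 1 (con 27 :+ 54 :* v7) v6 (sym (M₂-one-mult y c y≢0))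
    ∷ eqn 18 v1 (v2 :+ (3 :* v7 :+ 9 :* v8)) (b≡b″ c) ∷ []) refl
    where
    ρ : Vec ℕ 9
    ρ = M Γ″ c ∷ b c ∷ b″ c ∷ M Γ c ∷ M e c ∷ M one c ∷ M₂ one y c ∷ mult ys c ∷ mult [] c ∷ []
    eq : M Γ c + 2 * M e c ≡ M Γ″ c + (M one c + M₂ one y c)
    eq = begin
      M Γ c + 2 * M e c                       ≡⟨ cong (M Γ c +_) (sym (M-* 2 e c)) ⟩
      M Γ c + M (λ x → 2 * e x) c             ≡⟨ sym (M-+ Γ (λ x → 2 * e x) c) ⟩
      M (λ x → Γ x + 2 * e x) c               ≡⟨ M-cong Γ≡Γ″ c ⟩
      M (λ x → Γ″ x + (1 + δ (y · x))) c      ≡⟨ M-+ Γ″ (λ x → 1 + δ (y · x)) c ⟩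
      M Γ″ c + M (λ x → 1 + δ (y · x)) c      ≡⟨ cong (M Γ″ c +_) (M-cong (λ x → cong suc (sym (*-identityʳ (δ (y · x))))) c) ⟩
      M Γ″ c + M (λ x → 1 + on y one x) c     ≡⟨ cong (M Γ″ c +_) (M-+ one (on y one) c) ⟩
      M Γ″ c + (M one c + M₂ one y c)         ∎
      where open ≡-Reasoning

  Heavy : V₅ → Set
  Heavy q = ¬ q ≡ 0ᵥ × q · x₀ ≡ 0₃ × 3 ≤ b″ q

  -- At a point of the plane q, `M₂ b″ x₀ x` is at least 4 + 2 * 2 > 6, which forces Γ″ to be
  -- positive there. But q has 13 points in the quotient and mass only 5 + 3 * 2.
  b″≢2 : ∀ q → ¬ q ≡ 0ᵥ → q · x₀ ≡ 0₃ → ¬ b″ q ≡ 2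
  b″≢2 q q≢0 q⊥x₀ b″q≡2 = farkas {ρ = M Γ″ q ∷ M e q ∷ M one q ∷ b″ q ∷ []}
    ( hyp 1 v2 (v0 :+ v1) (≤-trans (M-mono q bound) (≤-of (M-+ Γ″ e q))) ∷ hyp 1 (con 81) v2 (M-one-≥ q)
    ∷ hyp 1 v1 (con 3) (≤-of (M-e q q⊥x₀)) ∷ hyp 1 v0 (con 30 :+ 18 :* v3) (≤-of (M-Γ″ q q⊥x₀)) ∷ hyp 18 v3 (con 2) (≤-of b″q≡2) ∷ [])
    where
    bound : ∀ x → q · x ≡ 0₃ → 1 ≤ Γ″ x + e x
    bound x q⊥x = decide (InSpan? xs x)
      where
      decide : Dec (InSpan xs x) → 1 ≤ Γ″ x + e x
      decide (yes i) = ≤-trans (≥-of (e-∈ i)) (m≤n+m (e x) (Γ″ x))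
      decide (no i) = by-contra λ r → farkas {ρ = Γ″ x ∷ e x ∷ M₂ b″ x₀ x ∷ b″ q ∷ b″ 0ᵥ ∷ []}
        ( hyp 6 (con 1 :+ (v0 :+ v1)) (con 1) r ∷ hyp 1 v2 (con 6 :+ 6 :* v0) (≤-of (M₂-b″-Γ″ x i))
        ∷ hyp 1 (v4 :+ 2 :* v3) v2 (≤-trans (≥-of (∑-pair b″ q b″-⊖)) (span-sum-≤ (q ∷ []) (independent₁ q≢0) b″ x₀ x
            (⊥₁ {u = q} {x₀} q⊥x₀) (⊥₁ {u = q} {x} q⊥x)))
        ∷ hyp 2 (con 2) v3 (≥-of b″q≡2) ∷ hyp 1 (con 4) v4 (≥-of b″-0) ∷ [])

  Γ″-weighted : ∑ (λ x → Γ″ x * M₂ b″ x₀ x) ≡ ∑ (λ c → on x₀ b″ c * (30 + 18 * b″ c))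
  Γ″-weighted = trans (sym (M-swap Γ″ (on x₀ b″))) (∑-cong λ c → weigh (x₀ · c) λ p → M-Γ″ c (trans (·-comm c x₀) p))
    where
    weigh : ∀ t {m k l} → (t ≡ 0₃ → k ≡ l) → δ t * m * k ≡ δ t * m * l
    weigh 0₃ {m} p = cong (1 * m *_) (p refl)
    weigh (F.suc t) p = refl

  -- Where Γ″ is positive, `M₂ b″ x₀ x` is at least 12, so the double count is at least 12 * 102 =
  -- 1224. If b″ ≤ 1 off the origin, it is at most 48 * 18 + 216 = 1080; the 216 is the surplus 4 *
  -- 102 - 4 * 48 at the origin.
  heavy-exists : (∀ q → ¬ Heavy q) → ⊥
  heavy-exists light = farkas {ρ = ∑ (λ x → Γ″ x * M₂ b″ x₀ x) ∷ M Γ″ 0ᵥ ∷ b″ 0ᵥ ∷ M b″ x₀ ∷ ∑ Γ″ ∷ ∑ (λ c → on x₀ b″ c * (30 + 18 * b″ c)) ∷ []}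
    ( hyp 1 (12 :* v4) v0 lower ∷ hyp 12 v1 v4 (≤-of (M-0ᵥ Γ″)) ∷ hyp 12 (con 30 :+ 18 :* v2) v1 (≥-of (M-Γ″ 0ᵥ (·-0ˡ x₀)))
    ∷ hyp 216 (con 4) v2 (≥-of b″-0) ∷ hyp 1 v0 v5 (≤-of Γ″-weighted) ∷ hyp 1 v5 (48 :* v3 :+ con 216) upper ∷ hyp 48 v3 (con 18) (≤-of M-b″) ∷ [])
    where
    small : ∀ c → x₀ · c ≡ 0₃ → ¬ c ≡ 0ᵥ → b″ c ≤ 1
    small c p c≢0 = ≤-pred (≤∧≢⇒< (≤-pred (≰⇒> λ r → light c (c≢0 , trans (·-comm c x₀) p , r))) (b″≢2 c c≢0 (trans (·-comm c x₀) p)))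
    lower : 12 * ∑ Γ″ ≤ ∑ (λ x → Γ″ x * M₂ b″ x₀ x)
    lower = ≤-trans (≥-of (∑-* 12 Γ″)) (∑-mono λ x → decide x (InSpan? xs x))
      where
      double : ∀ m → 12 * m ≤ m * (6 + 6 * m)
      double zero = z≤n
      double (suc m) = ≤-trans (≤-of (*-comm 12 (suc m))) (*-monoʳ-≤ (suc m) (≤-trans (m≤m+n 12 (6 * m)) (≤-of (lemma m))))
        where
        lemma : ∀ m → 12 + 6 * m ≡ 6 + 6 * suc m
        lemma = solve-∀
      decide : ∀ x → Dec (InSpan xs x) → 12 * Γ″ x ≤ Γ″ x * M₂ b″ x₀ x
      decide x (yes i) = ≤-trans (≤-of (cong (12 *_) (Γ″-line i))) z≤n
      decide x (no i) = ≤-trans (double (Γ″ x)) (≤-of (cong (Γ″ x *_) (sym (M₂-b″-Γ″ x i))))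
    upper : ∑ (λ c → on x₀ b″ c * (30 + 18 * b″ c)) ≤ 48 * M b″ x₀ + 216
    upper = ≤-trans (∑-mono {f = λ c → on x₀ b″ c * (30 + 18 * b″ c)} {λ c → 48 * on x₀ b″ c + mult [] c * 216}
        λ c → bound (x₀ · c) (b″ c) (mult [] c) (decide c (c ≟ᵥ 0ᵥ))) sums
      where
      sums : ∑ (λ c → 48 * on x₀ b″ c + mult [] c * 216) ≤ 48 * M b″ x₀ + 216
      sums = ≤-of (trans (∑-+ (λ c → 48 * on x₀ b″ c) (λ c → mult [] c * 216))
        (cong₂ _+_ (∑-* 48 (on x₀ b″)) (trans (∑-mult [] λ _ → 216) (∑-[] λ _ → 216))))
      ≤48 : ∀ m → m ≤ 1 → m * (30 + 18 * m) ≤ 48 * m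
      ≤48 zero _ = z≤n
      ≤48 (suc zero) _ = ≤-refl
      ≤48 (suc (suc m)) (s≤s ())
      bound : ∀ t m k → (t ≡ 0₃ → m * (30 + 18 * m) ≤ 48 * m + k * 216) → δ t * m * (30 + 18 * m) ≤ 48 * (δ t * m) + k * 216
      bound (F.suc t) m k p = z≤n
      bound 0₃ m k p = subst (λ z → z * (30 + 18 * m) ≤ 48 * z + k * 216) (sym (+-identityʳ m)) (p refl)
      at-0 : ∀ {m k} → m ≡ 4 → k ≡ 1 → m * (30 + 18 * m) ≤ 48 * m + k * 216
      at-0 refl refl = ≤ᵇ⇒≤ 408 408 tt
      at-≤1 : ∀ m k → m ≤ 1 → m * (30 + 18 * m) ≤ 48 * m + k * 216
      at-≤1 m k p = ≤-trans (≤48 m p) (m≤m+n (48 * m) (k * 216))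
      decide : ∀ c → Dec (c ≡ 0ᵥ) → x₀ · c ≡ 0₃ → b″ c * (30 + 18 * b″ c) ≤ 48 * b″ c + mult [] c * 216
      decide c (no c≢0) p = at-≤1 (b″ c) (mult [] c) (small c p c≢0)
      decide c (yes c≡0) p = at-0 (trans (cong b″ c≡0) b″-0) (mult-∈ [] independent-[] ([] , c≡0))

Res₁ : Arc → V₅ → Set
Res₁ D v = ρ₃ (Arc.b D v) ≡ 1₃

module Residue (D : Arc) (x₀ y : V₅) (x₀≢0 : ¬ x₀ ≡ 0ᵥ) (F-x₀ : Arc.F D x₀ ≡ 0)
  (y≢0 : ¬ y ≡ 0ᵥ) (y⊥x₀ : y · x₀ ≡ 0₃) (3≤b-y : 3 ≤ Arc.b D y) where
  open Arc D
  open Dual D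
  open Section D x₀ y x₀≢0 F-x₀ y≢0 y⊥x₀ 3≤b-y

  module _ (q : V₅) (q-heavy : Heavy q) where

    q≢0 : ¬ q ≡ 0ᵥ
    q≢0 = proj₁ q-heavy

    q⊥x₀ : q · x₀ ≡ 0₃
    q⊥x₀ = proj₁ (proj₂ q-heavy)

    qs : Vec V₅ 1
    qs = q ∷ []

    3mult≤b″ : ∀ v → 3 * mult qs v ≤ b″ v
    3mult≤b″ v = decide (InSpan? qs v)
      where
      bound : ∀ a → 3 ≤ b″ (scale a q)
      bound 0₃ = ≤-trans (n≤1+n 3) (≥-of (trans (cong b″ (scale-0 q)) b″-0))
      bound 1₃ = ≤-trans (proj₂ (proj₂ q-heavy)) (≥-of (cong b″ (scale-1 q)))
      bound 2₃ = ≤-trans (proj₂ (proj₂ q-heavy)) (≥-of (b″-⊖ q))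
      decide : Dec (InSpan qs v) → 3 * mult qs v ≤ b″ v
      decide (no i) = ≤-trans (≤-of (cong (3 *_) (mult-∉ qs i))) z≤n
      decide (yes i@(a ∷ [] , p)) = ≤-trans (≤-of (cong (3 *_) (mult-∈ qs (independent₁ q≢0) i)))
        (≤-trans (bound a) (≥-of (cong b″ (trans p (comb₁ a q)))))

    γ : V₅ → ℕ
    γ v = b″ v ∸ 3 * mult qs v

    b″≡γ : ∀ v → b″ v ≡ γ v + 3 * mult qs v
    b″≡γ v = ∸-split (3mult≤b″ v)

    b≡γ : ∀ v → b v ≡ γ v + 3 * mult qs v + (3 * mult ys v + 9 * mult [] v)
    b≡γ v = trans (b≡b″ v) (cong (_+ w″ v) (b″≡γ v))

    γ-0 : γ 0ᵥ ≡ 1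
    γ-0 = cong₂ (λ m n → m ∸ 3 * n) b″-0 (mult-0 (independent₁ q≢0))

    τ-bound : ∀ x → δ (q · x) ≤ Γ″ x + e x
    τ-bound x = decide (InSpan? xs x)
      where
      decide : Dec (InSpan xs x) → δ (q · x) ≤ Γ″ x + e x
      decide (yes i) = ≤-trans (δ≤1 (q · x)) (≤-trans (≥-of (e-∈ i)) (m≤n+m (e x) (Γ″ x)))
      decide (no i) = ≤-trans (bound (q · x) refl) (m≤m+n (Γ″ x) (e x))
        where
        bound : ∀ t → q · x ≡ t → δ t ≤ Γ″ x
        bound (F.suc _) _ = z≤n
        bound 0₃ q⊥x = by-contra λ r → farkas {ρ = Γ″ x ∷ M₂ b″ x₀ x ∷ b″ q ∷ b″ 0ᵥ ∷ []}
          ( hyp 6 (con 1 :+ v0) (con 1) r ∷ hyp 1 v1 (con 6 :+ 6 :* v0) (≤-of (M₂-b″-Γ″ x i))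
          ∷ hyp 1 (v3 :+ 2 :* v2) v1 (≤-trans (≥-of (∑-pair b″ q b″-⊖)) (span-sum-≤ qs (independent₁ q≢0) b″ x₀ x
              (⊥₁ {u = q} {x₀} q⊥x₀) (⊥₁ {u = q} {x} q⊥x)))
          ∷ hyp 2 (con 3) v2 (proj₂ (proj₂ q-heavy)) ∷ hyp 1 (con 4) v3 (≥-of b″-0) ∷ [])

    τ : V₅ → ℕ
    τ x = Γ″ x + e x ∸ δ (q · x)

    -- This is 6(1 + 3γ(c)), with total 6 * 4: what remains in the quotient behaves like a line,
    -- which lies in the plane c when γ(c) = 1 and meets it in mass 1 when γ(c) = 0.
    M-τ : ∀ c → c · x₀ ≡ 0₃ → M τ c ≡ 6 + 18 * γ c
    M-τ c c⊥x₀ = linear {ρ = ρ} 1 v0 (con 6 :+ 18 :* v4)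
      ( eqn 1 (v0 :+ v3) (v1 :+ v2) (sym eq)
      ∷ eqn 1 v1 (con 30 :+ 18 :* v5) (M-Γ″ c c⊥x₀) ∷ eqn 1 v2 (con 3) (M-e c c⊥x₀)
      ∷ eqn 1 (con 27 :+ 54 :* v6) v3 (sym (M₂-one-mult q c q≢0)) ∷ eqn 18 v5 (v4 :+ 3 :* v6) (b″≡γ c) ∷ []) refl
      where
      ρ : Vec ℕ 7
      ρ = M τ c ∷ M Γ″ c ∷ M e c ∷ M₂ one q c ∷ γ c ∷ b″ c ∷ mult qs c ∷ []
      eq : M Γ″ c + M e c ≡ M τ c + M₂ one q c
      eq = begin
        M Γ″ c + M e c                       ≡⟨ sym (M-+ Γ″ e c) ⟩
        M (λ x → Γ″ x + e x) c               ≡⟨ M-cong (λ x → ∸-split (τ-bound x)) c ⟩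
        M (λ x → τ x + δ (q · x)) c          ≡⟨ M-+ τ (λ x → δ (q · x)) c ⟩
        M τ c + M (λ x → δ (q · x)) c        ≡⟨ cong (M τ c +_) (M-cong (λ x → sym (*-identityʳ (δ (q · x)))) c) ⟩
        M τ c + M₂ one q c                   ∎
        where open ≡-Reasoning

    ∑-τ : ∑ τ ≡ 24
    ∑-τ = trans (sym (M-0ᵥ τ)) (trans (M-τ 0ᵥ (·-0ˡ x₀)) (cong (λ m → 6 + 18 * m) γ-0))

    γ≤1 : ∀ c → c · x₀ ≡ 0₃ → γ c ≤ 1
    γ≤1 c p = by-contra λ r → farkas {ρ = γ c ∷ M τ c ∷ ∑ τ ∷ []}
      ( hyp 18 (con 2) v0 r ∷ hyp 1 (con 6 :+ 18 :* v0) v1 (≥-of (M-τ c p)) ∷ hyp 1 v1 v2 (M-≤-∑ τ c) ∷ hyp 1 v2 (con 24) (≤-of ∑-τ) ∷ [])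

    -- γ(c) = 1 says that τ is supported on the hyperplane c.
    γ-support : ∀ c → c · x₀ ≡ 0₃ → γ c ≡ 1 → ∀ x → on c τ x ≡ τ x
    γ-support c p r = ∑-squeeze (λ x → δ-≤ (c · x) (τ x))
      (≤-of (trans ∑-τ (sym (trans (M-τ c p) (cong (λ m → 6 + 18 * m) r)))))

    γ-closed : ∀ c d → c · x₀ ≡ 0₃ → d · x₀ ≡ 0₃ → γ c ≡ 1 → γ d ≡ 1 → γ (c ⊕ d) ≡ 1
    γ-closed c d p r γc γd = ≤-antisym (γ≤1 (c ⊕ d) c+d⊥x₀)
      (by-contra λ s → farkas {ρ = γ (c ⊕ d) ∷ M τ (c ⊕ d) ∷ ∑ τ ∷ []}
        ( hyp 18 (con 1 :+ v0) (con 1) s ∷ hyp 1 v1 (con 6 :+ 18 :* v0) (≤-of (M-τ (c ⊕ d) c+d⊥x₀))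
        ∷ hyp 1 v2 v1 (≤-of (∑-cong λ x → trans (meet (τ x) (c · x) (d · x) (γ-support c p γc x) (γ-support d r γd x))
            (cong (λ t → δ t * τ x) (sym (·-⊕ˡ c d x))))) ∷ hyp 1 (con 24) v2 (≥-of ∑-τ) ∷ []))
      where
      c+d⊥x₀ : (c ⊕ d) · x₀ ≡ 0₃
      c+d⊥x₀ = trans (·-⊕ˡ c d x₀) (cong₂ _+₃_ p r)
      meet : ∀ m s t → δ s * m ≡ m → δ t * m ≡ m → m ≡ δ (s +₃ t) * m
      meet m 0₃ 0₃ _ _ = sym (+-identityʳ m)
      meet m (F.suc s) t u _ = trans (sym u) (sym (trans (cong (δ (F.suc s +₃ t) *_) (sym u)) (*-zeroʳ (δ (F.suc s +₃ t)))))
      meet m 0₃ (F.suc t) _ u = trans (sym u) (sym (trans (cong (δ (0₃ +₃ F.suc t) *_) (sym u)) (*-zeroʳ (δ (0₃ +₃ F.suc t)))))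

    M-γ : M γ x₀ ≡ 9
    M-γ = +-cancelʳ-≡ 9 (M γ x₀) 9 (trans (cong (M γ x₀ +_) (sym nine)) (trans (sym (M-+ γ (λ v → 3 * mult qs v) x₀))
      (trans (sym (M-cong b″≡γ x₀)) M-b″)))
      where
      nine : M (λ v → 3 * mult qs v) x₀ ≡ 9
      nine = trans (M-* 3 (mult qs) x₀) (cong (3 *_) (M-mult-⊥ qs x₀ (⊥₁ {u = q} {x₀} q⊥x₀)))

    -- All that was subtracted from b is divisible by 3. Hence the set γ = 1, obtained from choices
    -- of y and q, depends on x₀ and b alone.
    residue : ∀ v → ρ₃ (b v) ≡ ρ₃ (γ v)
    residue v = trans (cong ρ₃ (trans (b≡γ v) (regroup (γ v) (mult qs v) (mult ys v) (mult [] v))))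
      (trans (ρ₃-+ (γ v) (3 * m)) (trans (cong (ρ₃ (γ v) +₃_) (trans (ρ₃-* 3 m) (*₃-zeroˡ (ρ₃ m)))) (+₃-idʳ (ρ₃ (γ v)))))
      where
      m = mult qs v + (mult ys v + 3 * mult [] v)
      regroup : ∀ g m n k → g + 3 * m + (3 * n + 9 * k) ≡ g + 3 * (m + (n + 3 * k))
      regroup = solve-∀

    res₁→γ : ∀ v → v · x₀ ≡ 0₃ → Res₁ D v → γ v ≡ 1
    res₁→γ v p t = bit (γ v) (γ≤1 v p) (trans (sym (residue v)) t)
      where
      bit : ∀ m → m ≤ 1 → ρ₃ m ≡ 1₃ → m ≡ 1
      bit zero _ ()
      bit (suc zero) _ _ = refl
      bit (suc (suc m)) (s≤s ()) _

    γ→res₁ : ∀ v → γ v ≡ 1 → Res₁ D v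
    γ→res₁ v r = trans (residue v) (cong ρ₃ r)

-- Sections at special points

module Geometry (D : Arc) where
  open Arc D
  open Dual D

  record Special (x : V₅) : Set where
    field
      x≢0   : ¬ x ≡ 0ᵥ
      F≡0   : F x ≡ 0
      y     : V₅
      y≢0   : ¬ y ≡ 0ᵥ
      y⊥x   : y · x ≡ 0₃
      3≤b-y : 3 ≤ b y

  module _ {x : V₅} (s : Special x) where
    open Special s
    private
      module S = Section D x y x≢0 F≡0 y≢0 y⊥x 3≤b-y
      module R = Residue D x y x≢0 F≡0 y≢0 y⊥x 3≤b-y

    heavy : ∃ S.Heavy
    heavy = [ id , (λ none → ⊥-elim (S.heavy-exists none)) ]′
      (search λ q → ¬? (q ≟ᵥ 0ᵥ) ×-dec (q · x) F.≟ 0₃ ×-dec (3 ≤? S.b″ q))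

    private
      q = proj₁ heavy
      h = proj₂ heavy
      γ = R.γ q h

    InSection : V₅ → Set
    InSection v = v · x ≡ 0₃ × Res₁ D v

    section-0 : InSection 0ᵥ
    section-0 = ·-0ˡ x , cong ρ₃ b-0

    section-⊕ : ∀ {c d} → InSection c → InSection d → InSection (c ⊕ d)
    section-⊕ {c} {d} (c⊥x , rc) (d⊥x , rd) = trans (·-⊕ˡ c d x) (cong₂ _+₃_ c⊥x d⊥x) ,
      R.γ→res₁ q h (c ⊕ d) (R.γ-closed q h c d c⊥x d⊥x (R.res₁→γ q h c c⊥x rc) (R.res₁→γ q h d d⊥x rd))

    section-scale : ∀ a {c} → InSection c → InSection (scale a c)
    section-scale 0₃ {c} _ = subst InSection (sym (scale-0 c)) section-0
    section-scale 1₃ {c} i = subst InSection (sym (scale-1 c)) i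
    section-scale 2₃ {c} (c⊥x , rc) = trans (·-scaleˡ 2₃ c x) (cong (2₃ *₃_) c⊥x) , trans (cong ρ₃ (b-⊖ c)) rc

    section-comb : ∀ {k} (us : Vec V₅ k) → (∀ i → InSection (lookup us i)) → ∀ cs → InSection (comb cs us)
    section-comb [] p [] = section-0
    section-comb (u ∷ us) p (c ∷ cs) = section-⊕ (section-scale c (p F.zero)) (section-comb us (λ i → p (F.suc i)) cs)

    -- The characteristic function of the section, since γ is 0 or 1 on hyperplanes through x.
    σ : V₅ → ℕ
    σ = on x γ

    σ-∈ : ∀ {v} → InSection v → σ v ≡ 1
    σ-∈ {v} (v⊥x , r) = trans (cong₂ (λ t m → δ t * m) (trans (·-comm x v) v⊥x) (R.res₁→γ q h v v⊥x r)) refl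

    σ-∉ : ∀ v → ¬ InSection v → σ v ≡ 0
    σ-∉ v out = at (x · v) refl
      where
      at : ∀ t → x · v ≡ t → σ v ≡ 0
      at (F.suc t) p = cong (λ t → δ t * γ v) p
      at 0₃ p = trans (cong (λ t → δ t * γ v) p) (trans (+-identityʳ (γ v)) (bit (γ v) (R.γ≤1 q h v v⊥x) λ r → out (v⊥x , R.γ→res₁ q h v r)))
        where
        v⊥x : v · x ≡ 0₃
        v⊥x = trans (·-comm v x) p
        bit : ∀ m → m ≤ 1 → ¬ m ≡ 1 → m ≡ 0
        bit zero _ _ = refl
        bit (suc zero) _ r = ⊥-elim (r refl)
        bit (suc (suc m)) (s≤s ()) _

    InSection? : ∀ v → Dec (InSection v)
    InSection? v = (v · x) F.≟ 0₃ ×-dec ρ₃ (b v) F.≟ 1₃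

    ∑-σ : ∑ σ ≡ 9
    ∑-σ = R.M-γ q h

    section-span : ∀ {c d v} → Independent (c ∷ d ∷ []) → InSection c → InSection d → InSection v → InSpan (c ∷ d ∷ []) v
    section-span {c} {d} {v} ind i j l = span-fills (c ∷ d ∷ []) ind σ (λ cs → ≥-of (σ-∈ (section-comb (c ∷ d ∷ []) ij cs)))
      (≤-of ∑-σ) v (≥-of (σ-∈ l))
      where
      ij : ∀ k → InSection (lookup (c ∷ d ∷ []) k)
      ij F.zero = i
      ij (F.suc F.zero) = j

    section-escape : ∀ {k} (us : Vec V₅ k) → Independent us → 3 ^ k ≤ 8 → ∃ λ v → InSection v × ¬ InSpan us v
    section-escape us ind small = found (escape-span us ind σ (λ v → bit v (InSection? v)) (≤-trans (s≤s small) (≥-of ∑-σ)))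
      where
      bit : ∀ v → Dec (InSection v) → σ v ≤ 1
      bit v (yes i) = ≤-of (σ-∈ i)
      bit v (no i) = ≤-trans (≤-of (σ-∉ v i)) z≤n
      found : (∃ λ v → 1 ≤ σ v × ¬ InSpan us v) → ∃ λ v → InSection v × ¬ InSpan us v
      found (v , p , v∉) = v , decide (InSection? v) , v∉
        where
        decide : Dec (InSection v) → InSection v
        decide (yes i) = i
        decide (no i) = ⊥-elim (1+n≰n (≤-trans p (≤-of (σ-∉ v i))))

    -- A two-dimensional space meets every hyperplane: for independent c and d in the section, one
    -- of c, d, c + d, c - d is orthogonal to x′.
    section-meets : ∀ x′ → ∃ λ v → ¬ v ≡ 0ᵥ × InSection v × v · x′ ≡ 0₃
    section-meets x′ = step (section-escape [] independent-[] (s≤s z≤n))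
      where
      Goal = ∃ λ v → ¬ v ≡ 0ᵥ × InSection v × v · x′ ≡ 0₃
      step₂ : ∀ c → InSection c → ¬ c ≡ 0ᵥ → (∃ λ d → InSection d × ¬ InSpan (c ∷ []) d) → Goal
      step₂ c i c≢0 (d , j , out) = at (c · x′) (d · x′) refl refl
        where
        ind : Independent (d ∷ c ∷ [])
        ind = independent-∷ (independent₁ c≢0) out
        by-sum : ∀ s t → s +₃ t ≡ 0₃ → c · x′ ≡ s → d · x′ ≡ t → Goal
        by-sum s t r p p′ = c ⊕ d , (λ z → independent-≢ ind (a1 ⟨+⟩ a0) (λ ()) z) , section-⊕ i j , trans (·-⊕ˡ c d x′) (trans (cong₂ _+₃_ p p′) r)
        difference : ∀ s t → s +₃ (-₃ t) ≡ 0₃ → c · x′ ≡ s → d · x′ ≡ t → Goal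
        difference s t r p p′ = c ⊝ d , (λ z → independent-≢ ind (a1 ⟨-⟩ a0) (λ ()) z) , section-⊕ i (section-scale 2₃ j) ,
          trans (·-⊝ˡ c d x′) (trans (cong₂ (λ s t → s +₃ (-₃ t)) p p′) r)
        at : ∀ s t → c · x′ ≡ s → d · x′ ≡ t → Goal
        at 0₃ t p _ = c , c≢0 , i , p
        at (F.suc s) 0₃ _ p = d , independent-≢ ind a0 (λ ()) , j , p
        at 1₃ 1₃ = difference 1₃ 1₃ refl
        at 1₃ 2₃ = by-sum 1₃ 2₃ refl
        at 2₃ 1₃ = by-sum 2₃ 1₃ refl
        at 2₃ 2₃ = difference 2₃ 2₃ refl
      step : (∃ λ c → InSection c × ¬ InSpan [] c) → Goal
      step (c , i , out) = step₂ c i c≢0 (section-escape (c ∷ []) (independent₁ c≢0) (≤ᵇ⇒≤ 3 8 tt))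
        where
        c≢0 : ¬ c ≡ 0ᵥ
        c≢0 p = out ([] , p)

    private
      q≢0 : ¬ q ≡ 0ᵥ
      q≢0 = proj₁ h

      mult-≤1 : ∀ {u : V₅} → ¬ u ≡ 0ᵥ → ∀ v → mult (u ∷ []) v ≤ 1
      mult-≤1 {u} u≢0 v = decide (InSpan? (u ∷ []) v)
        where
        decide : Dec (InSpan (u ∷ []) v) → mult (u ∷ []) v ≤ 1
        decide (yes i) = ≤-of (mult-∈ (u ∷ []) (independent₁ u≢0) i)
        decide (no i) = ≤-trans (≤-of (mult-∉ (u ∷ []) i)) z≤n

      b-form : ∀ v {m n k} → mult (q ∷ []) v ≡ m → mult (y ∷ []) v ≡ n → mult [] v ≡ k → b v ≡ γ v + 3 * m + (3 * n + 9 * k)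
      b-form v refl refl refl = R.b≡γ q h v

    -- At most 1 comes from γ, 3 from the plane y, and 3 more if q is the same plane. A solid with
    -- larger b therefore has no points of multiplicity zero.
    b-y≤7 : b y ≤ 7
    b-y≤7 = by-contra λ r → farkas {ρ = b y ∷ γ y ∷ mult (q ∷ []) y ∷ []}
      ( hyp 1 (con 8) v0 r ∷ hyp 1 v0 (v1 :+ 3 :* v2 :+ con 3) (≤-of (b-form y refl (mult-self y≢0) (mult-∉ [] (∉-[] y≢0))))
      ∷ hyp 1 v1 (con 1) (R.γ≤1 q h y y⊥x) ∷ hyp 3 v2 (con 1) (mult-≤1 q≢0 y) ∷ [])

    -- If b(y) < 6, the second multiplicity-three hyperplane through x is different from y.
    second : b y ≤ 5 → b y ≤ 4 × ∃ λ q → ¬ q ≡ 0ᵥ × q · x ≡ 0₃ × ¬ InSpan (y ∷ []) q × 3 ≤ b q × b q ≤ 4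
    second small = b-y≤4 , q , q≢0 , proj₁ (proj₂ h) , q∉y ,
      ≤-trans (proj₂ (proj₂ h)) (≤-trans (m≤m+n (S.b″ q) (S.w″ q)) (≥-of (S.b≡b″ q))) , b-q≤4
      where
      y∉q : ¬ InSpan (q ∷ []) y
      y∉q i = farkas {ρ = b y ∷ γ y ∷ []} ( hyp 1 v0 (con 5) small
        ∷ hyp 1 (v1 :+ con 3 :+ con 3) v0 (≥-of (b-form y (mult-∈ (q ∷ []) (independent₁ q≢0) i) (mult-self y≢0) (mult-∉ [] (∉-[] y≢0)))) ∷ [])
      q∉y : ¬ InSpan (y ∷ []) q
      q∉y i = y∉q (span₁-sym q≢0 i)
      b-y≤4 : b y ≤ 4
      b-y≤4 = ≤-trans (≤-of (b-form y (mult-∉ (q ∷ []) y∉q) (mult-self y≢0) (mult-∉ [] (∉-[] y≢0))))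
        (≤-trans (≤-of (cong (_+ 3) (+-identityʳ (γ y)))) (+-monoˡ-≤ 3 (R.γ≤1 q h y y⊥x)))
      b-q≤4 : b q ≤ 4
      b-q≤4 = ≤-trans (≤-of (b-form q (mult-self q≢0) (mult-∉ (y ∷ []) q∉y) (mult-∉ [] (∉-[] q≢0))))
        (≤-trans (≤-of (+-identityʳ (γ q + 3))) (+-monoˡ-≤ 3 (R.γ≤1 q h q (proj₁ (proj₂ h)))))

    module _ (gap : ∀ v → ¬ v ≡ 0ᵥ → 3 ≤ b v → 6 ≤ b v) where

      -- A plane q different from y would have b(q) = γ(q) + 3 ≤ 4, a value excluded by `gap`.
      q∈y : InSpan (y ∷ []) q
      q∈y = decide (InSpan? (y ∷ []) q)
        where
        decide : Dec (InSpan (y ∷ []) q) → InSpan (y ∷ []) q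
        decide (yes i) = i
        decide (no i) = ⊥-elim (farkas {ρ = b q ∷ γ q ∷ []}
          ( hyp 1 (con 6) v0 (gap q q≢0 (≤-trans (proj₂ (proj₂ h)) (≤-trans (m≤m+n (S.b″ q) (S.w″ q)) (≥-of (S.b≡b″ q)))))
          ∷ hyp 1 v0 (v1 :+ con 3 :+ con 0) (≤-of (b-form q (mult-self q≢0) (mult-∉ (y ∷ []) i) (mult-∉ [] (∉-[] q≢0))))
          ∷ hyp 1 v1 (con 1) (R.γ≤1 q h q (proj₁ (proj₂ h))) ∷ []))

      others≤1 : ∀ v → ¬ v ≡ 0ᵥ → v · x ≡ 0₃ → ¬ InSpan (y ∷ []) v → b v ≤ 1
      others≤1 v v≢0 v⊥x v∉y = ≤-trans (≤-of (trans (b-form v (mult-∉ (q ∷ []) v∉q) (mult-∉ (y ∷ []) v∉y) (mult-∉ [] (∉-[] v≢0)))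
          (trans (+-identityʳ (γ v + 0)) (+-identityʳ (γ v))))) (R.γ≤1 q h v v⊥x)
        where
        v∉q : ¬ InSpan (q ∷ []) v
        v∉q i = v∉y (span₁-⊆ q∈y i)

-- Holes, stars and triangles of sections

module Triangles (D : Arc) where
  open Arc D
  open Dual D
  open Geometry D

  Heavy : V₅ → Set
  Heavy y = ¬ y ≡ 0ᵥ × 3 ≤ b y

  Hole : V₅ → V₅ → Set
  Hole y x = ¬ x ≡ 0ᵥ × y · x ≡ 0₃ × F x ≡ 0

  special : ∀ {y x} → Heavy y → Hole y x → Special x
  special {y} (y≢0 , 3≤b) (x≢0 , y⊥x , F≡0) = record { x≢0 = x≢0 ; F≡0 = F≡0 ; y = y ; y≢0 = y≢0 ; y⊥x = y⊥x ; 3≤b-y = 3≤b }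

  Special? : ∀ x → Dec (Special x)
  Special? x = [ (λ { (y , x≢0 , F≡0 , y≢0 , y⊥x , 3≤b) → yes (special (y≢0 , 3≤b) (x≢0 , y⊥x , F≡0)) }) ,
    (λ none → no λ s → let open Special s in none y (x≢0 , F≡0 , y≢0 , y⊥x , 3≤b-y)) ]′
    (search λ y → ¬? (x ≟ᵥ 0ᵥ) ×-dec (F x ≟ 0) ×-dec ¬? (y ≟ᵥ 0ᵥ) ×-dec (y · x) F.≟ 0₃ ×-dec (3 ≤? b y))

  full-≥ : ∀ y → (∀ x → ¬ Hole y x) → ∀ x → ¬ x ≡ 0ᵥ → y · x ≡ 0₃ → 1 ≤ F x
  full-≥ y none x x≢0 y⊥x = n≢0⇒n>0 λ F≡0 → none x (x≢0 , y⊥x , F≡0)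

  Hole? : ∀ y x → Dec (Hole y x)
  Hole? y x = ¬? (x ≟ᵥ 0ᵥ) ×-dec (y · x) F.≟ 0₃ ×-dec (F x ≟ 0)

  -- A solid without holes has 40 positive points, but the mass of y is at most 22 + 3 * 5 = 37.
  hole-exists : ∀ y → b y ≤ 5 → ∃ (Hole y)
  hole-exists y small = [ id , (λ none → ⊥-elim (absurd none)) ]′ (search (Hole? y))
    where
    absurd : (∀ x → ¬ Hole y x) → ⊥
    absurd none = farkas {ρ = b y ∷ M F y ∷ M one y ∷ M (mult []) y ∷ []}
      ( hyp 6 v0 (con 5) small ∷ hyp 1 v1 (con 44 :+ 6 :* v0) (≤-of (M-F y)) ∷ hyp 1 (con 81) v2 (M-one-≥ y)
      ∷ hyp 1 v2 (v1 :+ v3) (≤-trans (M-mono y bound) (≤-of (M-+ F (mult []) y))) ∷ hyp 1 v3 (con 1) (≤-of (M-mult-⊥ [] y (⊥[] {x = y}))) ∷ [])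
      where
      bound : ∀ x → y · x ≡ 0₃ → 1 ≤ F x + mult [] x
      bound x y⊥x = decide (x ≟ᵥ 0ᵥ)
        where
        decide : Dec (x ≡ 0ᵥ) → 1 ≤ F x + mult [] x
        decide (yes p) = ≤-trans (≥-of (mult-∈ [] independent-[] ([] , p))) (m≤n+m (mult [] x) (F x))
        decide (no p) = ≤-trans (full-≥ y none x p y⊥x) (m≤m+n (F x) (mult [] x))

  Star : V₅ → Set
  Star z = ∀ x → Special x → z · x ≡ 0₃

  star-full : ∀ {z y} → Star z → Heavy y → ∀ x → y · x ≡ 0₃ → ¬ z · x ≡ 0₃ → 1 ≤ F x
  star-full {z} star hy x y⊥x z∤x = n≢0⇒n>0 λ F≡0 → z∤x (star x (special hy (x≢0 , y⊥x , F≡0)))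
    where
    x≢0 : ¬ x ≡ 0ᵥ
    x≢0 p = z∤x (trans (cong (z ·_) p) (·-0ʳ z))

  -- The 27 points of the solid y off z have mass at least 27. Their mass is 22 + 3 b(y) less that
  -- of the plane y ∩ z, which is 6 plus the sum of b over the pencil.
  full-bound : ∀ {z y} → (∀ x → y · x ≡ 0₃ → ¬ z · x ≡ 0₃ → 1 ≤ F x) → Independent (y ∷ z ∷ []) →
    11 + (b z + b (y ⊕ z) + b (y ⊝ z)) ≤ 2 * b y
  full-bound {z} {y} full ind = by-contra λ r → farkas
    {ρ = b y ∷ b z ∷ b (y ⊕ z) ∷ b (y ⊝ z) ∷ M F y ∷ M₂ F y z ∷ M one y ∷ M₂ one y z ∷ []}
    ( hyp 2 (con 1 :+ 2 :* v0) (con 11 :+ (v1 :+ v2 :+ v3)) r ∷ hyp 1 v4 (con 44 :+ 6 :* v0) (≤-of (M-F y))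
    ∷ hyp 1 (con 12 :+ 2 :* (v0 :+ v1 :+ v2 :+ v3)) v5 (≥-of (M₂-F y z)) ∷ hyp 1 (con 81) v6 (M-one-≥ y)
    ∷ hyp 1 v7 (con 27) (≤-of (M₂-one ind)) ∷ hyp 1 (v5 :+ v6) (v4 :+ v7) count ∷ [])
    where
    count : M₂ F y z + M one y ≤ M F y + M₂ one y z
    count = begin
      M₂ F y z + M one y                    ≡⟨ cong (_+ M one y) (M₂-comm F y z) ⟩
      M₂ F z y + M one y                    ≡⟨ sym (M-+ (on z F) one y) ⟩
      M (λ x → on z F x + 1) y              ≤⟨ M-mono y (λ x y⊥x → bound x (z · x) refl y⊥x) ⟩
      M (λ x → F x + on z one x) y          ≡⟨ M-+ F (on z one) y ⟩
      M F y + M₂ one z y                    ≡⟨ cong (M F y +_) (M₂-comm one z y) ⟩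
      M F y + M₂ one y z                    ∎
      where
      open ≤-Reasoning
      bound : ∀ x t → z · x ≡ t → y · x ≡ 0₃ → on z F x + 1 ≤ F x + on z one x
      bound x 0₃ p _ = ≤-of (cong₂ _+_ (trans (cong (λ t → δ t * F x) p) (+-identityʳ (F x))) (sym (cong (λ t → δ t * 1) p)))
      bound x (F.suc t) p q = ≤-trans (≤-of (cong (λ t → δ t * F x + 1) p)) (≤-trans
        (full x q λ r → case trans (sym r) p of λ ()) (m≤m+n (F x) _))

  star-bound : ∀ {z y} → Star z → Heavy y → Independent (y ∷ z ∷ []) →
    11 + (b z + b (y ⊕ z) + b (y ⊝ z)) ≤ 2 * b y
  star-bound {z} star hy = full-bound (star-full {z} star hy)

  NoStar : Set
  NoStar = ∀ z → ¬ z ≡ 0ᵥ → Res₁ D z → ¬ Star z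

  escape : NoStar → ∀ z → ¬ z ≡ 0ᵥ → Res₁ D z → ∃ λ x → Special x × ¬ z · x ≡ 0₃
  escape nostar z z≢0 rz = [ id , (λ none → ⊥-elim (nostar z z≢0 rz λ x s → decide x s none ((z · x) F.≟ 0₃))) ]′
    (search λ x → Special? x ×-dec ¬? ((z · x) F.≟ 0₃))
    where
    decide : ∀ x → Special x → (∀ x → ¬ (Special x × ¬ z · x ≡ 0₃)) → Dec (z · x ≡ 0₃) → z · x ≡ 0₃
    decide x s none (yes p) = p
    decide x s none (no p) = ⊥-elim (none x (s , p))

  -- Three special points whose sections pairwise meet in p, q and r.
  record Triangle (x₁ : V₅) (s₁ : Special x₁) : Set where
    field
      x₂ x₃ : V₅
      s₂ : Special x₂
      s₃ : Special x₃
      p q r : V₅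
      p₁ : InSection s₁ p
      p₂ : InSection s₂ p
      q₁ : InSection s₁ q
      q₃ : InSection s₃ q
      r₂ : InSection s₂ r
      r₃ : InSection s₃ r
      independent : Independent (p ∷ q ∷ r ∷ [])
    basis : Vec V₅ 3
    basis = p ∷ q ∷ r ∷ []

  -- The absence of stars is used twice. A special x₂ off a vector z of the first section makes the
  -- first two sections differ; a special x₃ off p keeps p out of the span of q and r. If q were a
  -- multiple of r, then p and q would span the first section inside the orthogonal space of x₂,
  -- against the choice of z.
  triangle : NoStar → ∀ {x₁} (s₁ : Special x₁) → Triangle x₁ s₁
  triangle nostar {x₁} s₁ = step₁ (section-escape s₁ [] independent-[] (s≤s z≤n))
    where
    step₃ : ∀ z → InSection s₁ z → ∀ {x₂} (s₂ : Special x₂) → ¬ z · x₂ ≡ 0₃ →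
      ∀ p → ¬ p ≡ 0ᵥ → InSection s₁ p → p · x₂ ≡ 0₃ →
      ∀ {x₃} (s₃ : Special x₃) → ¬ p · x₃ ≡ 0₃ →
      (∃ λ q → ¬ q ≡ 0ᵥ × InSection s₁ q × q · x₃ ≡ 0₃) → (∃ λ r → ¬ r ≡ 0ᵥ × InSection s₂ r × r · x₃ ≡ 0₃) → Triangle x₁ s₁
    step₃ z z∈ {x₂} s₂ z∤x₂ p p≢0 p₁ p⊥x₂ {x₃} s₃ p∤x₃ (q , q≢0 , q₁ , q⊥x₃) (r , r≢0 , r₂ , r⊥x₃) = record
      { x₂ = x₂ ; x₃ = x₃ ; s₂ = s₂ ; s₃ = s₃ ; p = p ; q = q ; r = r ; p₁ = p₁ ; p₂ = p⊥x₂ , proj₂ p₁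
      ; q₁ = q₁ ; q₃ = q⊥x₃ , proj₂ q₁ ; r₂ = r₂ ; r₃ = r⊥x₃ , proj₂ r₂
      ; independent = independent-∷ (independent-∷ (independent₁ r≢0) q∉r) (∉-span x₃ (⊥₂ {u = q} {r} {x₃} q⊥x₃ r⊥x₃) p∤x₃) }
      where
      q∉r : ¬ InSpan (r ∷ []) q
      q∉r (a ∷ [] , e) = z∤x₂ (z⊥x₂ (section-span s₁ (independent-∷ (independent₁ q≢0) (∉-span x₃ (⊥₁ {u = q} {x₃} q⊥x₃) p∤x₃)) p₁ q₁ z∈))
        where
        q⊥x₂ : q · x₂ ≡ 0₃
        q⊥x₂ = trans (cong (_· x₂) e) (⊥-comb (r ∷ []) x₂ (⊥₁ {u = r} {x₂} (proj₁ r₂)) (a ∷ []))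
        z⊥x₂ : InSpan (p ∷ q ∷ []) z → z · x₂ ≡ 0₃
        z⊥x₂ (cs , e′) = trans (cong (_· x₂) e′) (⊥-comb (p ∷ q ∷ []) x₂ (⊥₂ {u = p} {q} {x₂} p⊥x₂ q⊥x₂) cs)
    step₂ : ∀ z → InSection s₁ z → (∃ λ x₂ → Special x₂ × ¬ z · x₂ ≡ 0₃) → Triangle x₁ s₁
    step₂ z z∈ (x₂ , s₂ , z∤x₂) = at (section-meets s₁ x₂)
      where
      at : (∃ λ p → ¬ p ≡ 0ᵥ × InSection s₁ p × p · x₂ ≡ 0₃) → Triangle x₁ s₁
      at (p , p≢0 , p₁ , p⊥x₂) = at₃ (escape nostar p p≢0 (proj₂ p₁))
        where
        at₃ : (∃ λ x₃ → Special x₃ × ¬ p · x₃ ≡ 0₃) → Triangle x₁ s₁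
        at₃ (x₃ , s₃ , p∤x₃) = step₃ z z∈ s₂ z∤x₂ p p≢0 p₁ p⊥x₂ s₃ p∤x₃ (section-meets s₁ x₃) (section-meets s₂ x₃)
    step₁ : (∃ λ z → InSection s₁ z × ¬ InSpan [] z) → Triangle x₁ s₁
    step₁ (z , z∈ , out) = step₂ z z∈ (escape nostar z (λ e → out ([] , e)) (proj₂ z∈))

  module _ {x₁} {s₁ : Special x₁} (△ : Triangle x₁ s₁) where
    open Triangle △

    private
      pair : ∀ {x} (s : Special x) {u v} → InSection s u → InSection s v → ∀ i → InSection s (lookup (u ∷ v ∷ []) i)
      pair s i j F.zero = i
      pair s i j (F.suc F.zero) = j

    -- Any hyperplane of the plane pqr through v meets the sides of the triangle in a spanning set.
    plane-section : ∀ {v x} → InSpan basis v → (s : Special x) → v · x ≡ 0₃ → InSection s v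
    plane-section {v} {x} (α ∷ β ∷ γ ∷ [] , e) s v⊥x = cases α β γ e
      where
      nonzero : ∀ a b c → ¬ a ≡ 0₃ → ¬ b ≡ 0₃ → ¬ c ≡ 0₃ → a +₃ (b +₃ c) ≡ 0₃ → (a ≡ b) × (b ≡ c)
      nonzero 0₃ b c p _ _ _ = ⊥-elim (p refl)
      nonzero a 0₃ c _ p _ _ = ⊥-elim (p refl)
      nonzero a b 0₃ _ _ p _ = ⊥-elim (p refl)
      nonzero 1₃ 1₃ 1₃ _ _ _ _ = refl , refl
      nonzero 2₃ 2₃ 2₃ _ _ _ _ = refl , refl
      nonzero 1₃ 1₃ 2₃ _ _ _ ()
      nonzero 1₃ 2₃ 1₃ _ _ _ ()
      nonzero 1₃ 2₃ 2₃ _ _ _ ()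
      nonzero 2₃ 1₃ 1₃ _ _ _ ()
      nonzero 2₃ 1₃ 2₃ _ _ _ ()
      nonzero 2₃ 2₃ 1₃ _ _ _ ()
      module _ (c d f : F₃) (e : v ≡ comb (c ∷ d ∷ f ∷ []) basis) where
        p′ = scale c p
        q′ = scale d q
        r′ = scale f r
        pqr : Vec V₅ 3
        pqr = p′ ∷ q′ ∷ r′ ∷ []
        e′ : v ≡ p′ ⊕ (q′ ⊕ r′)
        e′ = trans e (cong (λ t → p′ ⊕ (q′ ⊕ t)) (⊕-idʳ r′))
        sum-zero : (p′ · x) +₃ ((q′ · x) +₃ (r′ · x)) ≡ 0₃
        sum-zero = trans (sym (trans (·-⊕ˡ p′ (q′ ⊕ r′) x) (cong ((p′ · x) +₃_) (·-⊕ˡ q′ r′ x)))) (trans (cong (_· x) (sym e′)) v⊥x)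
        res-p = proj₂ (section-scale s₁ c p₁)
        res-q = proj₂ (section-scale s₁ d q₁)
        res-r = proj₂ (section-scale s₂ f r₂)
        res-qr = proj₂ (section-⊕ s₃ (section-scale s₃ d q₃) (section-scale s₃ f r₃))
        res-pr = proj₂ (section-⊕ s₂ (section-scale s₂ c p₂) (section-scale s₂ f r₂))
        res-pq = proj₂ (section-⊕ s₁ (section-scale s₁ c p₁) (section-scale s₁ d q₁))
        res-p-q = proj₂ (section-⊕ s₁ (section-scale s₁ c p₁) (section-scale s₁ 2₃ (section-scale s₁ d q₁)))
        res-q-r = proj₂ (section-⊕ s₃ (section-scale s₃ d q₃) (section-scale s₃ 2₃ (section-scale s₃ f r₃)))
        two : ∀ {u w} → Res₁ D u → Res₁ D w → v ≡ u ⊕ w → u · x ≡ 0₃ → w · x ≡ 0₃ → InSection s v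
        two ru rw e″ u⊥x w⊥x = subst (InSection s) (sym e″) (section-⊕ s (u⊥x , ru) (w⊥x , rw))
        other : ∀ {u w} → v ≡ u ⊕ w → u · x ≡ 0₃ → w · x ≡ 0₃
        other {u} {w} e″ u⊥x = trans (sym (+₃-idˡ (w · x))) (trans (cong (_+₃ (w · x)) (sym u⊥x)) (trans (sym (·-⊕ˡ u w x)) (trans (cong (_· x) (sym e″)) v⊥x)))
        split : Dec (p′ · x ≡ 0₃) → Dec (q′ · x ≡ 0₃) → Dec (r′ · x ≡ 0₃) → InSection s v
        split (yes k) _ _ = two res-p res-qr e′ k (other e′ k)
        split _ (yes k) _ = two res-q res-pr e″ k (other e″ k)
          where
          e″ : v ≡ q′ ⊕ (p′ ⊕ r′)
          e″ = trans e′ (by-coef pqr (a0 ⟨+⟩ (a1 ⟨+⟩ a2)) (a1 ⟨+⟩ (a0 ⟨+⟩ a2)) refl)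
        split _ _ (yes k) = two res-r res-pq e″ k (other e″ k)
          where
          e″ : v ≡ r′ ⊕ (p′ ⊕ q′)
          e″ = trans e′ (by-coef pqr (a0 ⟨+⟩ (a1 ⟨+⟩ a2)) (a2 ⟨+⟩ (a0 ⟨+⟩ a1)) refl)
        -- Three nonzero elements of F₃ with sum zero are equal, so both differences vanish at x;
        -- and p + q + r = (p - q) - (q - r) modulo 3.
        split (no i) (no j) (no k) = subst (InSection s) (sym e″)
            (section-⊕ s (equal p′ q′ (proj₁ same) , res-p-q) (section-scale s 2₃ (equal q′ r′ (proj₂ same) , res-q-r)))
          where
          same = nonzero (p′ · x) (q′ · x) (r′ · x) i j k sum-zero
          e″ : v ≡ (p′ ⊝ q′) ⊕ scale 2₃ (q′ ⊝ r′)
          e″ = trans e′ (by-coef pqr (a0 ⟨+⟩ (a1 ⟨+⟩ a2)) ((a0 ⟨-⟩ a1) ⟨+⟩ 2₃ ⟨*⟩ (a1 ⟨-⟩ a2)) refl)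
          equal : ∀ u w → u · x ≡ w · x → (u ⊝ w) · x ≡ 0₃
          equal u w k = trans (·-⊝ˡ u w x) (trans (cong (_+₃ (-₃ (w · x))) k) (from-yes (all? λ t → (t +₃ (-₃ t)) F.≟ 0₃) (w · x)))
      cases : ∀ c d f → v ≡ comb (c ∷ d ∷ f ∷ []) basis → InSection s v
      cases c d f e = split c d f e ((scale c p · x) F.≟ 0₃) ((scale d q · x) F.≟ 0₃) ((scale f r · x) F.≟ 0₃)

    zero-avoids : ∀ {v} → InSpan basis v → b v ≡ 0 → ∀ x → Special x → ¬ v · x ≡ 0₃
    zero-avoids {v} i bv x s v⊥x = case trans (cong ρ₃ (sym bv)) (proj₂ (plane-section i s v⊥x)) of λ ()

    -- With b(v) = 0 the solid v has mass 22, too small for two distinct full planes cut out by y₁ and y₂.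
    zero-dependent : ∀ {v y₁ y₂} → InSpan basis v → b v ≡ 0 → Heavy y₁ → Heavy y₂ → ¬ Independent (v ∷ y₁ ∷ y₂ ∷ [])
    zero-dependent {v} {y₁} {y₂} i bv h₁ h₂ ind = farkas
      {ρ = M F v ∷ M₃ one v y₁ y₂ ∷ M₂ one v y₁ ∷ M₂ one v y₂ ∷ M₂ F v (y₁ ⊕ y₂) ∷ b v ∷ b (y₁ ⊕ y₂) ∷ b (v ⊕ (y₁ ⊕ y₂)) ∷ b (v ⊝ (y₁ ⊕ y₂)) ∷ []}
      ( hyp 1 v0 (con 44 :+ 6 :* v5) (≤-of (M-F v)) ∷ hyp 6 v5 (con 0) (≤-of bv)
      ∷ hyp 2 v1 (con 9) (≤-of (M₃-one ind)) ∷ hyp 1 (con 27) v2 (M₂-one-≥ v y₁) ∷ hyp 1 (con 27) v3 (M₂-one-≥ v y₂)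
      ∷ hyp 1 (con 12 :+ 2 :* (v5 :+ v6 :+ v7 :+ v8)) v4 (≥-of (M₂-F v (y₁ ⊕ y₂)))
      ∷ hyp 1 (v2 :+ v3 :+ v4) (v0 :+ 2 :* v1) count ∷ [])
      where
      positive : ∀ {y} x → Heavy y → ¬ x ≡ 0ᵥ → v · x ≡ 0₃ → y · x ≡ 0₃ → 1 ≤ F x
      positive x hy x≢0 v⊥x y⊥x = n≢0⇒n>0 λ F≡0 → zero-avoids i bv x (special hy (x≢0 , y⊥x , F≡0)) v⊥x
      -- Points of v on y₁ or y₂ are positive by `zero-avoids`; off both, a point on y₁ + y₂ is
      -- counted with F itself. Summed over v this gives 27 + 27 + 12 ≤ 44 + 2 * 9, which is false.
      bound : ∀ x → v · x ≡ 0₃ → on y₁ one x + on y₂ one x + on (y₁ ⊕ y₂) F x ≤ F x + 2 * on y₂ (on y₁ one) x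
      bound x v⊥x = ≤-trans (≤-of (cong (λ t → on y₁ one x + on y₂ one x + δ t * F x) (·-⊕ˡ y₁ y₂ x)))
          (cases (y₁ · x) (y₂ · x) refl refl)
        where
        nz : ∀ {y a} → y · x ≡ F.suc a → ¬ x ≡ 0ᵥ
        nz {y} k refl = case trans (sym k) (·-0ʳ y) of λ ()
        cases : ∀ s t → y₁ · x ≡ s → y₂ · x ≡ t → δ (y₁ · x) * 1 + δ (y₂ · x) * 1 + δ ((y₁ · x) +₃ (y₂ · x)) * F x
          ≤ F x + 2 * (δ (y₂ · x) * (δ (y₁ · x) * 1))
        cases s t j k rewrite j | k = by s t j k
          where
          by : ∀ s t → y₁ · x ≡ s → y₂ · x ≡ t → δ s * 1 + δ t * 1 + δ (s +₃ t) * F x ≤ F x + 2 * (δ t * (δ s * 1))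
          by 0₃ 0₃ _ _ = ≤-of (lemma (F x))
            where
            lemma : ∀ m → 2 + (m + 0) ≡ m + 2
            lemma = solve-∀
          by 0₃ 1₃ j k = ≤-trans (positive x h₁ (nz {y₂} k) v⊥x j) (m≤m+n (F x) 0)
          by 0₃ 2₃ j k = ≤-trans (positive x h₁ (nz {y₂} k) v⊥x j) (m≤m+n (F x) 0)
          by 1₃ 0₃ j k = ≤-trans (positive x h₂ (nz {y₁} j) v⊥x k) (m≤m+n (F x) 0)
          by 2₃ 0₃ j k = ≤-trans (positive x h₂ (nz {y₁} j) v⊥x k) (m≤m+n (F x) 0)
          by 1₃ 1₃ _ _ = z≤n
          by 2₃ 2₃ _ _ = z≤n
          by 1₃ 2₃ _ _ = ≤-refl
          by 2₃ 1₃ _ _ = ≤-refl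
      count : M₂ one v y₁ + M₂ one v y₂ + M₂ F v (y₁ ⊕ y₂) ≤ M F v + 2 * M₃ one v y₁ y₂
      count = begin
        M₂ one v y₁ + M₂ one v y₂ + M₂ F v (y₁ ⊕ y₂)
          ≡⟨ cong₂ _+_ (cong₂ _+_ (M₂-comm one v y₁) (M₂-comm one v y₂)) (M₂-comm F v (y₁ ⊕ y₂)) ⟩
        M (on y₁ one) v + M (on y₂ one) v + M (on (y₁ ⊕ y₂) F) v
          ≡⟨ sym (trans (M-+ (λ x → on y₁ one x + on y₂ one x) (on (y₁ ⊕ y₂) F) v) (cong (_+ M (on (y₁ ⊕ y₂) F) v) (M-+ (on y₁ one) (on y₂ one) v))) ⟩
        M (λ x → on y₁ one x + on y₂ one x + on (y₁ ⊕ y₂) F x) v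
          ≤⟨ M-mono v bound ⟩
        M (λ x → F x + 2 * on y₂ (on y₁ one) x) v
          ≡⟨ trans (M-+ F (λ x → 2 * on y₂ (on y₁ one) x) v) (cong (M F v +_) (M-* 2 (on y₂ (on y₁ one)) v)) ⟩
        M F v + 2 * M (on y₂ (on y₁ one)) v
          ≡⟨ cong (λ m → M F v + 2 * m) (∑-cong λ x → lemma (δ (v · x)) (δ (y₂ · x)) (δ (y₁ · x))) ⟩
        M F v + 2 * M₃ one v y₁ y₂ ∎
        where
        open ≤-Reasoning
        lemma : ∀ a b c → a * (b * (c * 1)) ≡ b * (c * (a * 1))
        lemma = solve-∀

square-≤2 : ∀ m k → m ≤ 2 → m * m ≤ 2 * m + k
square-≤2 0 k _ = z≤n
square-≤2 1 k _ = s≤s z≤n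
square-≤2 2 k _ = m≤m+n 4 k
square-≤2 (suc (suc (suc m))) k (s≤s (s≤s ()))

-- Positive subspaces from hyperplanes with b between 3 and 5

module Outcome (D : Arc) where
  open Arc D
  open Dual D
  open Geometry D
  open Triangles D

  Plane : Set
  Plane = Σ (Vec V₅ 3) λ us → Independent us × (∀ cs → 1 ≤ b (comb cs us))

  plane-from : ∀ {x} {s : Special x} (△ : Triangle x s) →
    (∀ v → InSpan (Triangle.basis △) v → ¬ b v ≡ 0) → Plane
  plane-from △ pos = Triangle.basis △ , Triangle.independent △ , λ cs → n≢0⇒n>0 (pos (comb cs (Triangle.basis △)) (cs , refl))

  -- `second` supplies another heavy hyperplane q through the hole x, and both have b ≤ 4. A star z
  -- is not proportional to one of y and q, where the star bound fails as 2 * 4 < 11. A zero of b in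
  -- the plane of the triangle misses x, hence is independent of y and q, which `zero-dependent`
  -- forbids.
  light-plane : ∀ y → Heavy y → b y ≤ 5 → Plane
  light-plane y hy small = from-hole (hole-exists y small)
    where
    from-hole : ∃ (Hole y) → Plane
    from-hole (x , hole) = from-second (second s small)
      where
      s : Special x
      s = special hy hole
      from-second : (b y ≤ 4 × ∃ λ q → ¬ q ≡ 0ᵥ × q · x ≡ 0₃ × ¬ InSpan (y ∷ []) q × 3 ≤ b q × b q ≤ 4) → Plane
      from-second (b-y≤4 , q , q≢0 , q⊥x , q∉y , 3≤b-q , b-q≤4) = plane-from (triangle nostar s) λ v i bv →
          zero-dependent (triangle nostar s) i bv (q≢0 , 3≤b-q) hy
            (independent-∷ (independent-∷ (independent₁ (proj₁ hy)) q∉y)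
              (∉-span x (⊥₂ {u = q} {y} {x} q⊥x (proj₁ (proj₂ hole))) (zero-avoids (triangle nostar s) i bv x s)))
        where
        absurd : ∀ {z w} → ¬ z ≡ 0ᵥ → Star z → Heavy w → b w ≤ 4 → ¬ InSpan (z ∷ []) w → ⊥
        absurd {z} {w} z≢0 star hw small w∉z = farkas {ρ = b w ∷ b z ∷ b (w ⊕ z) ∷ b (w ⊝ z) ∷ []}
          ( hyp 1 (con 11 :+ (v1 :+ v2 :+ v3)) (2 :* v0) (star-bound star hw (independent-∷ (independent₁ z≢0) w∉z))
          ∷ hyp 2 v0 (con 4) small ∷ [])
        nostar : NoStar
        nostar z z≢0 _ star = decide (InSpan? (z ∷ []) y)
          where
          decide : Dec (InSpan (z ∷ []) y) → ⊥
          decide (no y∉z) = absurd z≢0 star hy b-y≤4 y∉z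
          decide (yes y∈z) = absurd z≢0 star (q≢0 , 3≤b-q) b-q≤4 λ q∈z → q∉y (span₁-trans (proj₁ hy) y∈z q∈z)

  -- As F² ≥ F, the second moment of b is at least 48 + 3 * 140 = 468. If b ≤ 2 off the origin, then
  -- b² ≤ 2b there and the second moment is at most 216 + 224, where 224 = 16² - 2 * 16.
  heavy-exists : ∃ Heavy
  heavy-exists = [ id , (λ none → ⊥-elim (absurd none)) ]′ (search λ y → ¬? (y ≟ᵥ 0ᵥ) ×-dec (3 ≤? b y))
    where
    absurd : (∀ y → ¬ Heavy y) → ⊥
    absurd none = farkas {ρ = ∑ (λ v → b v * b v) ∷ ∑ (λ x → F x * F x) ∷ ∑ b ∷ ∑ F ∷ []}
      ( hyp 1 (con 48 :+ 3 :* v1) v0 (≥-of second-moments) ∷ hyp 3 v3 v1 (∑-mono λ x → square (F x)) ∷ hyp 3 (con 140) v3 (≥-of ∑-F)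
      ∷ hyp 1 v0 (2 :* v2 :+ con 224) upper ∷ hyp 2 v2 (con 108) (≤-of ∑-b) ∷ [])
      where
      square : ∀ m → m ≤ m * m
      square zero = z≤n
      square (suc m) = m≤m+n (suc m) (m * suc m)
      at-0 : ∀ {m k} → m ≡ 16 → k ≡ 1 → m * m ≤ 2 * m + k * 224
      at-0 refl refl = ≤ᵇ⇒≤ 256 256 tt
      decide : ∀ v → Dec (v ≡ 0ᵥ) → b v * b v ≤ 2 * b v + mult [] v * 224
      decide v (yes p) = at-0 (trans (cong b p) b-0) (mult-∈ [] independent-[] ([] , p))
      decide v (no p) = square-≤2 (b v) (mult [] v * 224) (≤-pred (≰⇒> λ r → none v (p , r)))
      upper : ∑ (λ v → b v * b v) ≤ 2 * ∑ b + 224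
      upper = ≤-trans (∑-mono λ v → decide v (v ≟ᵥ 0ᵥ)) (≤-of (trans (∑-+ (λ v → 2 * b v) (λ v → mult [] v * 224))
        (cong₂ _+_ (∑-* 2 b) (trans (∑-mult [] λ _ → 224) (∑-[] λ _ → 224)))))

-- Without values 3 to 5: companions and holes of heavy hyperplanes

module Gap (D : Arc) (gap : ∀ v → ¬ v ≡ 0ᵥ → 3 ≤ Arc.b D v → 6 ≤ Arc.b D v) (b≤8 : ∀ v → ¬ v ≡ 0ᵥ → Arc.b D v ≤ 8) where
  open Arc D
  open Dual D
  open Geometry D
  open Triangles D
  open Outcome D

  ≤2 : ∀ v → ¬ v ≡ 0ᵥ → ¬ Heavy v → b v ≤ 2
  ≤2 v v≢0 light = ≤-pred (≰⇒> λ r → light (v≢0 , r))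

  heavy-6 : ∀ {y} → Heavy y → 6 ≤ b y
  heavy-6 {y} (y≢0 , 3≤b) = gap y y≢0 3≤b

  ∑-2mult : ∀ {k} (us : Vec V₅ k) → ∑ (λ x → 2 * mult us x) ≡ 2 * 3 ^ k
  ∑-2mult us = trans (∑-* 2 (mult us)) (cong (2 *_) (∑-mult-one us))

  δ01 : ∀ t → (δ t * 1 ≡ 0) ⊎ (δ t * 1 ≡ 1)
  δ01 0₃ = inj₂ refl
  δ01 (F.suc _) = inj₁ refl

  -- With j = 0 this is (m - 1)(m - 2) ≥ 0 for k = 1, and m ≤ m² for k = 0. The term in j records
  -- where the product is at least 2, as at the origin.
  square-gap : ∀ {k m j} → (k ≡ 0) ⊎ (k ≡ 1) → j ≡ 0 → m + 2 * (k * m) + 2 * j ≤ m * m + 2 * k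
  square-gap {m = 0} (inj₁ refl) refl = z≤n
  square-gap {m = suc m} (inj₁ refl) refl = ≤-trans (≤-of (trans (+-identityʳ _) (+-identityʳ (suc m)))) (≤-trans (m≤m+n (suc m) (m * suc m)) (≤-of (sym (+-identityʳ _))))
  square-gap {m = 0} (inj₂ refl) refl = z≤n
  square-gap {m = 1} (inj₂ refl) refl = ≤-refl
  square-gap {m = suc (suc m)} (inj₂ refl) refl = ≤-trans (m≤m+n _ (m * m + m)) (≤-of (lemma m))
    where
    lemma : ∀ m → 2 + m + 2 * (2 + m + 0) + 0 + (m * m + m) ≡ (2 + m) * (2 + m) + 2
    lemma = solve-∀

  square-at-0 : ∀ {k m j} → k ≡ 1 → m ≡ 0 → j ≡ 1 → m + 2 * (k * m) + 2 * j ≤ m * m + 2 * k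
  square-at-0 refl refl refl = ≤-refl

  weigh-squares : ∀ (g h : V₅ → ℕ) {f : V₅ → ℕ} → (∀ x → F x + 2 * (g x * F x) + h x ≤ F x * F x + 2 * g x) → (∀ x → g x * F x ≡ f x) →
    ∑ F + 2 * ∑ f + ∑ h ≤ ∑ (λ x → F x * F x) + 2 * ∑ g
  weigh-squares g h {f} p q = begin
    ∑ F + 2 * ∑ f + ∑ h
      ≡⟨ cong (λ m → ∑ F + m + ∑ h) (sym (trans (∑-* 2 (λ x → g x * F x)) (cong (2 *_) (∑-cong q)))) ⟩
    ∑ F + ∑ (λ x → 2 * (g x * F x)) + ∑ h
      ≡⟨ sym (trans (∑-+ (λ x → F x + 2 * (g x * F x)) h) (cong (_+ ∑ h) (∑-+ F (λ x → 2 * (g x * F x))))) ⟩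
    ∑ (λ x → F x + 2 * (g x * F x) + h x)
      ≤⟨ ∑-mono p ⟩
    ∑ (λ x → F x * F x + 2 * g x)
      ≡⟨ trans (∑-+ (λ x → F x * F x) (λ x → 2 * g x)) (cong (∑ (λ x → F x * F x) +_) (∑-* 2 g)) ⟩
    ∑ (λ x → F x * F x) + 2 * ∑ g ∎
    where open ≤-Reasoning

  -- Counting incidences between b and the points off y, weighted by F.
  module Lonely (y : V₅) (hy : Heavy y) (alone : ∀ v → Heavy v → InSpan (y ∷ []) v) where

    ys : Vec V₅ 1
    ys = y ∷ []

    y≢0 : ¬ y ≡ 0ᵥ
    y≢0 = proj₁ hy

    f : V₅ → ℕ
    f x = η (y · x) * F x

    M-f : ∀ v → M f v + M₂ F y v ≡ M F v
    M-f v = trans (sym (M-+ f (on y F) v)) (M-cong (λ x → lemma (y · x) (F x)) v)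
      where
      lemma : ∀ t m → η t * m + δ t * m ≡ m
      lemma 0₃ m = +-identityʳ m
      lemma (F.suc t) m = trans (+-identityʳ (m + 0)) (+-identityʳ m)

    ∑-f : ∑ f + 6 * b y ≡ 96
    ∑-f = linear {ρ = ρ} 1 (v0 :+ 6 :* v1) (con 96)
      ( eqn 1 v0 v2 (sym (M-0ᵥ f)) ∷ eqn 1 (v2 :+ v3) v4 (M-f 0ᵥ)
      ∷ eqn 1 v5 v3 (sym (M-0ᵥ (on y F))) ∷ eqn 1 (con 44 :+ 6 :* v1) v5 (sym (M-F y)) ∷ eqn 1 v4 (con 140) (trans (M-0ᵥ F) ∑-F) ∷ []) refl
      where
      ρ : Vec ℕ 6
      ρ = ∑ f ∷ b y ∷ M f 0ᵥ ∷ M₂ F y 0ᵥ ∷ M F 0ᵥ ∷ M F y ∷ []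

    lower : 54 * ∑ f ≤ ∑ (λ v → b v * M f v)
    lower = ≤-trans (≥-of (∑-* 54 f)) (≤-trans (∑-mono λ x → bound x (x ≟ᵥ 0ᵥ)) (≥-of (M-swap f b)))
      where
      weigh : ∀ h m → 54 * (h * m) ≤ h * m * (36 + 18 * m)
      weigh h zero = ≤-trans (≤-of (cong (54 *_) (*-zeroʳ h))) z≤n
      weigh h (suc m) = ≤-trans (≤-of (*-comm 54 (h * suc m))) (*-monoʳ-≤ (h * suc m) (≤-trans (m≤m+n 54 (18 * m)) (≤-of (lemma m))))
        where
        lemma : ∀ m → 54 + 18 * m ≡ 36 + 18 * suc m
        lemma = solve-∀
      bound : ∀ x → Dec (x ≡ 0ᵥ) → 54 * f x ≤ f x * M b x
      bound x (no p) = ≤-trans (weigh (η (y · x)) (F x)) (≤-of (cong (f x *_) (sym (M-b x p))))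
      bound x (yes p) = ≤-trans (≤-of (cong (54 *_) (trans (cong (η (y · x) *_) (trans (cong F p) F-0)) (*-zeroʳ (η (y · x)))))) z≤n

    light : ∀ v → ¬ InSpan ys v → b v ≤ 2
    light v v∉y = ≤2 v (λ p → v∉y (0ᵥ , trans p (sym (comb-0 ys)))) λ hv → v∉y (alone v hv)

    M-f-≤ : ∀ v → ¬ InSpan ys v → M f v + 2 * b y ≤ 40
    M-f-≤ v v∉y = by-contra λ r → farkas
      {ρ = M f v ∷ b y ∷ b v ∷ M₂ F y v ∷ M F v ∷ b (y ⊕ v) ∷ b (y ⊝ v) ∷ []}
      ( hyp 1 (con 41) (v0 :+ 2 :* v1) r ∷ hyp 1 (v0 :+ v3) v4 (≤-of (M-f v)) ∷ hyp 1 v4 (con 44 :+ 6 :* v2) (≤-of (M-F v))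
      ∷ hyp 1 (con 12 :+ 2 :* (v1 :+ v2 :+ v5 :+ v6)) v3 (≥-of (M₂-F y v)) ∷ hyp 4 v2 (con 2) (light v v∉y) ∷ [])

    M-f-line : ∀ c → ¬ c ≡ 0₃ → M f (scale c y) ≡ 0
    M-f-line c c≢0 = trans (∑-cong λ x → trans (cong (λ t → δ t * f x) (·-scaleˡ c y x)) (lemma c c≢0 (y · x) (F x))) ∑-0
      where
      lemma : ∀ c → ¬ c ≡ 0₃ → ∀ t m → δ (c *₃ t) * (η t * m) ≡ 0
      lemma 0₃ p _ _ = ⊥-elim (p refl)
      lemma 1₃ _ 0₃ m = refl
      lemma 1₃ _ 1₃ m = refl
      lemma 1₃ _ 2₃ m = refl
      lemma 2₃ _ 0₃ m = refl
      lemma 2₃ _ 1₃ m = refl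
      lemma 2₃ _ 2₃ m = refl

    -- Off the line of y each M f v is at most C by `M-f-≤`; at y and its negative it is 0, at the
    -- origin all of `∑ f`. Against `lower` this reads 3240 ≤ 3200 for b(y) = 6 and 2916 ≤ 2892 for
    -- b(y) = 7.
    upper : ∀ C → 40 ≤ C + 2 * b y → ∑ (λ v → b v * M f v) + C * (16 + 2 * b y) ≤ C * 108 + 16 * ∑ f
    upper C 40≤ = begin
      ∑ (λ v → b v * M f v) + C * (16 + 2 * b y)
        ≡⟨ cong (∑ (λ v → b v * M f v) +_) (sym (trans (∑-mult ys (λ v → C * b v)) (trans (∑-* C (λ cs → b (comb cs ys)))
             (cong (C *_) (trans (∑-pair b y b-⊖) (cong (_+ 2 * b y) b-0)))))) ⟩
      ∑ (λ v → b v * M f v) + ∑ (λ v → mult ys v * (C * b v))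
        ≡⟨ sym (∑-+ (λ v → b v * M f v) (λ v → mult ys v * (C * b v))) ⟩
      ∑ (λ v → b v * M f v + mult ys v * (C * b v))
        ≤⟨ ∑-mono (λ v → decide v (InSpan? ys v)) ⟩
      ∑ (λ v → C * b v + mult [] v * (16 * ∑ f))
        ≡⟨ ∑-+ (λ v → C * b v) (λ v → mult [] v * (16 * ∑ f)) ⟩
      ∑ (λ v → C * b v) + ∑ (λ v → mult [] v * (16 * ∑ f))
        ≡⟨ cong₂ _+_ (trans (∑-* C b) (cong (C *_) ∑-b)) (trans (∑-mult [] λ _ → 16 * ∑ f) (∑-[] λ _ → 16 * ∑ f)) ⟩
      C * 108 + 16 * ∑ f ∎
      where
      open ≤-Reasoning
      outside : ∀ {m n k l} → k ≡ 0 → n ≤ C → m * n + k * (C * m) ≤ C * m + l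
      outside {m} {n} {l = l} refl p = ≤-trans (≤-of (+-identityʳ (m * n))) (≤-trans (*-monoʳ-≤ m p) (≤-trans (≤-of (*-comm m C)) (m≤m+n (C * m) l)))
      line : ∀ {m n k l} → n ≡ 0 → k ≡ 1 → m * n + k * (C * m) ≤ C * m + l
      line {m} {l = l} refl refl = ≤-trans (≤-of (trans (cong (_+ 1 * (C * m)) (*-zeroʳ m)) (+-identityʳ (C * m)))) (m≤m+n (C * m) l)
      origin : ∀ {m n k l} → m ≡ 16 → n ≡ ∑ f → k ≡ 1 → l ≡ 1 → m * n + k * (C * m) ≤ C * m + l * (16 * ∑ f)
      origin refl refl refl refl = ≤-of (lemma (16 * ∑ f) (C * 16))
        where
        lemma : ∀ a c → a + (c + 0) ≡ c + (a + 0)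
        lemma = solve-∀
      decide : ∀ v → Dec (InSpan ys v) → b v * M f v + mult ys v * (C * b v) ≤ C * b v + mult [] v * (16 * ∑ f)
      decide v (no i) = outside {b v} (mult-∉ ys i) (+-cancelʳ-≤ (2 * b y) (M f v) C (≤-trans (M-f-≤ v i) 40≤))
      decide v (yes i@(a ∷ [] , p)) = at a p
        where
        at : ∀ a → v ≡ comb (a ∷ []) ys → b v * M f v + mult ys v * (C * b v) ≤ C * b v + mult [] v * (16 * ∑ f)
        at 0₃ p = origin (trans (cong b v≡0) b-0) (trans (cong (M f) v≡0) (M-0ᵥ f)) (mult-∈ ys (independent₁ y≢0) i) (mult-∈ [] independent-[] ([] , v≡0))
          where
          v≡0 : v ≡ 0ᵥ
          v≡0 = trans p (trans (comb₁ 0₃ y) (scale-0 y))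
        at 1₃ p = line {b v} (trans (cong (M f) (trans p (comb₁ 1₃ y))) (M-f-line 1₃ λ ())) (mult-∈ ys (independent₁ y≢0) i)
        at 2₃ p = line {b v} (trans (cong (M f) (trans p (comb₁ 2₃ y))) (M-f-line 2₃ λ ())) (mult-∈ ys (independent₁ y≢0) i)

    b-y≢6 : ¬ b y ≡ 6
    b-y≢6 e = farkas {ρ = ∑ f ∷ b y ∷ ∑ (λ v → b v * M f v) ∷ []}
      ( hyp 1 (54 :* v0) v2 lower ∷ hyp 1 (v2 :+ 28 :* (con 16 :+ 2 :* v1)) (con 3024 :+ 16 :* v0) (upper 28 (≥-of (cong (λ m → 28 + 2 * m) e)))
      ∷ hyp 38 (con 96) (v0 :+ 6 :* v1) (≥-of ∑-f) ∷ hyp 172 v1 (con 6) (≤-of e) ∷ [])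

    b-y≢7 : ¬ b y ≡ 7
    b-y≢7 e = farkas {ρ = ∑ f ∷ b y ∷ ∑ (λ v → b v * M f v) ∷ []}
      ( hyp 1 (54 :* v0) v2 lower ∷ hyp 1 (v2 :+ 26 :* (con 16 :+ 2 :* v1)) (con 2808 :+ 16 :* v0) (upper 26 (≥-of (cong (λ m → 26 + 2 * m) e)))
      ∷ hyp 38 (con 96) (v0 :+ 6 :* v1) (≥-of ∑-f) ∷ hyp 176 v1 (con 7) (≤-of e) ∷ [])

    -- Here the incidence count balances exactly, at 2592, so second moments are compared instead.
    -- From (F - 1)(F - 2) ≥ 0 on y and F ≤ F² off y the sum of F² is at least 164, that of b² at
    -- least 540; but b ≤ 2 off the line of y allows only 536.
    b-y≢8 : ¬ b y ≡ 8
    b-y≢8 e = farkas {ρ = ∑ (λ v → b v * b v) ∷ ∑ (λ x → F x * F x) ∷ M one y ∷ M F y ∷ ∑ F ∷ b y ∷ ∑ b ∷ []}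
      ( hyp 1 (con 48 :+ 3 :* v1) v0 (≥-of second-moments) ∷ hyp 3 (v4 :+ 2 :* v3 :+ con 2) (v1 :+ 2 :* v2) F-squares
      ∷ hyp 3 (con 140) v4 (≥-of ∑-F) ∷ hyp 6 v2 (con 81) (≤-of (M-one y y≢0)) ∷ hyp 6 (con 44 :+ 6 :* v5) v3 (≥-of (M-F y))
      ∷ hyp 36 (con 8) v5 (≥-of e) ∷ hyp 1 v0 (2 :* v6 :+ con 144 :+ con 176) b-squares ∷ hyp 2 v6 (con 108) (≤-of ∑-b) ∷ [])
      where
      F-squares : ∑ F + 2 * M F y + 2 ≤ ∑ (λ x → F x * F x) + 2 * M one y
      F-squares = ≤-trans (+-monoʳ-≤ (∑ F + 2 * M F y) (≥-of (∑-2mult [])))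
        (≤-trans (weigh-squares (on y one) (λ x → 2 * mult [] x) (λ x → decide x (x ≟ᵥ 0ᵥ)) (λ x → unit (δ (y · x)) (F x))) ≤-refl)
        where
        unit : ∀ d m → d * 1 * m ≡ d * m
        unit d m = cong (_* m) (*-identityʳ d)
        decide : ∀ x → Dec (x ≡ 0ᵥ) → F x + 2 * (on y one x * F x) + 2 * mult [] x ≤ F x * F x + 2 * on y one x
        decide x (yes p) = square-at-0 (trans (cong (λ t → δ t * 1) (trans (cong (y ·_) p) (·-0ʳ y))) refl) (trans (cong F p) F-0) (mult-∈ [] independent-[] ([] , p))
        decide x (no p) = square-gap {m = F x} (δ01 (y · x)) (mult-∉ [] (∉-[] p))
      b-squares : ∑ (λ v → b v * b v) ≤ 2 * ∑ b + 144 + 176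
      b-squares = ≤-trans (∑-mono λ v → decide v (InSpan? ys v)) (≤-of (trans (∑-+ (λ v → 2 * b v + mult ys v * 48) (λ v → mult [] v * 176))
          (cong₂ _+_ (trans (∑-+ (λ v → 2 * b v) (λ v → mult ys v * 48)) (cong₂ _+_ (∑-* 2 b) (trans (∑-mult ys λ _ → 48) (∑-const 1 48))))
            (trans (∑-mult [] λ _ → 176) (∑-[] λ _ → 176)))))
        where
        line : ∀ {m n} k → m ≡ 8 → n ≡ 1 → m * m ≤ 2 * m + n * 48 + k
        line k refl refl = m≤m+n 64 k
        origin : ∀ {m n k} → m ≡ 16 → n ≡ 1 → k ≡ 1 → m * m ≤ 2 * m + n * 48 + k * 176
        origin refl refl refl = ≤ᵇ⇒≤ 256 256 tt
        decide : ∀ v → Dec (InSpan ys v) → b v * b v ≤ 2 * b v + mult ys v * 48 + mult [] v * 176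
        decide v (no i) = ≤-trans (square-≤2 (b v) (mult ys v * 48 + mult [] v * 176) (light v i)) (≤-of (sym (+-assoc (2 * b v) (mult ys v * 48) (mult [] v * 176))))
        decide v (yes i@(a ∷ [] , p)) = at a p
          where
          at : ∀ a → v ≡ comb (a ∷ []) ys → b v * b v ≤ 2 * b v + mult ys v * 48 + mult [] v * 176
          at 0₃ p = origin (trans (cong b v≡0) b-0) (mult-∈ ys (independent₁ y≢0) i) (mult-∈ [] independent-[] ([] , v≡0))
            where
            v≡0 : v ≡ 0ᵥ
            v≡0 = trans p (trans (comb₁ 0₃ y) (scale-0 y))
          at 1₃ p = line (mult [] v * 176) (trans (cong b (trans p (trans (comb₁ 1₃ y) (scale-1 y)))) e) (mult-∈ ys (independent₁ y≢0) i)
          at 2₃ p = line (mult [] v * 176) (trans (cong b (trans p (comb₁ 2₃ y))) (trans (b-⊖ y) e)) (mult-∈ ys (independent₁ y≢0) i)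

    contradiction : ⊥
    contradiction = cases (b y) refl (heavy-6 hy) (b≤8 y y≢0)
      where
      cases : ∀ m → b y ≡ m → 6 ≤ m → m ≤ 8 → ⊥
      cases 6 e _ _ = b-y≢6 e
      cases 7 e _ _ = b-y≢7 e
      cases 8 e _ _ = b-y≢8 e
      cases (suc (suc (suc (suc (suc (suc (suc (suc (suc m))))))))) e _ (s≤s (s≤s (s≤s (s≤s (s≤s (s≤s (s≤s (s≤s ()))))))))
      cases 0 _ () _
      cases 1 _ (s≤s ()) _
      cases 2 _ (s≤s (s≤s ())) _
      cases 3 _ (s≤s (s≤s (s≤s ()))) _
      cases 4 _ (s≤s (s≤s (s≤s (s≤s ())))) _
      cases 5 _ (s≤s (s≤s (s≤s (s≤s (s≤s ()))))) _

  companion : ∀ y → Heavy y → ∃ λ y′ → Heavy y′ × ¬ InSpan (y ∷ []) y′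
  companion y hy = [ id , (λ none → ⊥-elim (Lonely.contradiction y hy λ v hv → decide v hv none (InSpan? (y ∷ []) v))) ]′
    (search λ v → (¬? (v ≟ᵥ 0ᵥ) ×-dec (3 ≤? b v)) ×-dec ¬? (InSpan? (y ∷ []) v))
    where
    decide : ∀ v → Heavy v → (∀ v → ¬ (Heavy v × ¬ InSpan (y ∷ []) v)) → Dec (InSpan (y ∷ []) v) → InSpan (y ∷ []) v
    decide v hv none (yes i) = i
    decide v hv none (no i) = ⊥-elim (none v (hv , i))

  -- If y had no hole, `full-bound` against a companion would give 11 + 6 ≤ 2 * 8.
  heavy-hole : ∀ y → Heavy y → ∃ (Hole y)
  heavy-hole y hy = [ id , (λ none → ⊥-elim (absurd none (companion y hy))) ]′ (search (Hole? y))
    where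
    absurd : (∀ x → ¬ Hole y x) → (∃ λ y′ → Heavy y′ × ¬ InSpan (y ∷ []) y′) → ⊥
    absurd none (y′ , h′ , out) = farkas {ρ = b y ∷ b y′ ∷ b (y ⊕ y′) ∷ b (y ⊝ y′) ∷ []}
      ( hyp 1 (con 11 :+ (v1 :+ v2 :+ v3)) (2 :* v0) (full-bound {y′} {y} (λ x y⊥x y′∤x → full-≥ y none x (λ p → y′∤x (trans (cong (y′ ·_) p) (·-0ʳ y′))) y⊥x)
          (independent-∷ (independent₁ (proj₁ h′)) λ i → out (span₁-sym (proj₁ hy) i)))
      ∷ hyp 2 v0 (con 8) (b≤8 y (proj₁ hy)) ∷ hyp 1 (con 6) v1 (heavy-6 h′) ∷ [])

  heavy-special : ∀ y → Heavy y → ∃ λ x → Σ (Special x) λ s → Special.y s ≡ y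
  heavy-special y hy = at (heavy-hole y hy)
    where
    at : ∃ (Hole y) → ∃ λ x → Σ (Special x) λ s → Special.y s ≡ y
    at (x , hole) = x , special hy hole , refl

  heavy-7 : ∀ {y} → Heavy y → b y ≤ 7
  heavy-7 {y} hy = at (heavy-special y hy)
    where
    at : (∃ λ x → Σ (Special x) λ s → Special.y s ≡ y) → b y ≤ 7
    at (x , s , e) = subst (λ t → b t ≤ 7) e (b-y≤7 s)

independent₃-by : ∀ {us : Vec V₅ 3} → Independent us → (e f g : Vexp 3) →
  (∀ a b c → coef (a ⟨*⟩ e ⟨+⟩ (b ⟨*⟩ f ⟨+⟩ c ⟨*⟩ g)) ≡ 0ᵥ → a ≡ 0₃ × b ≡ 0₃ × c ≡ 0₃) →
  Independent (evalᵥ us e ∷ evalᵥ us f ∷ evalᵥ us g ∷ [])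
independent₃-by {us} ind e f g inj (a ∷ b ∷ c ∷ []) p = all-zero (inj a b c (ind (coef h) (trans (sym (coef-correct us h)) (trans (sym unfold) p))))
  where
  h : Vexp 3
  h = a ⟨*⟩ e ⟨+⟩ (b ⟨*⟩ f ⟨+⟩ c ⟨*⟩ g)
  unfold : comb (a ∷ b ∷ c ∷ []) (evalᵥ us e ∷ evalᵥ us f ∷ evalᵥ us g ∷ []) ≡ evalᵥ us h
  unfold = cong (λ t → scale a (evalᵥ us e) ⊕ (scale b (evalᵥ us f) ⊕ t)) (⊕-idʳ (scale c (evalᵥ us g)))
  all-zero : a ≡ 0₃ × b ≡ 0₃ × c ≡ 0₃ → a ∷ b ∷ c ∷ [] ≡ 0ᵥ
  all-zero (refl , refl , refl) = refl

Injective₃ : (e f g : Vexp 3) → Set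
Injective₃ e f g = ∀ a b c → coef (a ⟨*⟩ e ⟨+⟩ (b ⟨*⟩ f ⟨+⟩ c ⟨*⟩ g)) ≡ 0ᵥ → a ≡ 0₃ × b ≡ 0₃ × c ≡ 0₃

injective₃? : (e f g : Vexp 3) → Dec (Injective₃ e f g)
injective₃? e f g = all? λ a → all? λ b → all? λ c →
  (coef (a ⟨*⟩ e ⟨+⟩ (b ⟨*⟩ f ⟨+⟩ c ⟨*⟩ g)) ≟ᵥ 0ᵥ) →-dec ((a F.≟ 0₃) ×-dec (b F.≟ 0₃) ×-dec (c F.≟ 0₃))

≡1-of : ∀ {m} → m ≤ 1 → ρ₃ m ≡ 1₃ → m ≡ 1
≡1-of {zero} _ ()
≡1-of {suc zero} _ _ = refl
≡1-of {suc (suc m)} (s≤s ()) _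

ρ₃-pos : ∀ {m} → ρ₃ m ≡ 1₃ → 1 ≤ m
ρ₃-pos {zero} ()
ρ₃-pos {suc m} _ = s≤s z≤n

-- No hyperplane of residue one contains all special points

module GapStar (D : Arc) (gap : ∀ v → ¬ v ≡ 0ᵥ → 3 ≤ Arc.b D v → 6 ≤ Arc.b D v) (b≤8 : ∀ v → ¬ v ≡ 0ᵥ → Arc.b D v ≤ 8) where
  open Arc D
  open Dual D
  open Geometry D
  open Triangles D
  open Outcome D
  open Gap D gap b≤8

  6∨7 : ∀ {w} → Heavy w → (b w ≡ 6) ⊎ (b w ≡ 7)
  6∨7 {w} hw = at (b w) refl (heavy-6 hw) (heavy-7 hw)
    where
    at : ∀ m → b w ≡ m → 6 ≤ m → m ≤ 7 → (b w ≡ 6) ⊎ (b w ≡ 7)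
    at m e p q with m≤n⇒m<n∨m≡n p
    ... | inj₂ refl = inj₁ e
    ... | inj₁ r = inj₂ (trans e (≤-antisym q r))

  module WithStar (z : V₅) (z≢0 : ¬ z ≡ 0ᵥ) (res-z : Res₁ D z) (star : Star z) where

    record Beside (w : V₅) : Set where
      field
        b-z : b z ≡ 1
        b-w⊕z : b (w ⊕ z) + 6 ≡ b w
        b-w⊝z : b (w ⊝ z) + 6 ≡ b w

    -- For b(w) = 6 the star bound leaves nothing to w + z and w - z. For b(w) = 7 it leaves 2, and
    -- both lie in the section at a hole of w, so each is at least 1. In either case the bound is
    -- attained.
    beside : ∀ {w} → Heavy w → ¬ InSpan (z ∷ []) w → Beside w
    beside {w} hw w∉z = at (heavy-special w hw)
      where
      bound : 11 + (b z + b (w ⊕ z) + b (w ⊝ z)) ≤ 2 * b w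
      bound = star-bound star hw (independent-∷ (independent₁ z≢0) w∉z)
      at : (∃ λ x → Σ (Special x) λ s → Special.y s ≡ w) → Beside w
      at (x , s , refl) = by (6∨7 hw)
        where
        z∈ : InSection s z
        z∈ = star x s , res-z
        b-z : b z ≡ 1
        b-z = ≡1-of (others≤1 s gap z z≢0 (star x s) (w∉z ∘ span₁-sym z≢0)) res-z
        by : (b w ≡ 6) ⊎ (b w ≡ 7) → Beside w
        by (inj₁ e) = record { b-z = b-z ; b-w⊕z = trans (cong (_+ 6) p) (sym e) ; b-w⊝z = trans (cong (_+ 6) m) (sym e) }
          where
          ρ : Vec ℕ 4
          ρ = b w ∷ b z ∷ b (w ⊕ z) ∷ b (w ⊝ z) ∷ []
          p : b (w ⊕ z) ≡ 0
          p = n≤0⇒n≡0 (by-contra λ r → farkas {ρ = ρ} (hyp 1 (con 11 :+ (v1 :+ v2 :+ v3)) (2 :* v0) bound ∷ hyp 2 v0 (con 6) (≤-of e)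
            ∷ hyp 1 (con 1) v1 (≥-of b-z) ∷ hyp 1 (con 1) v2 r ∷ []))
          m : b (w ⊝ z) ≡ 0
          m = n≤0⇒n≡0 (by-contra λ r → farkas {ρ = ρ} (hyp 1 (con 11 :+ (v1 :+ v2 :+ v3)) (2 :* v0) bound ∷ hyp 2 v0 (con 6) (≤-of e)
            ∷ hyp 1 (con 1) v1 (≥-of b-z) ∷ hyp 1 (con 1) v3 r ∷ []))
        by (inj₂ e) = record { b-z = b-z ; b-w⊕z = trans (cong (_+ 6) p) (sym e) ; b-w⊝z = trans (cong (_+ 6) m) (sym e) }
          where
          ρ : Vec ℕ 4
          ρ = b w ∷ b z ∷ b (w ⊕ z) ∷ b (w ⊝ z) ∷ []
          w∈ : InSection s w
          w∈ = Special.y⊥x s , cong ρ₃ e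
          p≥ : 1 ≤ b (w ⊕ z)
          p≥ = ρ₃-pos (proj₂ (section-⊕ s w∈ z∈))
          m≥ : 1 ≤ b (w ⊝ z)
          m≥ = ρ₃-pos (proj₂ (section-⊕ s w∈ (section-scale s 2₃ z∈)))
          p : b (w ⊕ z) ≡ 1
          p = ≤-antisym (by-contra λ r → farkas {ρ = ρ} (hyp 1 (con 11 :+ (v1 :+ v2 :+ v3)) (2 :* v0) bound ∷ hyp 2 v0 (con 7) (≤-of e)
            ∷ hyp 1 (con 1) v1 (≥-of b-z) ∷ hyp 1 (con 2) v2 r ∷ hyp 1 (con 1) v3 m≥ ∷ [])) p≥
          m : b (w ⊝ z) ≡ 1
          m = ≤-antisym (by-contra λ r → farkas {ρ = ρ} (hyp 1 (con 11 :+ (v1 :+ v2 :+ v3)) (2 :* v0) bound ∷ hyp 2 v0 (con 7) (≤-of e)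
            ∷ hyp 1 (con 1) v1 (≥-of b-z) ∷ hyp 1 (con 2) v3 r ∷ hyp 1 (con 1) v2 p≥ ∷ [])) m≥

    -- Equality holds in full-bound: F = 1 on the points of w off z, so the mass of the plane w, u depends only on its trace on z.
    module _ {w : V₅} (hw : Heavy w) (w∉z : ¬ InSpan (z ∷ []) w) where
      private
        g₁ g₂ : V₅ → ℕ
        g₁ x = on z F x + 1
        g₂ x = F x + on z one x

        ind-wz : Independent (w ∷ z ∷ [])
        ind-wz = independent-∷ (independent₁ z≢0) w∉z

        g≡ : ∀ x → on w g₁ x ≡ on w g₂ x
        g≡ = ∑-squeeze (λ x → bound x (w · x) (z · x) refl refl) (≤-trans (≤-of (M-+ F (on z one) w)) (≤-trans total≤ (≥-of (M-+ (on z F) one w))))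
          where
          open Beside (beside hw w∉z)
          total≤ : M F w + M₂ one z w ≤ M₂ F z w + M one w
          total≤ = by-contra λ r → farkas {ρ = M F w ∷ M₂ one z w ∷ M₂ F z w ∷ M one w ∷ b w ∷ b z ∷ b (w ⊕ z) ∷ b (w ⊝ z) ∷ []}
            ( hyp 1 (con 1 :+ (v2 :+ v3)) (v0 :+ v1) r ∷ hyp 1 v0 (con 44 :+ 6 :* v4) (≤-of (M-F w))
            ∷ hyp 1 v1 (con 27) (≤-of (trans (M₂-comm one z w) (M₂-one ind-wz)))
            ∷ hyp 1 (con 12 :+ 2 :* (v4 :+ v5 :+ v6 :+ v7)) v2 (≥-of (trans (M₂-comm F z w) (M₂-F w z)))
            ∷ hyp 1 (con 81) v3 (M-one-≥ w) ∷ hyp 2 (con 1) v5 (≥-of b-z) ∷ hyp 2 v4 (v6 :+ con 6) (≥-of b-w⊕z) ∷ hyp 2 v4 (v7 :+ con 6) (≥-of b-w⊝z) ∷ [])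
          bound : ∀ x s t → w · x ≡ s → z · x ≡ t → on w g₁ x ≤ on w g₂ x
          bound x (F.suc s) t p _ = ≤-of (trans (cong (λ t → δ t * g₁ x) p) (sym (cong (λ t → δ t * g₂ x) p)))
          bound x 0₃ 0₃ _ q = *-monoʳ-≤ (δ (w · x)) (≤-of (cong₂ _+_ (trans (cong (λ t → δ t * F x) q) (+-identityʳ (F x))) (sym (cong (λ t → δ t * 1) q))))
          bound x 0₃ (F.suc t) p q = *-monoʳ-≤ (δ (w · x)) (≤-trans (≤-of (cong (λ t → δ t * F x + 1) q))
            (≤-trans (star-full {z} star hw x p λ r → case trans (sym r) q of λ ()) (m≤m+n (F x) _)))

        trace : ∀ u → M₃ F z w u + M₂ one w u ≡ M₂ F w u + M₃ one z w u
        trace u = begin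
          M₃ F z w u + M₂ one w u                      ≡⟨ sym (M-+ (on w (on z F)) (on w one) u) ⟩
          M (λ x → on w (on z F) x + on w one x) u     ≡⟨ M-cong (λ x → sym (*-distribˡ-+ (δ (w · x)) (on z F x) 1)) u ⟩
          M (on w g₁) u                                ≡⟨ M-cong g≡ u ⟩
          M (on w g₂) u                                ≡⟨ M-cong (λ x → *-distribˡ-+ (δ (w · x)) (F x) (on z one x)) u ⟩
          M (λ x → on w F x + on w (on z one) x) u     ≡⟨ M-+ (on w F) (on w (on z one)) u ⟩
          M₂ F w u + M₃ one z w u                      ∎
          where open ≡-Reasoning

        M₃-translate : ∀ f u → M₃ f z w (u ⊕ z) ≡ M₃ f z w u
        M₃-translate f u = ∑-cong λ x → trans (cong (λ t → δ t * on w (on z f) x) (·-⊕ˡ u z x)) (lemma (u · x) (z · x) (δ (w · x)) (f x))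
          where
          lemma : ∀ s t m k → δ (s +₃ t) * (m * (δ t * k)) ≡ δ s * (m * (δ t * k))
          lemma s 0₃ m k = cong (λ t → δ t * (m * (k + 0))) (+₃-idʳ s)
          lemma s (F.suc t) m k = trans (cong (δ (s +₃ F.suc t) *_) (*-zeroʳ m)) (trans (*-zeroʳ (δ (s +₃ F.suc t)))
            (sym (trans (cong (δ s *_) (*-zeroʳ m)) (*-zeroʳ (δ s)))))

      -- The forms u and u + z agree on z, so the planes w ∩ u and w ∩ (u + z) have the same trace
      -- there; off z the multiplicities on w are all 1.
      pencil-translate : ∀ u → Independent (w ∷ u ∷ []) → Independent (w ∷ (u ⊕ z) ∷ []) →
        b u + b (w ⊕ u) + b (w ⊝ u) ≡ b (u ⊕ z) + b (w ⊕ (u ⊕ z)) + b (w ⊝ (u ⊕ z))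
      pencil-translate u ind ind′ = *-cancelˡ-≡ _ _ 2 (+-cancelˡ-≡ (12 + 2 * b w) _ _ (trans (sym (expand u)) (trans same (expand (u ⊕ z)))))
        where
        expand : ∀ u → M₂ F w u ≡ 12 + 2 * b w + 2 * (b u + b (w ⊕ u) + b (w ⊝ u))
        expand u = trans (M₂-F w u) (lemma (b w) (b u) (b (w ⊕ u)) (b (w ⊝ u)))
          where
          lemma : ∀ a c d e → 12 + 2 * (a + c + d + e) ≡ 12 + 2 * a + 2 * (c + d + e)
          lemma = solve-∀
        same : M₂ F w u ≡ M₂ F w (u ⊕ z)
        same = +-cancelʳ-≡ (M₃ one z w u) _ _ (trans (sym (trace u)) (trans
          (cong₂ _+_ (sym (M₃-translate F u)) (trans (M₂-one ind) (sym (M₂-one ind′)))) (trans (trace (u ⊕ z)) (cong (M₂ F w (u ⊕ z) +_) (M₃-translate one u)))))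

    module Pair (y y′ : V₅) (hy : Heavy y) (hy′ : Heavy y′) (y′∉y : ¬ InSpan (y ∷ []) y′) where

      y∉y′ : ¬ InSpan (y′ ∷ []) y
      y∉y′ = y′∉y ∘ span₁-sym (proj₁ hy)

      ∉z : ∀ {u w} → Heavy u → Heavy w → ¬ InSpan (w ∷ []) u → ¬ InSpan (z ∷ []) w
      ∉z {u} {w} hu hw u∉w w∈z@(c ∷ [] , p) = farkas {ρ = b u ∷ b z ∷ b (u ⊕ z) ∷ b (u ⊝ z) ∷ []}
        ( hyp 1 (con 11 :+ (v1 :+ v2 :+ v3)) (2 :* v0) (star-bound star hu (independent-∷ (independent₁ z≢0) λ u∈z → u∉w (span₁-trans (proj₁ hw) w∈z u∈z)))
        ∷ hyp 2 v0 (con 7) (heavy-7 hu) ∷ hyp 1 (con 6) v1 (≤-trans (heavy-6 hw) (≤-of (trans (cong b (trans p (comb₁ c z))) (at c p)))) ∷ [])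
        where
        at : ∀ c → w ≡ comb (c ∷ []) (z ∷ []) → b (scale c z) ≡ b z
        at 0₃ p = ⊥-elim (proj₁ hw (trans p (trans (comb₁ 0₃ z) (scale-0 z))))
        at 1₃ _ = cong b (scale-1 z)
        at 2₃ _ = b-⊖ z

      y∉z : ¬ InSpan (z ∷ []) y
      y∉z = ∉z hy′ hy y′∉y
      y′∉z : ¬ InSpan (z ∷ []) y′
      y′∉z = ∉z hy hy′ y∉y′

      near≤1 : ∀ {w} → Heavy w → ¬ InSpan (z ∷ []) w → b (w ⊕ z) ≤ 1 × b (w ⊝ z) ≤ 1
      near≤1 {w} hw w∉z = at (b-w⊕z) , at b-w⊝z
        where
        open Beside (beside hw w∉z)
        at : ∀ {m} → m + 6 ≡ b w → m ≤ 1
        at {m} e = +-cancelʳ-≤ 6 m 1 (≤-trans (≤-of e) (heavy-7 hw))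

      y′∉yz : ¬ InSpan (y ∷ z ∷ []) y′
      y′∉yz (c ∷ d ∷ [] , p) = at c d p
        where
        yz : Vec V₅ 2
        yz = y ∷ z ∷ []
        small : ∀ {m} → b y′ ≡ m → m ≤ 1 → ⊥
        small refl q = 1+n≰n (≤-trans (≤-trans (s≤s (s≤s z≤n)) (heavy-6 hy′)) q)
        at : ∀ c d → y′ ≡ comb (c ∷ d ∷ []) yz → ⊥
        at 0₃ d p = y′∉z (d ∷ [] , trans p (trans (cong (_⊕ comb (d ∷ []) (z ∷ [])) (scale-0 y)) (⊕-idˡ _)))
        at c 0₃ p = y′∉y (c ∷ [] , trans p (cong (scale c y ⊕_) (trans (cong (_⊕ 0ᵥ) (scale-0 z)) (⊕-idˡ 0ᵥ))))
        at 1₃ 1₃ p = small (cong b (trans p (sym (coef-correct yz (a0 ⟨+⟩ a1))))) (proj₁ (near≤1 hy y∉z))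
        at 1₃ 2₃ p = small (cong b (trans p (sym (coef-correct yz (a0 ⟨-⟩ a1))))) (proj₂ (near≤1 hy y∉z))
        at 2₃ 1₃ p = small (trans (cong b (trans p (sym (coef-correct yz (2₃ ⟨*⟩ (a0 ⟨-⟩ a1)))))) (b-⊖ (y ⊝ z))) (proj₂ (near≤1 hy y∉z))
        at 2₃ 2₃ p = small (trans (cong b (trans p (sym (coef-correct yz (2₃ ⟨*⟩ (a0 ⟨+⟩ a1)))))) (b-⊖ (y ⊕ z))) (proj₁ (near≤1 hy y∉z))

      vs : Vec V₅ 3
      vs = y′ ∷ y ∷ z ∷ []

      ind : Independent vs
      ind = independent-∷ (independent-∷ (independent₁ z≢0) y∉z) y′∉yz

      -- Up to sign, these are the values of b at all combinations of y, y′ and z with three nonzero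
      -- coefficients.
      n₁ n₂ n₃ n₄ : ℕ
      n₁ = b (y ⊕ (y′ ⊕ z))
      n₂ = b (y ⊝ (y′ ⊕ z))
      n₃ = b (y ⊕ (y′ ⊝ z))
      n₄ = b (y ⊝ (y′ ⊝ z))

      pair : ∀ e f → ¬ coef e ≡ 0ᵥ → ¬ coef f ≡ 0ᵥ → ¬ coef (e ⟨+⟩ f) ≡ 0ᵥ → ¬ coef (e ⟨-⟩ f) ≡ 0ᵥ → Independent (evalᵥ vs e ∷ evalᵥ vs f ∷ [])
      pair = independent-pair ind

      five : ∀ {u k l m n p} → Heavy u → p ≤ 1 → b u + k + l ≡ p + m + n → 5 ≤ m + n
      five {u} {k} {l} {m} {n} {p} hu p≤1 e = by-contra λ r → farkas {ρ = b u ∷ k ∷ l ∷ m ∷ n ∷ p ∷ []}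
        ( hyp 1 (con 1 :+ (v3 :+ v4)) (con 5) r ∷ hyp 1 (v0 :+ v1 :+ v2) (v5 :+ v3 :+ v4) (≤-of e) ∷ hyp 1 v5 (con 1) p≤1 ∷ hyp 1 (con 6) v0 (heavy-6 hu) ∷ [])

      -- Translating the pencil of y and y′ by z replaces b(y′) ≥ 6 by b(y′ + z) ≤ 1; the other two
      -- values must make up the difference. The three analogues exchange the roles of y and y′ or
      -- the sign of z.
      n₁+n₂ : 5 ≤ n₁ + n₂
      n₁+n₂ = five hy′ (proj₁ (near≤1 hy′ y′∉z)) (pencil-translate hy y∉z y′ (pair a1 a0 (λ ()) (λ ()) (λ ()) (λ ())) (pair a1 (a0 ⟨+⟩ a2) (λ ()) (λ ()) (λ ()) (λ ())))

      back : ∀ u → u ⊝ z ⊕ z ≡ u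
      back u = by-coef (u ∷ z ∷ []) (a0 ⟨-⟩ a1 ⟨+⟩ a1) a0 refl

      n₃+n₄ : 5 ≤ n₃ + n₄
      n₃+n₄ = five hy′ (proj₂ (near≤1 hy′ y′∉z)) (sym (trans (pencil-translate hy y∉z (y′ ⊝ z)
          (pair a1 (a0 ⟨-⟩ a2) (λ ()) (λ ()) (λ ()) (λ ())) (pair a1 (a0 ⟨-⟩ a2 ⟨+⟩ a2) (λ ()) (λ ()) (λ ()) (λ ()))) (cong (λ t → b t + b (y ⊕ t) + b (y ⊝ t)) (back y′))))

      n₁+n₄ : 5 ≤ n₁ + n₄
      n₁+n₄ = five hy (proj₁ (near≤1 hy y∉z)) (trans (pencil-translate hy′ y′∉z y (pair a0 a1 (λ ()) (λ ()) (λ ()) (λ ())) (pair a0 (a1 ⟨+⟩ a2) (λ ()) (λ ()) (λ ()) (λ ())))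
        (cong₂ (λ m n → b (y ⊕ z) + m + n) (cong b (by-coef vs (a0 ⟨+⟩ (a1 ⟨+⟩ a2)) (a1 ⟨+⟩ (a0 ⟨+⟩ a2)) refl))
          (trans (cong b (by-coef vs (a0 ⟨-⟩ (a1 ⟨+⟩ a2)) (2₃ ⟨*⟩ (a1 ⟨-⟩ (a0 ⟨-⟩ a2))) refl)) (b-⊖ (y ⊝ (y′ ⊝ z))))))

      n₃+n₂ : 5 ≤ n₃ + n₂
      n₃+n₂ = five hy (proj₂ (near≤1 hy y∉z)) (trans (sym (trans (pencil-translate hy′ y′∉z (y ⊝ z)
          (pair a0 (a1 ⟨-⟩ a2) (λ ()) (λ ()) (λ ()) (λ ())) (pair a0 (a1 ⟨-⟩ a2 ⟨+⟩ a2) (λ ()) (λ ()) (λ ()) (λ ()))) (cong (λ t → b t + b (y′ ⊕ t) + b (y′ ⊝ t)) (back y))))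
        (cong₂ (λ m n → b (y ⊝ z) + m + n) (cong b (by-coef vs (a0 ⟨+⟩ (a1 ⟨-⟩ a2)) (a1 ⟨+⟩ (a0 ⟨-⟩ a2)) refl))
          (trans (cong b (by-coef vs (a0 ⟨-⟩ (a1 ⟨-⟩ a2)) (2₃ ⟨*⟩ (a1 ⟨-⟩ (a0 ⟨+⟩ a2))) refl)) (b-⊖ (y ⊝ (y′ ⊕ z))))))

      alternative : ∀ w → Heavy w → Independent (w ∷ z ∷ []) → b (w ⊕ z) ≤ 2 × b (w ⊝ z) ≤ 2
      alternative w hw i = (by-contra λ r → farkas {ρ = ρ} (hyp 1 (con 11 :+ (v1 :+ v2 :+ v3)) (2 :* v0) (star-bound star hw i)
          ∷ hyp 2 v0 (con 7) (heavy-7 hw) ∷ hyp 1 (con 1) v1 (ρ₃-pos res-z) ∷ hyp 1 (con 3) v2 r ∷ [])) ,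
        (by-contra λ r → farkas {ρ = ρ} (hyp 1 (con 11 :+ (v1 :+ v2 :+ v3)) (2 :* v0) (star-bound star hw i)
          ∷ hyp 2 v0 (con 7) (heavy-7 hw) ∷ hyp 1 (con 1) v1 (ρ₃-pos res-z) ∷ hyp 1 (con 3) v3 r ∷ []))
        where
        ρ : Vec ℕ 4
        ρ = b w ∷ b z ∷ b (w ⊕ z) ∷ b (w ⊝ z) ∷ []

      n₁→n₃ : 3 ≤ n₁ → n₃ ≤ 2
      n₁→n₃ r = ≤-trans (≤-of (cong b (by-coef vs (a1 ⟨+⟩ (a0 ⟨-⟩ a2)) (a1 ⟨+⟩ (a0 ⟨+⟩ a2) ⟨+⟩ a2) refl)))
        (proj₁ (alternative (y ⊕ (y′ ⊕ z)) (independent-≢ ind (a1 ⟨+⟩ (a0 ⟨+⟩ a2)) (λ ()) , r) (pair (a1 ⟨+⟩ (a0 ⟨+⟩ a2)) a2 (λ ()) (λ ()) (λ ()) (λ ()))))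

      n₂→n₄ : 3 ≤ n₂ → n₄ ≤ 2
      n₂→n₄ r = ≤-trans (≤-of (cong b (by-coef vs (a1 ⟨-⟩ (a0 ⟨-⟩ a2)) (a1 ⟨-⟩ (a0 ⟨+⟩ a2) ⟨-⟩ a2) refl)))
        (proj₂ (alternative (y ⊝ (y′ ⊕ z)) (independent-≢ ind (a1 ⟨-⟩ (a0 ⟨+⟩ a2)) (λ ()) , r) (pair (a1 ⟨-⟩ (a0 ⟨+⟩ a2)) a2 (λ ()) (λ ()) (λ ()) (λ ()))))

      -- The four values form a cycle whose neighbours sum to at least 5, so one of n₁ and n₃ being
      -- at most 2 makes both n₂ and n₄ heavy. But opposite values differ by a translation by z and
      -- cannot both be heavy.
      contradiction : ⊥
      contradiction = at n₁ n₂ n₃ n₄ n₁+n₂ n₃+n₄ n₁+n₄ n₃+n₂ n₁→n₃ n₂→n₄ (3 ≤? n₁)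
        where
        big : ∀ {m n} → m ≤ 2 → 5 ≤ m + n → 3 ≤ n
        big {m} {n} p q = +-cancelˡ-≤ 2 3 n (≤-trans q (+-monoˡ-≤ n p))
        at : ∀ n₁ n₂ n₃ n₄ → 5 ≤ n₁ + n₂ → 5 ≤ n₃ + n₄ → 5 ≤ n₁ + n₄ → 5 ≤ n₃ + n₂ → (3 ≤ n₁ → n₃ ≤ 2) → (3 ≤ n₂ → n₄ ≤ 2) → Dec (3 ≤ n₁) → ⊥
        at n₁ n₂ n₃ n₄ p q r s f g (yes t) = 1+n≰n (≤-trans (big {n₃} (f t) q) (g (big {n₃} (f t) s)))
        at n₁ n₂ n₃ n₄ p q r s f g (no t) = 1+n≰n (≤-trans (big {n₁} (≤-pred (≰⇒> t)) r) (g (big {n₁} (≤-pred (≰⇒> t)) p)))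

  no-star : NoStar
  no-star z z≢0 res-z star = at heavy-exists
    where
    at : ∃ Heavy → ⊥
    at (y , hy) = at′ (companion y hy)
      where
      at′ : (∃ λ y′ → Heavy y′ × ¬ InSpan (y ∷ []) y′) → ⊥
      at′ (y′ , hy′ , out) = WithStar.Pair.contradiction z z≢0 res-z star y y′ hy hy′ out

InSpan-eval : ∀ {k m} {us : Vec V₅ k} {ws : Vec V₅ m} → (∀ i → InSpan us (lookup ws i)) → (e : Vexp m) → InSpan us (evalᵥ ws e)
InSpan-eval p (atom i) = p i
InSpan-eval p (e ⟨+⟩ f) = InSpan-⊕ (InSpan-eval p e) (InSpan-eval p f)
InSpan-eval p (e ⟨-⟩ f) = InSpan-⊕ (InSpan-eval p e) (InSpan-scale 2₃ (InSpan-eval p f))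
InSpan-eval p (c ⟨*⟩ e) = InSpan-scale c (InSpan-eval p e)

last∉ : ∀ {p q r : V₅} → Independent (p ∷ q ∷ r ∷ []) → ¬ InSpan (p ∷ q ∷ []) r
last∉ {p} {q} {r} ind (c ∷ d ∷ [] , e) = case ind (c ∷ d ∷ 2₃ ∷ []) (begin
  scale c p ⊕ (scale d q ⊕ (scale 2₃ r ⊕ 0ᵥ))   ≡⟨ by-coef (scale c p ∷ scale d q ∷ r ∷ 0ᵥ ∷ []) (a0 ⟨+⟩ (a1 ⟨+⟩ (2₃ ⟨*⟩ a2 ⟨+⟩ a3))) ((a0 ⟨+⟩ (a1 ⟨+⟩ a3)) ⟨-⟩ a2) refl ⟩
  comb (c ∷ d ∷ []) (p ∷ q ∷ []) ⊝ r            ≡⟨ cong (_⊝ r) (sym e) ⟩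
  r ⊝ r                                         ≡⟨ ⊝-self r ⟩
  0ᵥ                                            ∎) of λ ()
  where open ≡-Reasoning

-- A zero of b on the line of two heavy hyperplanes

module GapPlane (D : Arc) (gap : ∀ v → ¬ v ≡ 0ᵥ → 3 ≤ Arc.b D v → 6 ≤ Arc.b D v) (b≤8 : ∀ v → ¬ v ≡ 0ᵥ → Arc.b D v ≤ 8) where
  open Arc D
  open Dual D
  open Geometry D
  open Triangles D
  open Outcome D
  open Gap D gap b≤8
  open GapStar D gap b≤8

  Heavy-scale : ∀ {v} a → ¬ a ≡ 0₃ → Heavy v → Heavy (scale a v)
  Heavy-scale 0₃ p _ = ⊥-elim (p refl)
  Heavy-scale {v} 1₃ _ h = subst Heavy (sym (scale-1 v)) h
  Heavy-scale {v} 2₃ _ (v≢0 , 3≤b) = (λ p → v≢0 (trans (sym (⊖⊖ v)) (trans (cong ⊖_ p) (scale-0ᵥ 2₃)))) , ≤-trans 3≤b (≥-of (b-⊖ v))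

  b-scale : ∀ {v} a → ¬ a ≡ 0₃ → b (scale a v) ≡ b v
  b-scale {v} a a≢0 = even-scale b-⊖ a a≢0 v

  section-1 : ∀ {x} (s : Special x) v → ¬ v ≡ 0ᵥ → ¬ InSpan (Special.y s ∷ []) v → InSection s v → b v ≡ 1
  section-1 s v v≢0 v∉y (v⊥x , r) = ≡1-of (others≤1 s gap v v≢0 v⊥x v∉y) r

  module Zero {x₁} {s₁ : Special x₁} (△ : Triangle x₁ s₁) (e : V₅) (e∈ : InSpan (Triangle.basis △) e) (b-e : b e ≡ 0)
    (w₁ w₂ : V₅) (h₁ : Heavy w₁) (h₂ : Heavy w₂) (ind : Independent (w₁ ∷ w₂ ∷ [])) (e≡ : e ≡ w₁ ⊕ w₂) where
    open Triangle △

    ws : Vec V₅ 2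
    ws = w₁ ∷ w₂ ∷ []

    u : ℕ
    u = b (w₁ ⊝ w₂)

    w₁≢0 : ¬ w₁ ≡ 0ᵥ
    w₁≢0 = proj₁ h₁
    w₂≢0 : ¬ w₂ ≡ 0ᵥ
    w₂≢0 = proj₁ h₂

    -- The plane e ∩ w₁ weighs no more than the solid e, whose doubled mass is 44. Its pencil
    -- consists of e, w₁, w₂ and w₁ - w₂.
    sum≤16 : b w₁ + b w₂ + u ≤ 16
    sum≤16 = by-contra λ r → farkas {ρ = b w₁ ∷ b w₂ ∷ u ∷ b e ∷ b (e ⊕ w₁) ∷ b (e ⊝ w₁) ∷ M₂ F e w₁ ∷ M F e ∷ []}
      ( hyp 2 (con 17) (v0 :+ v1 :+ v2) r ∷ hyp 1 (con 12 :+ 2 :* (v3 :+ v0 :+ v4 :+ v5)) v6 (≥-of (M₂-F e w₁))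
      ∷ hyp 1 v6 v7 (M-≤-∑ (on e F) w₁) ∷ hyp 1 v7 (con 44 :+ 6 :* v3) (≤-of (M-F e)) ∷ hyp 4 v3 (con 0) (≤-of b-e)
      ∷ hyp 2 v2 v4 (≤-of (sym (trans (cong b (trans (cong (_⊕ w₁) e≡) (by-coef ws (a0 ⟨+⟩ a1 ⟨+⟩ a0) (2₃ ⟨*⟩ (a0 ⟨-⟩ a1)) refl))) (b-⊖ (w₁ ⊝ w₂)))))
      ∷ hyp 2 v1 v5 (≤-of (cong b (trans (by-coef ws a1 (a0 ⟨+⟩ a1 ⟨-⟩ a0) refl) (cong (_⊝ w₁) (sym e≡))))) ∷ [])

    e∈-span : ∀ {v} → Heavy v → ¬ InSpan (w₁ ∷ []) v → InSpan (v ∷ w₁ ∷ []) e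
    e∈-span {v} hv v∉ = decide (InSpan? (v ∷ w₁ ∷ []) e)
      where
      decide : Dec (InSpan (v ∷ w₁ ∷ []) e) → InSpan (v ∷ w₁ ∷ []) e
      decide (yes i) = i
      decide (no i) = ⊥-elim (zero-dependent △ e∈ b-e hv h₁ (independent-∷ (independent-∷ (independent₁ w₁≢0) v∉) i))

    -- By `zero-dependent` a further heavy v would lie on the line of w₁ and w₂. The other two
    -- elements of that line are e, with b = 0, and w₁ - w₂, with b ≤ 16 - 6 - 6 = 4.
    others≤2 : ∀ v → ¬ v ≡ 0ᵥ → ¬ InSpan (w₁ ∷ []) v → ¬ InSpan (w₂ ∷ []) v → b v ≤ 2
    others≤2 v v≢0 v∉1 v∉2 = ≤2 v v≢0 λ hv → at hv (e∈-span hv v∉1)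
      where
      at : Heavy v → InSpan (v ∷ w₁ ∷ []) e → ⊥
      at hv (c ∷ d ∷ [] , p) = by c d solved
        where
        solved : scale c v ≡ w₁ ⊕ w₂ ⊝ scale d w₁
        solved = trans (by-coef (scale c v ∷ scale d w₁ ∷ []) a0 (a0 ⟨+⟩ a1 ⟨-⟩ a1) refl)
          (cong (_⊝ scale d w₁) (trans (cong (scale c v ⊕_) (sym (⊕-idʳ (scale d w₁)))) (trans (sym p) e≡)))
        value : ∀ c d → ¬ c ≡ 0₃ → scale c v ≡ w₁ ⊕ w₂ ⊝ scale d w₁ → ∀ f → coef {2} f ≡ coef (a0 ⟨+⟩ a1 ⟨-⟩ d ⟨*⟩ a0) → b v ≡ b (evalᵥ ws f)
        value c d c≢0 q f r = trans (sym (b-scale c c≢0)) (cong b (trans q (by-coef ws (a0 ⟨+⟩ a1 ⟨-⟩ d ⟨*⟩ a0) f (sym r))))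
        small : ∀ {m} → b v ≡ m → m ≤ 5 → ⊥
        small q r = 1+n≰n (≤-trans (heavy-6 hv) (≤-trans (≤-of q) r))
        u≤4 : u ≤ 4
        u≤4 = by-contra λ r → farkas {ρ = b w₁ ∷ b w₂ ∷ u ∷ []} (hyp 1 (con 5) v2 r ∷ hyp 1 (v0 :+ v1 :+ v2) (con 16) sum≤16
          ∷ hyp 1 (con 6) v0 (heavy-6 h₁) ∷ hyp 1 (con 6) v1 (heavy-6 h₂) ∷ [])
        along-w₂ : ∀ c → ¬ c ≡ 0₃ → scale c v ≡ w₂ → InSpan (w₂ ∷ []) v
        along-w₂ 0₃ r _ = ⊥-elim (r refl)
        along-w₂ 1₃ _ q = 1₃ ∷ [] , trans (sym (scale-1 v)) (trans q (sym (trans (comb₁ 1₃ w₂) (scale-1 w₂))))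
        along-w₂ 2₃ _ q = 2₃ ∷ [] , trans (sym (⊖⊖ v)) (trans (cong ⊖_ q) (sym (comb₁ 2₃ w₂)))
        nonzero : ∀ c → ¬ c ≡ 0₃ → ∀ d → scale c v ≡ w₁ ⊕ w₂ ⊝ scale d w₁ → ⊥
        nonzero c r 0₃ q = small (trans (value c 0₃ r q (a0 ⟨+⟩ a1) refl) (trans (cong b (sym e≡)) b-e)) z≤n
        nonzero c r 1₃ q = v∉2 (along-w₂ c r (trans q (by-coef ws (a0 ⟨+⟩ a1 ⟨-⟩ 1₃ ⟨*⟩ a0) a1 refl)))
        nonzero c r 2₃ q = small (trans (value c 2₃ r q (2₃ ⟨*⟩ (a0 ⟨-⟩ a1)) refl) (b-⊖ (w₁ ⊝ w₂))) (≤-trans u≤4 (n≤1+n 4))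
        by : ∀ c d → scale c v ≡ w₁ ⊕ w₂ ⊝ scale d w₁ → ⊥
        by 0₃ d q = independent-≢ ind (a0 ⟨+⟩ a1 ⟨-⟩ d ⟨*⟩ a0) (bad d) (trans (sym q) (scale-0 v))
          where
          bad : ∀ d → ¬ coef {2} (a0 ⟨+⟩ a1 ⟨-⟩ d ⟨*⟩ a0) ≡ 0ᵥ
          bad 0₃ ()
          bad 1₃ ()
          bad 2₃ ()
        by 1₃ d q = nonzero 1₃ (λ ()) d q
        by 2₃ d q = nonzero 2₃ (λ ()) d q

    π : V₅ → ℕ
    π = on w₂ (on w₁ one)

    π-F : ∀ x → π x * F x ≡ on w₂ (on w₁ F) x
    π-F x = lemma (δ (w₂ · x)) (δ (w₁ · x)) (F x)
      where
      lemma : ∀ a b m → a * (b * 1) * m ≡ a * (b * m)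
      lemma = solve-∀

    π-01 : ∀ x → (π x ≡ 0) ⊎ (π x ≡ 1)
    π-01 x = at (w₂ · x) (w₁ · x)
      where
      at : ∀ s t → (δ s * (δ t * 1) ≡ 0) ⊎ (δ s * (δ t * 1) ≡ 1)
      at 0₃ 0₃ = inj₂ refl
      at 0₃ (F.suc t) = inj₁ refl
      at (F.suc s) t = inj₁ refl

    π-∈ : ∀ {x} → w₁ · x ≡ 0₃ → w₂ · x ≡ 0₃ → π x ≡ 1
    π-∈ p q = cong₂ (λ s t → δ t * (δ s * 1)) p q

    -- (F - 1)(F - 2) ≥ 0 is summed over the plane w₁ ∩ w₂ and F ≤ F² over the rest, then carried
    -- over to b by `second-moments`. The span of `us` collects vectors where the product is at
    -- least 2; the origin is always available.
    F-squares : ∀ {k} (us : Vec V₅ k) → (∀ x → F x + 2 * (π x * F x) + 2 * mult us x ≤ F x * F x + 2 * π x) →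
      384 + 12 * (b w₁ + b w₂ + u) + 6 * 3 ^ k ≤ ∑ (λ v → b v * b v) + 6
    F-squares {k} us p = by-contra λ r → farkas
      {ρ = b w₁ ∷ b w₂ ∷ u ∷ b (w₁ ⊕ w₂) ∷ ∑ (λ v → b v * b v) ∷ ∑ (λ x → F x * F x) ∷ ∑ F ∷ M₂ F w₁ w₂ ∷ M₂ one w₁ w₂ ∷ ∑ (λ x → 2 * mult us x) ∷ 3 ^ k ∷ []}
      ( hyp 1 (con 1 :+ (v4 :+ con 6)) (con 384 :+ 12 :* (v0 :+ v1 :+ v2) :+ 6 :* v10) r
      ∷ hyp 1 (con 48 :+ 3 :* v5) v4 (≥-of second-moments) ∷ hyp 3 (v6 :+ 2 :* v7 :+ v9) (v5 :+ 2 :* v8) (weigh-squares π (λ x → 2 * mult us x) p π-F)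
      ∷ hyp 3 (con 140) v6 (≥-of ∑-F) ∷ hyp 6 (con 12 :+ 2 :* (v0 :+ v1 :+ v3 :+ v2)) v7 (≥-of (M₂-F w₁ w₂))
      ∷ hyp 6 v8 (con 27) (≤-of (M₂-one ind)) ∷ hyp 3 (2 :* v10) v9 (≥-of (∑-2mult us)) ∷ [])
      where
      v10 : Lin 11
      v10 = var (F.suc (F.suc (F.suc (F.suc (F.suc (F.suc (F.suc (F.suc (F.suc (F.suc F.zero))))))))))

    F-squares₀ : 384 + 12 * (b w₁ + b w₂ + u) ≤ ∑ (λ v → b v * b v)
    F-squares₀ = +-cancelʳ-≤ 6 _ _ (F-squares [] λ x → decide x (x ≟ᵥ 0ᵥ))
      where
      decide : ∀ x → Dec (x ≡ 0ᵥ) → F x + 2 * (π x * F x) + 2 * mult [] x ≤ F x * F x + 2 * π x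
      decide x (yes p) = square-at-0 (π-∈ (trans (cong (w₁ ·_) p) (·-0ʳ w₁)) (trans (cong (w₂ ·_) p) (·-0ʳ w₂))) (trans (cong F p) F-0) (mult-∈ [] independent-[] ([] , p))
      decide x (no p) = square-gap {m = F x} (π-01 x) (mult-∉ [] (∉-[] p))

    -- Off the lines w₁ and w₂ one has b ≤ 2 and so b² ≤ 2b, with a gain of one wherever b = 1.
    b-squares : ∀ (σ : V₅ → ℕ) K₁ K₂ K₀ →
      (∀ v → ¬ v ≡ 0ᵥ → ¬ InSpan (w₁ ∷ []) v → ¬ InSpan (w₂ ∷ []) v → (σ v ≡ 0) ⊎ (σ v ≡ 1 × b v ≡ 1)) →
      (∀ c → ¬ c ≡ 0₃ → b w₁ * b w₁ + σ (scale c w₁) ≤ 2 * b w₁ + K₁) →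
      (∀ c → ¬ c ≡ 0₃ → b w₂ * b w₂ + σ (scale c w₂) ≤ 2 * b w₂ + K₂) →
      256 + σ 0ᵥ ≤ 32 + (K₁ + K₂ + K₀) →
      ∑ (λ v → b v * b v) + ∑ σ ≤ 216 + 3 * K₁ + 3 * K₂ + K₀
    b-squares σ K₁ K₂ K₀ off on₁ on₂ at₀ = begin
      ∑ (λ v → b v * b v) + ∑ σ
        ≡⟨ sym (∑-+ (λ v → b v * b v) σ) ⟩
      ∑ (λ v → b v * b v + σ v)
        ≤⟨ ∑-mono (λ v → decide v (v ≟ᵥ 0ᵥ) (InSpan? (w₁ ∷ []) v) (InSpan? (w₂ ∷ []) v)) ⟩
      ∑ (λ v → 2 * b v + m₁ v * K₁ + m₂ v * K₂ + mult [] v * K₀)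
        ≡⟨ ∑-+ (λ v → 2 * b v + m₁ v * K₁ + m₂ v * K₂) (λ v → mult [] v * K₀) ⟩
      ∑ (λ v → 2 * b v + m₁ v * K₁ + m₂ v * K₂) + ∑ (λ v → mult [] v * K₀)
        ≡⟨ cong₂ _+_ (∑-+ (λ v → 2 * b v + m₁ v * K₁) (λ v → m₂ v * K₂)) (trans (∑-mult [] λ _ → K₀) (∑-[] λ _ → K₀)) ⟩
      ∑ (λ v → 2 * b v + m₁ v * K₁) + ∑ (λ v → m₂ v * K₂) + K₀
        ≡⟨ cong (_+ K₀) (cong₂ _+_ (∑-+ (λ v → 2 * b v) (λ v → m₁ v * K₁)) (trans (∑-mult (w₂ ∷ []) λ _ → K₂) (∑-const 1 K₂))) ⟩
      ∑ (λ v → 2 * b v) + ∑ (λ v → m₁ v * K₁) + 3 * K₂ + K₀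
        ≡⟨ cong (λ t → t + 3 * K₂ + K₀) (cong₂ _+_ (trans (∑-* 2 b) (cong (2 *_) ∑-b)) (trans (∑-mult (w₁ ∷ []) λ _ → K₁) (∑-const 1 K₁))) ⟩
      216 + 3 * K₁ + 3 * K₂ + K₀ ∎
      where
      open ≤-Reasoning
      m₁ m₂ : V₅ → ℕ
      m₁ = mult (w₁ ∷ [])
      m₂ = mult (w₂ ∷ [])
      square : ∀ m {k} j → m ≤ 2 → (k ≡ 0) ⊎ (k ≡ 1 × m ≡ 1) → m * m + k ≤ 2 * m + j
      square 0 j _ (inj₁ refl) = z≤n
      square 1 j _ (inj₁ refl) = s≤s z≤n
      square 2 j _ (inj₁ refl) = m≤m+n 4 j
      square m j _ (inj₂ (refl , refl)) = m≤m+n 2 j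
      square (suc (suc (suc m))) j (s≤s (s≤s ())) (inj₁ _)
      regroup : ∀ a b c d → a + (b + c + d) ≡ a + b + c + d
      regroup = solve-∀
      line : ∀ v (w : V₅) K → ¬ v ≡ 0ᵥ → (∀ c → ¬ c ≡ 0₃ → b w * b w + σ (scale c w) ≤ 2 * b w + K) → InSpan (w ∷ []) v → b v * b v + σ v ≤ 2 * b v + K
      line v w K v≢0 q (c ∷ [] , p) = at (c F.≟ 0₃)
        where
        v≡ : v ≡ scale c w
        v≡ = trans p (comb₁ c w)
        at : Dec (c ≡ 0₃) → b v * b v + σ v ≤ 2 * b v + K
        at (yes refl) = ⊥-elim (v≢0 (trans v≡ (scale-0 w)))
        at (no r) = subst₂ (λ m k → m * m + k ≤ 2 * m + K) (sym (trans (cong b v≡) (b-scale c r))) (cong σ (sym v≡)) (q c r)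
      origin : ∀ {m k m₁ m₂ m₀} → m ≡ 16 → k ≡ σ 0ᵥ → m₁ ≡ 1 → m₂ ≡ 1 → m₀ ≡ 1 → m * m + k ≤ 2 * m + m₁ * K₁ + m₂ * K₂ + m₀ * K₀
      origin refl refl refl refl refl = ≤-trans at₀ (≤-of (lemma K₁ K₂ K₀))
        where
        lemma : ∀ a b c → 32 + (a + b + c) ≡ 32 + 1 * a + 1 * b + 1 * c
        lemma = solve-∀
      decide : ∀ v → Dec (v ≡ 0ᵥ) → Dec (InSpan (w₁ ∷ []) v) → Dec (InSpan (w₂ ∷ []) v) →
        b v * b v + σ v ≤ 2 * b v + m₁ v * K₁ + m₂ v * K₂ + mult [] v * K₀
      decide v (yes p) _ _ = origin (trans (cong b p) b-0) (cong σ p) (trans (cong m₁ p) (mult-0 (independent₁ w₁≢0)))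
        (trans (cong m₂ p) (mult-0 (independent₁ w₂≢0))) (mult-∈ [] independent-[] ([] , p))
      decide v (no p) (yes i) _ = ≤-trans (line v w₁ K₁ p on₁ i) (≤-trans (≤-of (cong (2 * b v +_) (sym (trans (cong (_* K₁) (mult-∈ (w₁ ∷ []) (independent₁ w₁≢0) i)) (+-identityʳ K₁)))))
        (≤-trans (m≤m+n (2 * b v + m₁ v * K₁) (m₂ v * K₂)) (m≤m+n (2 * b v + m₁ v * K₁ + m₂ v * K₂) (mult [] v * K₀))))
      decide v (no p) (no _) (yes i) = ≤-trans (line v w₂ K₂ p on₂ i) (≤-trans (≤-of (cong (2 * b v +_) (sym (trans (cong (_* K₂) (mult-∈ (w₂ ∷ []) (independent₁ w₂≢0) i)) (+-identityʳ K₂)))))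
        (≤-trans (+-monoˡ-≤ (m₂ v * K₂) (m≤m+n (2 * b v) (m₁ v * K₁))) (m≤m+n (2 * b v + m₁ v * K₁ + m₂ v * K₂) (mult [] v * K₀))))
      decide v (no p) (no i) (no j) = ≤-trans (square (b v) (m₁ v * K₁ + m₂ v * K₂ + mult [] v * K₀) (others≤2 v p i j) (off v p i j))
        (≤-of (regroup (2 * b v) (m₁ v * K₁) (m₂ v * K₂) (mult [] v * K₀)))

-- Second moments when the heavy values are 6 or 7

module GapCases (D : Arc) (gap : ∀ v → ¬ v ≡ 0ᵥ → 3 ≤ Arc.b D v → 6 ≤ Arc.b D v) (b≤8 : ∀ v → ¬ v ≡ 0ᵥ → Arc.b D v ≤ 8) where
  open Arc D
  open Dual D
  open Geometry D
  open Triangles D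
  open Outcome D
  open Gap D gap b≤8
  open GapStar D gap b≤8
  open GapPlane D gap b≤8

  residue-6 : ∀ {v} → b v ≡ 6 → ¬ Res₁ D v
  residue-6 p r = case trans (sym (cong ρ₃ p)) r of λ ()

  b-in-line : ∀ {v w : V₅} → ¬ v ≡ 0ᵥ → InSpan (w ∷ []) v → b v ≡ b w
  b-in-line {v} {w} v≢0 (c ∷ [] , p) = at (c F.≟ 0₃)
    where
    at : Dec (c ≡ 0₃) → b v ≡ b w
    at (yes refl) = ⊥-elim (v≢0 (trans p (trans (comb₁ 0₃ w) (scale-0 w))))
    at (no q) = trans (cong b (trans p (comb₁ c w))) (b-scale c q)

  module _ {x₁} {s₁ : Special x₁} (△ : Triangle x₁ s₁) (e : V₅) (e∈ : InSpan (Triangle.basis △) e) (b-e : b e ≡ 0)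
    (w₁ w₂ : V₅) (h₁ : Heavy w₁) (h₂ : Heavy w₂) (ind : Independent (w₁ ∷ w₂ ∷ [])) (e≡ : e ≡ w₁ ⊕ w₂) where
    open Triangle △
    open Zero △ e e∈ b-e w₁ w₂ h₁ h₂ ind e≡

    private
      sec : V₅ → ℕ
      sec = σ s₁

    -- `F-squares₀` requires 384 + 12 * 12 = 528. Above, the 538 is reduced by 9 for the first
    -- section and 3 for the line of r, where b = 1 is odd and b² < 2b. The vector r counts
    -- separately because p and q already span the first section. The constants are 24 = 36 - 12 and
    -- 178 = 258 - 32 - 48.
    all-six : (∀ v → Heavy v → b v ≡ 6) → ⊥
    all-six six = farkas {ρ = b w₁ ∷ b w₂ ∷ u ∷ ∑ (λ v → b v * b v) ∷ ∑ σ′ ∷ []}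
      ( hyp 1 (con 384 :+ 12 :* (v0 :+ v1 :+ v2)) v3 F-squares₀ ∷ hyp 12 (con 6) v0 (heavy-6 h₁) ∷ hyp 12 (con 6) v1 (heavy-6 h₂)
      ∷ hyp 1 (v3 :+ v4) (con 538) (b-squares σ′ 24 24 178 off (on-w w₁ h₁) (on-w w₂ h₂) at₀)
      ∷ hyp 1 (con 12) v4 (≥-of (trans (∑-+ sec (mult (r ∷ []))) (cong₂ _+_ (∑-σ s₁) (∑-mult-one (r ∷ []))))) ∷ [])
      where
      r≢0 : ¬ r ≡ 0ᵥ
      r≢0 = independent-≢ independent a2 λ ()
      σ′ : V₅ → ℕ
      σ′ v = sec v + mult (r ∷ []) v
      one-of : ∀ {x} (s : Special x) v → ¬ v ≡ 0ᵥ → InSection s v → b v ≡ 1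
      one-of s v v≢0 i = section-1 s v v≢0 (λ j → residue-6 (trans (b-in-line v≢0 j) (six y (y≢0 , 3≤b-y))) (proj₂ i)) i
        where open Special s
      b-r : b r ≡ 1
      b-r = one-of s₂ r r≢0 r₂
      r∉ : ¬ InSection s₁ r
      r∉ i = last∉ independent (section-span s₁ pq p₁ q₁ i)
        where
        pq : Independent (p ∷ q ∷ [])
        pq = independent-pair independent a0 a1 (λ ()) (λ ()) (λ ()) (λ ())
      off : ∀ v → ¬ v ≡ 0ᵥ → ¬ InSpan (w₁ ∷ []) v → ¬ InSpan (w₂ ∷ []) v → (σ′ v ≡ 0) ⊎ (σ′ v ≡ 1 × b v ≡ 1)
      off v v≢0 _ _ = decide (InSection? s₁ v) (InSpan? (r ∷ []) v)
        where
        decide : Dec (InSection s₁ v) → Dec (InSpan (r ∷ []) v) → (σ′ v ≡ 0) ⊎ (σ′ v ≡ 1 × b v ≡ 1)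
        decide (yes i) (no j) = inj₂ (cong₂ _+_ (σ-∈ s₁ i) (mult-∉ (r ∷ []) j) , one-of s₁ v v≢0 i)
        decide (yes i) (yes j) = ⊥-elim (r∉ (along (span₁-sym v≢0 j)))
          where
          along : InSpan (v ∷ []) r → InSection s₁ r
          along (c ∷ [] , p) = subst (InSection s₁) (sym (trans p (comb₁ c v))) (section-scale s₁ c i)
        decide (no i) (yes j) = inj₂ (cong₂ _+_ (σ-∉ s₁ v i) (mult-∈ (r ∷ []) (independent₁ r≢0) j) , trans (b-in-line v≢0 j) b-r)
        decide (no i) (no j) = inj₁ (cong₂ _+_ (σ-∉ s₁ v i) (mult-∉ (r ∷ []) j))
      on-w : ∀ w → Heavy w → ∀ c → ¬ c ≡ 0₃ → b w * b w + σ′ (scale c w) ≤ 2 * b w + 24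
      on-w w hw c c≢0 = ≤-of (lemma (six w hw) (cong₂ _+_ (σ-∉ s₁ (scale c w) λ i → residue-6 b-cw (proj₂ i)) (mult-∉ (r ∷ []) λ j → case trans (sym b-cw) (trans (b-in-line (proj₁ (Heavy-scale c c≢0 hw)) j) b-r) of λ ())))
        where
        b-cw : b (scale c w) ≡ 6
        b-cw = trans (b-scale c c≢0) (six w hw)
        lemma : ∀ {m k} → m ≡ 6 → k ≡ 0 → m * m + k ≡ 2 * m + 24
        lemma refl refl = refl
      at₀ : 256 + σ′ 0ᵥ ≤ 258
      at₀ = ≤-of (cong (256 +_) (cong₂ _+_ (σ-∈ s₁ (section-0 s₁)) (mult-0 (independent₁ r≢0))))

    module Sevens (b-w₁ : b w₁ ≡ 7) (b-w₂ : b w₂ ≡ 7) (w₁∈s₁ : InSection s₁ w₁) (y∈w₁ : InSpan (w₁ ∷ []) (Special.y s₁)) where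

      private
        y₁ : V₅
        y₁ = Special.y s₁

      w₂∤x₁ : ¬ w₂ · x₁ ≡ 0₃
      w₂∤x₁ p = zero-avoids △ e∈ b-e x₁ s₁ (trans (cong (_· x₁) e≡) (trans (·-⊕ˡ w₁ w₂ x₁) (cong₂ _+₃_ (proj₁ w₁∈s₁) p)))

      -- The section saves 9 out of 583. Since w₁ lies in it and w₂ does not, the constants are 36 =
      -- 49 + 1 - 14 and 35 = 49 - 14, and 154 completes 257 = 32 + 36 + 35 + 154 at the origin.
      squares-≤574 : ∑ (λ v → b v * b v) ≤ 574
      squares-≤574 = by-contra λ r → farkas {ρ = ∑ (λ v → b v * b v) ∷ ∑ sec ∷ []}
        ( hyp 1 (con 575) v0 r ∷ hyp 1 (v0 :+ v1) (con 583) (b-squares sec 36 35 154 off on₁ on₂ (≤-of (cong (256 +_) (σ-∈ s₁ (section-0 s₁)))))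
        ∷ hyp 1 (con 9) v1 (≥-of (∑-σ s₁)) ∷ [])
        where
        off : ∀ v → ¬ v ≡ 0ᵥ → ¬ InSpan (w₁ ∷ []) v → ¬ InSpan (w₂ ∷ []) v → (sec v ≡ 0) ⊎ (sec v ≡ 1 × b v ≡ 1)
        off v v≢0 v∉ _ = decide (InSection? s₁ v)
          where
          v∉y : ¬ InSpan (y₁ ∷ []) v
          v∉y j = v∉ (span₁-⊆ y∈w₁ j)
          decide : Dec (InSection s₁ v) → (sec v ≡ 0) ⊎ (sec v ≡ 1 × b v ≡ 1)
          decide (yes i) = inj₂ (σ-∈ s₁ i , section-1 s₁ v v≢0 v∉y i)
          decide (no i) = inj₁ (σ-∉ s₁ v i)
        on₁ : ∀ c → ¬ c ≡ 0₃ → b w₁ * b w₁ + sec (scale c w₁) ≤ 2 * b w₁ + 36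
        on₁ c _ = ≤-of (lemma b-w₁ (σ-∈ s₁ (section-scale s₁ c w₁∈s₁)))
          where
          lemma : ∀ {m k} → m ≡ 7 → k ≡ 1 → m * m + k ≡ 2 * m + 36
          lemma refl refl = refl
        on₂ : ∀ c → ¬ c ≡ 0₃ → b w₂ * b w₂ + sec (scale c w₂) ≤ 2 * b w₂ + 35
        on₂ c c≢0 = ≤-of (lemma b-w₂ (σ-∉ s₁ (scale c w₂) λ i → w₂∤x₁ (*₃-cancel c (w₂ · x₁) c≢0 (trans (sym (·-scaleˡ c w₂ x₁)) (proj₁ i)))))
          where
          lemma : ∀ {m k} → m ≡ 7 → k ≡ 0 → m * m + k ≡ 2 * m + 35
          lemma refl refl = refl

      u≤1 : u ≤ 1
      u≤1 = by-contra λ r → farkas {ρ = b w₁ ∷ b w₂ ∷ u ∷ ∑ (λ v → b v * b v) ∷ []}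
        ( hyp 12 (con 2) v2 r ∷ hyp 1 (con 384 :+ 12 :* (v0 :+ v1 :+ v2)) v3 F-squares₀ ∷ hyp 12 (con 7) v0 (≥-of b-w₁) ∷ hyp 12 (con 7) v1 (≥-of b-w₂)
        ∷ hyp 1 v3 (con 574) squares-≤574 ∷ [])

      Both : V₅ → Set
      Both x = ¬ x ≡ 0ᵥ × w₁ · x ≡ 0₃ × w₂ · x ≡ 0₃

      b-e′ : b (w₁ ⊕ w₂) ≡ 0
      b-e′ = trans (cong b (sym e≡)) b-e

      -- For u = 1 the second moment of b is at least 564. Multiplicity 3 makes (F - 1)(F - 2) at
      -- least 2 at both representatives, which adds 12 and exceeds 574.
      thin : u ≡ 1 → ∀ x → Both x → F x ≤ 2
      thin u≡1 X (X≢0 , w₁⊥X , w₂⊥X) = by-contra λ r → farkas {ρ = b w₁ ∷ b w₂ ∷ u ∷ ∑ (λ v → b v * b v) ∷ []}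
        ( hyp 12 (con 1) v2 (≥-of u≡1) ∷ hyp 1 (con 384 :+ 12 :* (v0 :+ v1 :+ v2) :+ con 18) (v3 :+ con 6) (F-squares Xs λ x → decide r x (x ≟ᵥ 0ᵥ) (InSpan? Xs x))
        ∷ hyp 12 (con 7) v0 (≥-of b-w₁) ∷ hyp 12 (con 7) v1 (≥-of b-w₂) ∷ hyp 1 v3 (con 574) squares-≤574 ∷ [])
        where
        Xs : Vec V₅ 1
        Xs = X ∷ []
        triple : ∀ {k m j} → k ≡ 1 → j ≡ 1 → 3 ≤ m → m + 2 * (k * m) + 2 * j ≤ m * m + 2 * k
        triple {m = m} refl refl p = ≤-trans (≤-of (lemma m)) (+-monoˡ-≤ 2 (*-monoˡ-≤ m p))
          where
          lemma : ∀ m → m + 2 * (m + 0) + 2 ≡ 3 * m + 2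
          lemma = solve-∀
        decide : 3 ≤ F X → ∀ x → Dec (x ≡ 0ᵥ) → Dec (InSpan Xs x) → F x + 2 * (π x * F x) + 2 * mult Xs x ≤ F x * F x + 2 * π x
        decide r x (yes p) _ = square-at-0 (π-∈ (trans (cong (w₁ ·_) p) (·-0ʳ w₁)) (trans (cong (w₂ ·_) p) (·-0ʳ w₂))) (trans (cong F p) F-0)
          (trans (cong (mult Xs) p) (mult-0 (independent₁ X≢0)))
        decide r x (no p) (no i) = square-gap {m = F x} (π-01 x) (mult-∉ Xs i)
        decide r x (no p) (yes i@(c ∷ [] , q)) = triple {m = F x} (π-∈ (along w₁ w₁⊥X) (along w₂ w₂⊥X)) (mult-∈ Xs (independent₁ X≢0) i)
            (≤-trans r (≥-of (trans (cong F x≡) (even-scale F-⊖ c (λ { refl → p (trans x≡ (scale-0 X)) }) X))))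
          where
          x≡ : x ≡ scale c X
          x≡ = trans q (comb₁ c X)
          along : ∀ w → w · X ≡ 0₃ → w · x ≡ 0₃
          along w w⊥X = trans (cong (w ·_) x≡) (trans (·-scaleʳ c w X) (trans (cong (c *₃_) w⊥X) (*₃-zeroʳ c)))

      -- All planes through w₁ and w₂ have mass at least 16 there, and a hyperplane through them meets only 19.
      u≢0 : ¬ u ≡ 0
      u≢0 u≡0 = at found
        where
        M₂≡40 : M₂ F w₁ w₂ ≡ 40
        M₂≡40 = trans (M₂-F w₁ w₂) (cong (λ m → 12 + 2 * m) (cong₂ _+_ (cong₂ _+_ (cong₂ _+_ b-w₁ b-w₂) b-e′) u≡0))
        f : V₅ → ℕ
        f = on w₂ (on w₁ F)
        -- If F were at least 2 on all 13 points of the plane w₁ ∩ w₂, its doubled mass would be 52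
        -- instead of 40.
        found : ∃ λ X → Both X × F X ≤ 1
        found = [ id , (λ none → ⊥-elim (absurd none)) ]′
          (search λ x → (¬? (x ≟ᵥ 0ᵥ) ×-dec (w₁ · x) F.≟ 0₃ ×-dec (w₂ · x) F.≟ 0₃) ×-dec (F x ≤? 1))
          where
          absurd : (∀ x → ¬ (Both x × F x ≤ 1)) → ⊥
          absurd none = farkas {ρ = M₂ F w₁ w₂ ∷ M₂ one w₁ w₂ ∷ ∑ (λ x → 2 * mult [] x) ∷ []}
            ( hyp 2 (con 27) v1 (M₂-one-≥ w₁ w₂) ∷ hyp 1 v0 (con 40) (≤-of M₂≡40) ∷ hyp 1 v2 (con 2) (≤-of (∑-2mult []))
            ∷ hyp 1 (2 :* v1) (v0 :+ v2) (≤-trans (≥-of (∑-* 2 π)) (≤-trans (∑-mono λ x → bound x (w₂ · x) (w₁ · x) refl refl) (≤-of (∑-+ f (λ x → 2 * mult [] x))))) ∷ [])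
            where
            bound : ∀ x s t → w₂ · x ≡ s → w₁ · x ≡ t → 2 * π x ≤ f x + 2 * mult [] x
            bound x s t p q = ≤-trans (≤-of (cong₂ (λ s t → 2 * (δ s * (δ t * 1))) p q)) (≤-trans (by s t p q (x ≟ᵥ 0ᵥ))
              (≤-of (cong₂ (λ s t → δ s * (δ t * F x) + 2 * mult [] x) (sym p) (sym q))))
              where
              by : ∀ s t → w₂ · x ≡ s → w₁ · x ≡ t → Dec (x ≡ 0ᵥ) → 2 * (δ s * (δ t * 1)) ≤ δ s * (δ t * F x) + 2 * mult [] x
              by (F.suc s) t _ _ _ = z≤n
              by 0₃ (F.suc t) _ _ _ = z≤n
              by 0₃ 0₃ p q (yes z) = ≤-trans (≥-of (cong (2 *_) (mult-∈ [] independent-[] ([] , z)))) (m≤n+m (2 * mult [] x) (F x + 0 + 0))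
              by 0₃ 0₃ p q (no z) = ≤-trans (≰⇒> λ r → none x ((z , q , p) , r)) (≤-trans (≤-of (sym (trans (+-identityʳ (F x + 0)) (+-identityʳ (F x))))) (m≤m+n (F x + 0 + 0) (2 * mult [] x)))
        -- The pencil gives 3 M₃ = 32 + 2k, and k = 0 is impossible because 3 does not divide 32.
        -- Four lines through X then weigh 48, more than 40 + 6 * 1.
        M₃-≥12 : ∀ v → 12 ≤ M₃ F w₁ w₂ v
        M₃-≥12 v = by-contra λ r → case k ≤? 0 of λ
          { (yes s) → odd r (n≤0⇒n≡0 s)
          ; (no s) → farkas {ρ = ρ} (hyp 3 (con 1 :+ v0) (con 12) r ∷ hyp 2 (con 1) v1 (≰⇒> s) ∷ hyp 1 (con 32 :+ 2 :* v1) (3 :* v0) eq ∷ []) }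
          where
          k : ℕ
          k = b v + b (w₁ ⊕ v) + b (w₁ ⊝ v) + (b (w₂ ⊕ v) + b (w₁ ⊕ (w₂ ⊕ v)) + b (w₁ ⊝ (w₂ ⊕ v))) + (b (w₂ ⊝ v) + b (w₁ ⊕ (w₂ ⊝ v)) + b (w₁ ⊝ (w₂ ⊝ v)))
          ρ : Vec ℕ 2
          ρ = M₃ F w₁ w₂ v ∷ k ∷ []
          expand : ∀ t → M₂ F w₁ t ≡ 26 + 2 * (b t + b (w₁ ⊕ t) + b (w₁ ⊝ t))
          expand t = trans (M₂-F w₁ t) (lemma (b t) (b (w₁ ⊕ t)) (b (w₁ ⊝ t)) b-w₁)
            where
            rearrange : ∀ a c d → 12 + 2 * (7 + a + c + d) ≡ 26 + 2 * (a + c + d)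
            rearrange = solve-∀
            lemma : ∀ a c d {m} → m ≡ 7 → 12 + 2 * (m + a + c + d) ≡ 26 + 2 * (a + c + d)
            lemma a c d refl = rearrange a c d
          pencil : M₂ F w₁ w₂ + M₂ F w₁ v + M₂ F w₁ (w₂ ⊕ v) + M₂ F w₁ (w₂ ⊝ v) ≡ M F w₁ + 3 * M₃ F w₁ w₂ v
          pencil = M₂-pencil F w₁ w₂ v
          M-F-w₁ : M F w₁ ≡ 86
          M-F-w₁ = trans (M-F w₁) (cong (λ m → 44 + 6 * m) b-w₁)
          eq′ : (32 + 2 * k ≤ 3 * M₃ F w₁ w₂ v) × (3 * M₃ F w₁ w₂ v ≤ 32 + 2 * k)
          eq′ = by-contra (λ r → farkas {ρ = ρ′} (hyp 1 (con 1 :+ 3 :* v0) (con 32 :+ 2 :* vk) r ∷ hyp 1 (v1 :+ v2 :+ v3 :+ v4) (v5 :+ 3 :* v0) (≤-of pencil)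
              ∷ hyp 1 (con 40) v1 (≥-of M₂≡40) ∷ hyp 1 (con 26 :+ 2 :* v6) v2 (≥-of (expand v)) ∷ hyp 1 (con 26 :+ 2 :* v7) v3 (≥-of (expand (w₂ ⊕ v)))
              ∷ hyp 1 (con 26 :+ 2 :* v8) v4 (≥-of (expand (w₂ ⊝ v))) ∷ hyp 1 v5 (con 86) (≤-of M-F-w₁) ∷ [])) ,
            by-contra (λ r → farkas {ρ = ρ′} (hyp 1 (con 1 :+ (con 32 :+ 2 :* vk)) (3 :* v0) r ∷ hyp 1 (v5 :+ 3 :* v0) (v1 :+ v2 :+ v3 :+ v4) (≥-of pencil)
              ∷ hyp 1 v1 (con 40) (≤-of M₂≡40) ∷ hyp 1 v2 (con 26 :+ 2 :* v6) (≤-of (expand v)) ∷ hyp 1 v3 (con 26 :+ 2 :* v7) (≤-of (expand (w₂ ⊕ v)))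
              ∷ hyp 1 v4 (con 26 :+ 2 :* v8) (≤-of (expand (w₂ ⊝ v))) ∷ hyp 1 (con 86) v5 (≥-of M-F-w₁) ∷ []))
            where
            vk : Lin 9
            vk = v6 :+ v7 :+ v8
            ρ′ : Vec ℕ 9
            ρ′ = M₃ F w₁ w₂ v ∷ M₂ F w₁ w₂ ∷ M₂ F w₁ v ∷ M₂ F w₁ (w₂ ⊕ v) ∷ M₂ F w₁ (w₂ ⊝ v) ∷ M F w₁
              ∷ b v + b (w₁ ⊕ v) + b (w₁ ⊝ v) ∷ b (w₂ ⊕ v) + b (w₁ ⊕ (w₂ ⊕ v)) + b (w₁ ⊝ (w₂ ⊕ v)) ∷ b (w₂ ⊝ v) + b (w₁ ⊕ (w₂ ⊝ v)) + b (w₁ ⊝ (w₂ ⊝ v)) ∷ []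
          eq : 32 + 2 * k ≤ 3 * M₃ F w₁ w₂ v
          eq = proj₁ eq′
          odd : suc (M₃ F w₁ w₂ v) ≤ 12 → k ≡ 0 → ⊥
          odd r s = farkas {ρ = ρ} (hyp 3 (con 11) v0 eleven ∷ hyp 1 (3 :* v0) (con 32 :+ 2 :* v1) (proj₂ eq′) ∷ hyp 2 v1 (con 0) (≤-of s) ∷ [])
            where
            eleven : 11 ≤ M₃ F w₁ w₂ v
            eleven = by-contra λ t → farkas {ρ = ρ} (hyp 3 (con 1 :+ v0) (con 11) t ∷ hyp 1 (con 32 :+ 2 :* v1) (3 :* v0) eq ∷ [])
        at : (∃ λ X → Both X × F X ≤ 1) → ⊥
        at (X , (X≢0 , w₁⊥X , w₂⊥X) , small) = farkas {ρ = M₂ F w₁ w₂ ∷ F X ∷ []}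
          ( hyp 1 (con 48) (v0 :+ 6 :* v1) (spread F w₂ w₁ 12 F-0 F-⊖ (independent-pair ind a1 a0 (λ ()) (λ ()) (λ ()) (λ ())) X≢0 w₂⊥X w₁⊥X M₃-≥12)
          ∷ hyp 1 v0 (con 40) (≤-of M₂≡40) ∷ hyp 6 v1 (con 1) small ∷ [])

      -- Off the line w₁w₂ the plane of the triangle is positive, so its dual line has mass at least 9, but F ≤ 2 there.
      u≢1 : w₂ ≡ e ⊝ w₁ → InSpan basis w₁ → ¬ u ≡ 1
      u≢1 w₂≡ w₁∈ u≡1 = at (section-escape s₁ (w₁ ∷ []) (independent₁ w₁≢0) (≤ᵇ⇒≤ 3 8 tt))
        where
        at : (∃ λ w → InSection s₁ w × ¬ InSpan (w₁ ∷ []) w) → ⊥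
        at (w , w∈s , w∉) = farkas {ρ = M₃ F w₁ w₂ w ∷ M₂ F w₁ w₂ ∷ M₂ F w₁ w ∷ M₂ F w₁ (w₂ ⊕ w) ∷ M₂ F w₁ (w₂ ⊝ w) ∷ M F w₁ ∷ M₃ one w₁ w₂ w ∷ ∑ (λ x → 2 * mult [] x) ∷ []}
          ( hyp 1 (v1 :+ v2 :+ v3 :+ v4) (v5 :+ 3 :* v0) (≤-of (M₂-pencil F w₁ w₂ w)) ∷ hyp 1 (con 42) v1 (≥-of M₂≡42)
          ∷ hyp 1 (con 32) v2 (thirty-two a0 (λ ()) refl refl) ∷ hyp 1 (con 32) v3 (thirty-two (a2 ⟨+⟩ a0) (λ ()) refl refl) ∷ hyp 1 (con 32) v4 (thirty-two (a2 ⟨-⟩ a0) (λ ()) refl refl)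
          ∷ hyp 1 v5 (con 86) (≤-of (trans (M-F w₁) (cong (λ m → 44 + 6 * m) b-w₁)))
          ∷ hyp 3 (v0 :+ v7) (2 :* v6) light ∷ hyp 6 v6 (con 9) (≤-of (M₃-one ind₁₂w)) ∷ hyp 3 (con 2) v7 (≥-of (∑-2mult [])) ∷ [])
          where
          M₂≡42 : M₂ F w₁ w₂ ≡ 42
          M₂≡42 = trans (M₂-F w₁ w₂) (cong (λ m → 12 + 2 * m) (cong₂ _+_ (cong₂ _+_ (cong₂ _+_ b-w₁ b-w₂) b-e′) u≡1))
          w∉ws : ¬ InSpan ws w
          w∉ws (c ∷ d ∷ [] , p) = by d p
            where
            pairing : ∀ d → w ≡ comb (c ∷ d ∷ []) ws → d *₃ (w₂ · x₁) ≡ 0₃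
            pairing d p = trans (sym (+₃-idˡ _)) (trans (cong₂ _+₃_ (sym (trans (·-scaleˡ c w₁ x₁) (trans (cong (c *₃_) (proj₁ w₁∈s₁)) (*₃-zeroʳ c)))) (sym (·-scaleˡ d w₂ x₁)))
              (trans (sym (·-⊕ˡ (scale c w₁) (scale d w₂) x₁)) (trans (cong (_· x₁) (trans (cong (scale c w₁ ⊕_) (sym (⊕-idʳ (scale d w₂)))) (sym p))) (proj₁ w∈s))))
            by : ∀ d → w ≡ comb (c ∷ d ∷ []) ws → ⊥
            by 0₃ p = w∉ (c ∷ [] , trans p (cong (scale c w₁ ⊕_) (trans (⊕-idʳ (scale 0₃ w₂)) (scale-0 w₂))))
            by 1₃ p = w₂∤x₁ (trans (sym (*₃-idˡ _)) (pairing 1₃ p))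
            by 2₃ p = w₂∤x₁ (*₃-cancel 2₃ (w₂ · x₁) (λ ()) (pairing 2₃ p))
          www : Vec V₅ 3
          www = w ∷ w₁ ∷ w₂ ∷ []
          ind-w : Independent www
          ind-w = independent-∷ ind w∉ws
          ind₁₂w : Independent (w₁ ∷ w₂ ∷ w ∷ [])
          ind₁₂w = independent₃-by ind-w a1 a2 a0 (from-yes (injective₃? a1 a2 a0))
          in-plane : ∀ i → InSpan basis (lookup www i)
          in-plane F.zero = pq (section-span s₁ (independent-pair independent a0 a1 (λ ()) (λ ()) (λ ()) (λ ())) p₁ q₁ w∈s)
            where
            pq : InSpan (p ∷ q ∷ []) w → InSpan basis w
            pq (c ∷ d ∷ [] , k) = c ∷ d ∷ 0₃ ∷ [] , trans k (cong (λ t → scale c p ⊕ (scale d q ⊕ t)) (sym (trans (⊕-idʳ (scale 0₃ r)) (scale-0 r))))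
          in-plane (F.suc F.zero) = w₁∈
          in-plane (F.suc (F.suc F.zero)) = subst (InSpan basis) (sym w₂≡) (InSpan-⊕ e∈ (InSpan-scale 2₃ w₁∈))
          positive : ∀ f → ¬ V.head (coef {3} f) ≡ 0₃ → 1 ≤ b (evalᵥ www f)
          positive f r = n≢0⇒n>0 λ z → zero-dependent △ (InSpan-eval in-plane f) z h₁ h₂
            (independent-∷ ind λ i → outside (coef f) r (subst (InSpan ws) (coef-correct www f) i))
            where
            outside : ∀ cs → ¬ V.head cs ≡ 0₃ → ¬ InSpan ws (comb cs www)
            outside (c ∷ cs) r i = w∉ws (cancel c r (subst (InSpan ws) (⊕-cancel (scale c w) (comb cs ws)) (InSpan-⊕ i (InSpan-scale 2₃ (cs , refl)))))
              where
              cancel : ∀ c → ¬ c ≡ 0₃ → InSpan ws (scale c w) → InSpan ws w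
              cancel 0₃ r _ = ⊥-elim (r refl)
              cancel 1₃ _ i = subst (InSpan ws) (scale-1 w) i
              cancel 2₃ _ i = subst (InSpan ws) (⊖⊖ w) (InSpan-scale 2₃ i)
          -- This is 12 + 2(7 + 1 + 1 + 1). Three such planes together with the 42 of w₁ ∩ w₂ give 3
          -- M₃ ≥ 42 + 96 - 86 = 52, hence M₃ ≥ 18, while F ≤ 2 on four points allows only 16.
          thirty-two : ∀ f → ¬ V.head (coef {3} f) ≡ 0₃ → V.head (coef {3} (a1 ⟨+⟩ f)) ≡ V.head (coef {3} f) → V.head (coef {3} (a1 ⟨-⟩ f)) ≡ 2₃ *₃ V.head (coef {3} f) → 32 ≤ M₂ F w₁ (evalᵥ www f)
          thirty-two f r p m = by-contra λ t → farkas {ρ = M₂ F w₁ v ∷ b w₁ ∷ b v ∷ b (w₁ ⊕ v) ∷ b (w₁ ⊝ v) ∷ []}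
            ( hyp 1 (con 1 :+ v0) (con 32) t ∷ hyp 1 (con 12 :+ 2 :* (v1 :+ v2 :+ v3 :+ v4)) v0 (≥-of (M₂-F w₁ v)) ∷ hyp 2 (con 7) v1 (≥-of b-w₁)
            ∷ hyp 2 (con 1) v2 (positive f r) ∷ hyp 2 (con 1) v3 (positive (a1 ⟨+⟩ f) λ z → r (trans (sym p) z))
            ∷ hyp 2 (con 1) v4 (positive (a1 ⟨-⟩ f) λ z → r (*₃-cancel 2₃ (V.head (coef f)) (λ ()) (trans (sym m) z))) ∷ [])
            where
            v : V₅
            v = evalᵥ www f
          light : M₃ F w₁ w₂ w + ∑ (λ x → 2 * mult [] x) ≤ 2 * M₃ one w₁ w₂ w
          light = ≤-trans (≥-of (∑-+ (on w (on w₂ (on w₁ F))) (λ x → 2 * mult [] x)))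
            (≤-trans (∑-mono λ x → bound x (w · x) (w₂ · x) (w₁ · x) refl refl refl (x ≟ᵥ 0ᵥ)) (≤-of (∑-* 2 (on w (on w₂ (on w₁ one))))))
            where
            Goal : ℕ → ℕ → V₅ → F₃ → F₃ → F₃ → Set
            Goal m k x r s t = δ r * (δ s * (δ t * m)) + 2 * k ≤ 2 * (δ r * (δ s * (δ t * 1)))
            origin : ∀ {m k x} → m ≡ 0 → k ≡ 1 → Goal m k x 0₃ 0₃ 0₃
            origin refl refl = ≤-refl
            inside : ∀ {m k x} → m ≤ 2 → k ≡ 0 → Goal m k x 0₃ 0₃ 0₃
            inside {m} p refl = ≤-trans (≤-of (lemma m)) p
              where
              lemma : ∀ m → m + 0 + 0 + 0 + 0 ≡ m
              lemma = solve-∀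
            none : ∀ {m k x} r s t → ¬ (r ≡ 0₃ × s ≡ 0₃ × t ≡ 0₃) → k ≡ 0 → Goal m k x r s t
            none (F.suc _) _ _ _ refl = z≤n
            none 0₃ (F.suc _) _ _ refl = z≤n
            none 0₃ 0₃ (F.suc _) _ refl = z≤n
            none 0₃ 0₃ 0₃ p _ = ⊥-elim (p (refl , refl , refl))
            move : ∀ {x r s t} → w · x ≡ r → w₂ · x ≡ s → w₁ · x ≡ t → Goal (F x) (mult [] x) x r s t → Goal (F x) (mult [] x) x (w · x) (w₂ · x) (w₁ · x)
            move refl refl refl g = g
            bound : ∀ x r s t → w · x ≡ r → w₂ · x ≡ s → w₁ · x ≡ t → Dec (x ≡ 0ᵥ) → Goal (F x) (mult [] x) x (w · x) (w₂ · x) (w₁ · x)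
            bound x r s t i j k (yes z) = move {x} {0₃} {0₃} {0₃} (trans (cong (w ·_) z) (·-0ʳ w)) (trans (cong (w₂ ·_) z) (·-0ʳ w₂)) (trans (cong (w₁ ·_) z) (·-0ʳ w₁))
              (origin {x = x} (trans (cong F z) F-0) (mult-∈ [] independent-[] ([] , z)))
            bound x 0₃ 0₃ 0₃ i j k (no z) = move i j k (inside {x = x} (thin u≡1 x (z , k , j)) (mult-∉ [] (∉-[] z)))
            bound x (F.suc r) s t i j k (no z) = move i j k (none {F x} {x = x} (F.suc r) s t (λ { (() , _) }) (mult-∉ [] (∉-[] z)))
            bound x 0₃ (F.suc s) t i j k (no z) = move i j k (none {F x} {x = x} 0₃ (F.suc s) t (λ { (_ , () , _) }) (mult-∉ [] (∉-[] z)))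
            bound x 0₃ 0₃ (F.suc t) i j k (no z) = move i j k (none {F x} {x = x} 0₃ 0₃ (F.suc t) (λ { (_ , _ , ()) }) (mult-∉ [] (∉-[] z)))

-- Positivity on the plane of a triangle

module GapPositive (D : Arc) (gap : ∀ v → ¬ v ≡ 0ᵥ → 3 ≤ Arc.b D v → 6 ≤ Arc.b D v) (b≤8 : ∀ v → ¬ v ≡ 0ᵥ → Arc.b D v ≤ 8) where
  open Arc D
  open Dual D
  open Geometry D
  open Triangles D
  open Outcome D
  open Gap D gap b≤8
  open GapStar D gap b≤8
  open GapPlane D gap b≤8
  open GapCases D gap b≤8

  module _ {x₁} {s₁ : Special x₁} (△ : Triangle x₁ s₁) (sevens : b (Special.y s₁) ≡ 7 ⊎ (∀ v → Heavy v → b v ≡ 6)) where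
    open Special s₁ using (y; y≢0; y⊥x; 3≤b-y)
    open Triangle △

    module _ (e : V₅) (e∈ : InSpan basis e) (b-e : b e ≡ 0) (w₁ w₂ : V₅) (h₁ : Heavy w₁) (h₂ : Heavy w₂) (ind : Independent (w₁ ∷ w₂ ∷ []))
      (e≡ : e ≡ w₁ ⊕ w₂) (w₁∈y : InSpan (y ∷ []) w₁) where

      w₂≡ : w₂ ≡ e ⊝ w₁
      w₂≡ = trans (by-coef (w₁ ∷ w₂ ∷ []) a1 (a0 ⟨+⟩ a1 ⟨-⟩ a0) refl) (cong (_⊝ w₁) (sym e≡))

      -- As 7 ≡ 1, the first section contains y and so w₁; hence w₁ and w₂ = e - w₁ lie in the plane
      -- of the triangle. If b(w₂) = 6, then `plane-section` at a hole of w₂ gives it the wrong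
      -- residue.
      with-seven : b y ≡ 7 → ⊥
      with-seven b-y = at (6∨7 h₂)
        where
        b-w₁ : b w₁ ≡ 7
        b-w₁ = trans (b-in-line (proj₁ h₁) w₁∈y) b-y
        y∈s₁ : InSection s₁ y
        y∈s₁ = y⊥x , cong ρ₃ b-y
        w₁∈s₁ : InSection s₁ w₁
        w₁∈s₁ = subst (InSection s₁) (sym (proj₂ w₁∈y)) (section-comb s₁ (y ∷ []) (λ { F.zero → y∈s₁ }) (proj₁ w₁∈y))
        w₁∈ : InSpan basis w₁
        w₁∈ = pq (section-span s₁ (independent-pair independent a0 a1 (λ ()) (λ ()) (λ ()) (λ ())) p₁ q₁ w₁∈s₁)
          where
          pq : InSpan (p ∷ q ∷ []) w₁ → InSpan basis w₁
          pq (c ∷ d ∷ [] , k) = c ∷ d ∷ 0₃ ∷ [] , trans k (cong (λ t → scale c p ⊕ (scale d q ⊕ t)) (sym (trans (⊕-idʳ (scale 0₃ r)) (scale-0 r))))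
        w₂∈ : InSpan basis w₂
        w₂∈ = subst (InSpan basis) (sym w₂≡) (InSpan-⊕ e∈ (InSpan-scale 2₃ w₁∈))
        y∈w₁ : InSpan (w₁ ∷ []) y
        y∈w₁ = span₁-sym (proj₁ h₁) w₁∈y
        at : (b w₂ ≡ 6) ⊎ (b w₂ ≡ 7) → ⊥
        at (inj₁ p) = hole (heavy-special w₂ h₂)
          where
          hole : (∃ λ x → Σ (Special x) λ s → Special.y s ≡ w₂) → ⊥
          hole (x , s , refl) = residue-6 p (proj₂ (plane-section △ w₂∈ s (Special.y⊥x s)))
        at (inj₂ p) = cases (m≤n⇒m<n∨m≡n u≤1)
          where
          open Zero △ e e∈ b-e w₁ w₂ h₁ h₂ ind e≡ using (u)
          open Sevens △ e e∈ b-e w₁ w₂ h₁ h₂ ind e≡ b-w₁ p w₁∈s₁ y∈w₁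
          cases : (u < 1) ⊎ (u ≡ 1) → ⊥
          cases (inj₁ q) = u≢0 (n<1⇒n≡0 q)
          cases (inj₂ q) = u≢1 w₂≡ w₁∈ q

      no-zero : ⊥
      no-zero = [ with-seven , all-six △ e e∈ b-e w₁ w₂ h₁ h₂ ind e≡ ]′ sevens

    -- `zero-dependent`, applied to y and a companion, puts a zero e of b on their line. Neither
    -- coefficient of e vanishes, since multiples of a heavy vector are heavy or the origin; scaling
    -- absorbs the coefficients into w₁ and w₂.
    positive : Plane
    positive = plane-from △ λ e e∈ b-e → absurd e e∈ b-e (companion y (y≢0 , 3≤b-y))
      where
      absurd : ∀ e → InSpan basis e → b e ≡ 0 → (∃ λ y′ → Heavy y′ × ¬ InSpan (y ∷ []) y′) → ⊥
      absurd e e∈ b-e (y′ , hy′ , y′∉) = decide (InSpan? (y′ ∷ y ∷ []) e)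
        where
        ind : Independent (y′ ∷ y ∷ [])
        ind = independent-∷ (independent₁ y≢0) y′∉
        hy : Heavy y
        hy = y≢0 , 3≤b-y
        light : ∀ {w} → Heavy w → ¬ b w ≡ 0
        light (_ , r) q = case ≤-trans r (≤-of q) of λ ()
        nonzero : ∀ c d → ¬ c ≡ 0₃ → ¬ d ≡ 0₃ → e ≡ comb (c ∷ d ∷ []) (y′ ∷ y ∷ []) → ⊥
        nonzero c d c≢0 d≢0 k = no-zero e e∈ b-e (scale d y) (scale c y′) (Heavy-scale d d≢0 hy) (Heavy-scale c c≢0 hy′)
          (independent-pair ind (d ⟨*⟩ a1) (c ⟨*⟩ a0) (ne d c d≢0) (ne′ d c c≢0) (by-sum d c d≢0) (difference d c d≢0))
          (trans k (by-coef (scale c y′ ∷ scale d y ∷ 0ᵥ ∷ []) (a0 ⟨+⟩ (a1 ⟨+⟩ a2)) (a1 ⟨+⟩ a0 ⟨+⟩ a2) refl ■ ⊕-idʳ _))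
          (d ∷ [] , sym (comb₁ d y))
          where
          _■_ : ∀ {u v w : V₅} → u ≡ v → v ≡ w → u ≡ w
          _■_ = trans
          ne : ∀ d c → ¬ d ≡ 0₃ → ¬ coef {2} (d ⟨*⟩ a1) ≡ 0ᵥ
          ne 0₃ _ r _ = r refl
          ne 1₃ _ _ ()
          ne 2₃ _ _ ()
          ne′ : ∀ d c → ¬ c ≡ 0₃ → ¬ coef {2} (c ⟨*⟩ a0) ≡ 0ᵥ
          ne′ _ 0₃ r _ = r refl
          ne′ _ 1₃ _ ()
          ne′ _ 2₃ _ ()
          by-sum : ∀ d c → ¬ d ≡ 0₃ → ¬ coef {2} (d ⟨*⟩ a1 ⟨+⟩ c ⟨*⟩ a0) ≡ 0ᵥ
          by-sum d c r q = r (trans (lemma d c) (cong (λ v → lookup v (F.suc F.zero)) q))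
            where
            lemma : ∀ d c → d ≡ lookup (coef {2} (d ⟨*⟩ a1 ⟨+⟩ c ⟨*⟩ a0)) (F.suc F.zero)
            lemma = from-yes (all? λ d → all? λ c → d F.≟ lookup (coef {2} (d ⟨*⟩ a1 ⟨+⟩ c ⟨*⟩ a0)) (F.suc F.zero))
          difference : ∀ d c → ¬ d ≡ 0₃ → ¬ coef {2} (d ⟨*⟩ a1 ⟨-⟩ c ⟨*⟩ a0) ≡ 0ᵥ
          difference d c r q = r (trans (lemma d c) (cong (λ v → lookup v (F.suc F.zero)) q))
            where
            lemma : ∀ d c → d ≡ lookup (coef {2} (d ⟨*⟩ a1 ⟨-⟩ c ⟨*⟩ a0)) (F.suc F.zero)
            lemma = from-yes (all? λ d → all? λ c → d F.≟ lookup (coef {2} (d ⟨*⟩ a1 ⟨-⟩ c ⟨*⟩ a0)) (F.suc F.zero))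
        decide : Dec (InSpan (y′ ∷ y ∷ []) e) → ⊥
        decide (no i) = zero-dependent △ e∈ b-e hy′ hy (independent-∷ ind i)
        decide (yes (c ∷ d ∷ [] , k)) = at (c F.≟ 0₃) (d F.≟ 0₃)
          where
          single : ∀ {w} c → Heavy w → e ≡ scale c w → ⊥
          single {w} c hw k = by (c F.≟ 0₃)
            where
            by : Dec (c ≡ 0₃) → ⊥
            by (yes refl) = case trans (sym b-0) (trans (cong b (trans (sym (scale-0 w)) (sym k))) b-e) of λ ()
            by (no r) = light (Heavy-scale c r hw) (trans (cong b (sym k)) b-e)
          at : Dec (c ≡ 0₃) → Dec (d ≡ 0₃) → ⊥
          at (yes refl) _ = single d hy (trans k (trans (cong (_⊕ (scale d y ⊕ 0ᵥ)) (scale-0 y′)) (trans (⊕-idˡ _) (⊕-idʳ _))))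
          at (no _) (yes refl) = single c hy′ (trans k (trans (cong (scale c y′ ⊕_) (trans (⊕-idʳ _) (scale-0 y))) (⊕-idʳ _)))
          at (no r) (no t) = nonzero c d r t k

  -- The triangle starts at a hole of a hyperplane with b = 7 if there is one, which puts that
  -- hyperplane into the first section. Otherwise every heavy hyperplane has b = 6 and the second
  -- moments decide.
  plane : Plane
  plane = [ from-seven , (λ none → without none heavy-exists) ]′ (search λ v → (¬? (v ≟ᵥ 0ᵥ) ×-dec (3 ≤? b v)) ×-dec (b v ≟ 7))
    where
    from-seven : (∃ λ v → Heavy v × b v ≡ 7) → Plane
    from-seven (v , hv , b-v) = at (heavy-special v hv)
      where
      at : (∃ λ x → Σ (Special x) λ s → Special.y s ≡ v) → Plane
      at (x , s , refl) = positive (triangle no-star s) (inj₁ b-v)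
    without : (∀ v → ¬ (Heavy v × b v ≡ 7)) → ∃ Heavy → Plane
    without none (v , hv) = at (heavy-special v hv)
      where
      six : ∀ v → Heavy v → b v ≡ 6
      six v hv = [ id , (λ p → ⊥-elim (none v (hv , p))) ]′ (6∨7 hv)
      at : (∃ λ x → Σ (Special x) λ s → Special.y s ≡ v) → Plane
      at (x , s , _) = positive (triangle no-star s) (inj₂ six)

module Alternative (D : Arc) where
  open Arc D
  open Dual D
  open Geometry D
  open Triangles D
  open Outcome D

  alternative : (∃ λ s → ¬ s ≡ 0ᵥ × 9 ≤ b s) ⊎ Plane
  alternative = [ inj₁ , inj₂ ∘ bounded ]′ (search λ s → ¬? (s ≟ᵥ 0ᵥ) ×-dec (9 ≤? b s))
    where
    bounded : (∀ s → ¬ (¬ s ≡ 0ᵥ × 9 ≤ b s)) → Plane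
    bounded none = [ (λ (y , hy , r) → light-plane y hy r) , (λ no-light → GapPositive.plane D
        (λ v v≢0 r → ≰⇒> λ t → no-light v ((v≢0 , r) , t)) (λ v v≢0 → ≤-pred (≰⇒> λ t → none v (v≢0 , t)))) ]′
      (search λ y → (¬? (y ≟ᵥ 0ᵥ) ×-dec (3 ≤? b y)) ×-dec (b y ≤? 5))

import Data.Bool.Properties as Boolₚ
open import Data.List.Properties using (map-∘; map-++; map-cong)
open import Data.Maybe using (Maybe; just; nothing; maybe′)
open import Data.Nat.ListAction using (sum)
open import Data.Nat.ListAction.Properties using (sum-++)
open import Data.Bool.ListAction using (any)

-- Points and their representatives

normalized-⊖ : ∀ {n} (v : Vec F₃ n) → normalized v ≡ true → normalized (⊖ v) ≡ false
normalized-⊖ (0₃ ∷ v) p = normalized-⊖ v p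
normalized-⊖ (1₃ ∷ v) p = refl
normalized-⊖ (2₃ ∷ v) ()

normalized-0 : ∀ n → normalized (0ᵥ {n}) ≡ false
normalized-0 zero = refl
normalized-0 (suc n) = normalized-0 n

normalize : ∀ {n} (v : Vec F₃ n) → ¬ v ≡ 0ᵥ → (normalized v ≡ true) ⊎ (normalized (⊖ v) ≡ true)
normalize [] p = ⊥-elim (p refl)
normalize (0₃ ∷ v) p = normalize v λ q → p (cong (0₃ ∷_) q)
normalize (1₃ ∷ v) _ = inj₁ refl
normalize (2₃ ∷ v) _ = inj₂ refl

vec-≢0 : ∀ P → ¬ vec P ≡ 0ᵥ
vec-≢0 (v , p) q = case trans (sym p) (trans (cong normalized q) (normalized-0 5)) of λ ()

vec-≢⊖ : ∀ P Q → ¬ vec P ≡ ⊖ vec Q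
vec-≢⊖ (v , p) (w , q) r = case trans (sym p) (trans (cong normalized r) (normalized-⊖ w q)) of λ ()

vec-injective : ∀ P Q → vec P ≡ vec Q → P ≡ Q
vec-injective (v , p) (v , q) refl = cong (v ,_) (Decidable⇒UIP.≡-irrelevant Boolₚ._≟_ p q)

representative : ∀ v → ¬ v ≡ 0ᵥ → ∃ λ P → (v ≡ vec P) ⊎ (v ≡ ⊖ vec P)
representative v v≢0 = [ (λ p → (v , p) , inj₁ refl) , (λ p → (⊖ v , p) , inj₂ (sym (⊖⊖ v))) ]′ (normalize v v≢0)

-- Splitting on the leading nonzero coordinate lets `normalized` and `toPoint` compute together, so
-- the equation proof stored in the point need not be inspected.
toPoint-cases : ∀ v → (∃ λ p → toPoint v ≡ just (v , p)) ⊎ (normalized v ≡ false × toPoint v ≡ nothing)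
toPoint-cases (1₃ ∷ _) = inj₁ (refl , refl)
toPoint-cases (2₃ ∷ _) = inj₂ (refl , refl)
toPoint-cases (0₃ ∷ 1₃ ∷ _) = inj₁ (refl , refl)
toPoint-cases (0₃ ∷ 2₃ ∷ _) = inj₂ (refl , refl)
toPoint-cases (0₃ ∷ 0₃ ∷ 1₃ ∷ _) = inj₁ (refl , refl)
toPoint-cases (0₃ ∷ 0₃ ∷ 2₃ ∷ _) = inj₂ (refl , refl)
toPoint-cases (0₃ ∷ 0₃ ∷ 0₃ ∷ 1₃ ∷ _) = inj₁ (refl , refl)
toPoint-cases (0₃ ∷ 0₃ ∷ 0₃ ∷ 2₃ ∷ _) = inj₂ (refl , refl)
toPoint-cases (0₃ ∷ 0₃ ∷ 0₃ ∷ 0₃ ∷ 1₃ ∷ []) = inj₁ (refl , refl)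
toPoint-cases (0₃ ∷ 0₃ ∷ 0₃ ∷ 0₃ ∷ 2₃ ∷ []) = inj₂ (refl , refl)
toPoint-cases (0₃ ∷ 0₃ ∷ 0₃ ∷ 0₃ ∷ 0₃ ∷ []) = inj₂ (refl , refl)

toPoint-vec : ∀ P → toPoint (vec P) ≡ just P
toPoint-vec (v , p) = at (toPoint-cases v)
  where
  at : (∃ λ q → toPoint v ≡ just (v , q)) ⊎ (normalized v ≡ false × toPoint v ≡ nothing) → toPoint v ≡ just (v , p)
  at (inj₁ (q , r)) = trans r (cong just (vec-injective (v , q) (v , p) refl))
  at (inj₂ (q , _)) = case trans (sym p) q of λ ()

toPoint-false : ∀ v → normalized v ≡ false → toPoint v ≡ nothing
toPoint-false v p = [ (λ (q , _) → case trans (sym p) q of λ ()) , proj₂ ]′ (toPoint-cases v)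

-- Extension by zero from normalized vectors, which turns a sum over `allPoints` into a sum over
-- F₃⁵.
half : Multiset → V₅ → ℕ
half K v = maybe′ K 0 (toPoint v)

half-vec : ∀ K P → half K (vec P) ≡ K P
half-vec K P = cong (maybe′ K 0) (toPoint-vec P)

half-false : ∀ K v → normalized v ≡ false → half K v ≡ 0
half-false K v p = cong (maybe′ K 0) (toPoint-false v p)

sum-mapMaybe : ∀ {A B : Set} (f : A → Maybe B) (g : B → ℕ) xs → sum (L.map g (L.mapMaybe f xs)) ≡ sum (L.map (maybe′ g 0 ∘ f) xs)
sum-mapMaybe f g [] = refl
sum-mapMaybe f g (x ∷ xs) with f x
... | just y = cong (g y +_) (sum-mapMaybe f g xs)
... | nothing = sum-mapMaybe f g xs

sum-allVecs : ∀ n (f : Vec F₃ n → ℕ) → sum (L.map f (allVecs n)) ≡ ∑ f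
sum-allVecs zero f = trans (+-identityʳ (f [])) (sym (∑-[] f))
sum-allVecs (suc n) f = trans (split 0₃ (block 1₃ L.++ (block 2₃ L.++ [])))
  (trans (cong (∑ (λ v → f (0₃ ∷ v)) +_) (trans (split 1₃ (block 2₃ L.++ []))
    (cong (∑ (λ v → f (1₃ ∷ v)) +_) (trans (split 2₃ []) (+-identityʳ _))))) (sym (∑-∷ f)))
  where
  block : F₃ → List (Vec F₃ (suc n))
  block a = L.map (a ∷_) (allVecs n)
  split : ∀ a xs → sum (L.map f (block a L.++ xs)) ≡ ∑ (λ v → f (a ∷ v)) + sum (L.map f xs)
  split a xs = trans (cong sum (map-++ f (block a) xs)) (trans (sum-++ (L.map f (block a)) (L.map f xs))
    (cong (_+ sum (L.map f xs)) (trans (cong sum (sym (map-∘ (allVecs n)))) (sum-allVecs n λ v → f (a ∷ v)))))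

total-half : ∀ K → total K ≡ ∑ (half K)
total-half K = trans (sum-mapMaybe toPoint K (allVecs 5)) (sum-allVecs 5 (half K))

half-cong : ∀ {K K′ : Multiset} → (∀ P → K P ≡ K′ P) → ∀ v → half K v ≡ half K′ v
half-cong {K} {K′} p v = at (toPoint v)
  where
  at : ∀ m → maybe′ K 0 m ≡ maybe′ K′ 0 m
  at (just P) = p P
  at nothing = refl

half-+ : ∀ (K K′ : Multiset) v → half (λ P → K P + K′ P) v ≡ half K v + half K′ v
half-+ K K′ v = at (toPoint v)
  where
  at : ∀ m → maybe′ (λ P → K P + K′ P) 0 m ≡ maybe′ K 0 m + maybe′ K′ 0 m
  at (just P) = refl
  at nothing = refl

total-sum : ∀ {K K₁ K₂ : Multiset} → (∀ P → K P ≡ K₁ P + K₂ P) → total K ≡ total K₁ + total K₂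
total-sum {K} {K₁} {K₂} p = trans (total-half K) (trans (∑-cong λ v → trans (half-cong p v) (half-+ K₁ K₂ v))
  (trans (∑-+ (half K₁) (half K₂)) (cong₂ _+_ (sym (total-half K₁)) (sym (total-half K₂)))))

mass-sum : ∀ {K K₁ K₂ : Multiset} → (∀ P → K P ≡ K₁ P + K₂ P) → ∀ Q → mass K Q ≡ mass K₁ Q + mass K₂ Q
mass-sum {K} {K₁} {K₂} p Q = total-sum {restrict K} {restrict K₁} {restrict K₂} λ P → at P (Q P)
  where
  restrict : Multiset → Multiset
  restrict K P = if Q P then K P else 0
  at : ∀ P t → (if t then K P else 0) ≡ (if t then K₁ P else 0) + (if t then K₂ P else 0)
  at P true = p P
  at P false = refl

lift : Multiset → V₅ → ℕ
lift K v = half K v + half K (⊖ v)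

lift-vec : ∀ K P → lift K (vec P) ≡ K P
lift-vec K P = trans (cong₂ _+_ (half-vec K P) (half-false K (⊖ vec P) (normalized-⊖ (vec P) (proj₂ P)))) (+-identityʳ (K P))

lift-⊖ : ∀ K v → lift K (⊖ v) ≡ lift K v
lift-⊖ K v = trans (cong (half K (⊖ v) +_) (cong (half K) (⊖⊖ v))) (+-comm (half K (⊖ v)) (half K v))

lift-0 : ∀ K → lift K 0ᵥ ≡ 0
lift-0 K = cong₂ _+_ (half-false K 0ᵥ (normalized-0 5)) (half-false K (⊖ 0ᵥ) (normalized-0 5))

-- Every point has two representatives, so a sum over F₃⁵ counts it twice.
∑-even : ∀ {K : Multiset} (g : V₅ → ℕ) → (∀ v → g (⊖ v) ≡ g v) → (∀ P → K P ≡ g (vec P)) → ∑ g ≡ 2 * total K + g 0ᵥ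
∑-even {K} g even p = begin
  ∑ g                                                             ≡⟨ ∑-cong (λ v → decide v (v ≟ᵥ 0ᵥ)) ⟩
  ∑ (λ v → half K v + half K (⊖ v) + mult [] v * g 0ᵥ)            ≡⟨ ∑-+ (lift K) (λ v → mult [] v * g 0ᵥ) ⟩
  ∑ (lift K) + ∑ (λ v → mult [] v * g 0ᵥ)                         ≡⟨ cong₂ _+_ (∑-+ (half K) (λ v → half K (⊖ v))) (trans (∑-mult [] λ _ → g 0ᵥ) (∑-[] λ _ → g 0ᵥ)) ⟩
  ∑ (half K) + ∑ (λ v → half K (⊖ v)) + g 0ᵥ                      ≡⟨ cong (_+ g 0ᵥ) (cong₂ _+_ (sym (total-half K)) (trans (∑-scale 2₃ (λ ()) (half K)) (sym (total-half K)))) ⟩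
  total K + total K + g 0ᵥ                                        ≡⟨ cong (_+ g 0ᵥ) (cong (total K +_) (sym (+-identityʳ (total K)))) ⟩
  2 * total K + g 0ᵥ                                              ∎
  where
  open ≡-Reasoning
  decide : ∀ v → Dec (v ≡ 0ᵥ) → g v ≡ half K v + half K (⊖ v) + mult [] v * g 0ᵥ
  decide v (yes q) = trans (cong g q) (sym (cong₂ _+_ (trans (cong (lift K) q) (lift-0 K))
    (trans (cong (_* g 0ᵥ) (mult-∈ [] independent-[] ([] , q))) (+-identityʳ (g 0ᵥ)))))
  decide v (no q) = trans (at (representative v q)) (sym (trans (cong (λ m → lift K v + m * g 0ᵥ) (mult-∉ [] (∉-[] q))) (+-identityʳ (lift K v))))
    where
    at : (∃ λ P → (v ≡ vec P) ⊎ (v ≡ ⊖ vec P)) → g v ≡ lift K v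
    at (P , inj₁ r) = trans (cong g r) (trans (sym (p P)) (trans (sym (lift-vec K P)) (cong (lift K) (sym r))))
    at (P , inj₂ r) = trans (cong g r) (trans (even (vec P)) (trans (sym (p P)) (trans (sym (lift-vec K P)) (trans (sym (lift-⊖ K (vec P))) (cong (lift K) (sym r))))))

on-⊖ : ∀ h {g : V₅ → ℕ} → (∀ v → g (⊖ v) ≡ g v) → ∀ v → on h g (⊖ v) ≡ on h g v
on-⊖ h {g} even v = cong₂ _*_ (trans (cong δ (·-scaleʳ 2₃ h v)) (δ-neg (h · v))) (even v)

on-0 : ∀ h {g : V₅ → ℕ} → on h g 0ᵥ ≡ g 0ᵥ
on-0 h {g} = trans (cong (λ t → δ t * g 0ᵥ) (·-0ʳ h)) (+-identityʳ (g 0ᵥ))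

M-even : ∀ {K : Multiset} (g : V₅ → ℕ) → (∀ v → g (⊖ v) ≡ g v) → (∀ P → K P ≡ g (vec P)) → ∀ H →
  M g (vec H) ≡ 2 * mass K (hyperplanePts H) + g 0ᵥ
M-even {K} g even p H = trans (∑-even (on (vec H) g) (on-⊖ (vec H) even) λ P → at P (vec H · vec P) refl)
  (cong (2 * mass K (hyperplanePts H) +_) (on-0 (vec H) {g}))
  where
  at : ∀ P t → vec H · vec P ≡ t → (if hyperplanePts H P then K P else 0) ≡ on (vec H) g (vec P)
  at P 0₃ q = trans (cong (λ t → if t then K P else 0) (dec-true (dot (vec H) (vec P) F.≟ 0₃) q))
    (trans (p P) (sym (trans (cong (λ t → δ t * g (vec P)) q) (+-identityʳ (g (vec P))))))
  at P (F.suc t) q = trans (cong (λ t → if t then K P else 0) (dec-false (dot (vec H) (vec P) F.≟ 0₃) λ r → case trans (sym q) r of λ ()))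
    (sym (cong (λ t → δ t * g (vec P)) q))

import Data.Bool.Properties as Boolₚ
open import Data.List.Properties using (map-∘; map-++; map-cong)
open import Data.Maybe using (Maybe; just; nothing; maybe′)
open import Data.Nat.ListAction using (sum)
open import Data.Nat.ListAction.Properties using (sum-++)
open import Data.Bool.ListAction using (any)

·-comb : ∀ {n k} (h : Vec F₃ n) (cs : Vec F₃ k) us → h · comb cs us ≡ cs · V.map (h ·_) us
·-comb h [] [] = ·-0ʳ h
·-comb h (c ∷ cs) (u ∷ us) = trans (·-⊕ʳ h (scale c u) (comb cs us)) (cong₂ _+₃_ (·-scaleʳ c h u) (·-comb h cs us))

any₃-true : ∀ {f : F₃ → Bool} a → f a ≡ true → any f (L.allFin 3) ≡ true
any₃-true {f} 0₃ p rewrite p = refl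
any₃-true {f} 1₃ p with f 0₃
... | true = refl
... | false rewrite p = refl
any₃-true {f} 2₃ p with f 0₃ | f 1₃
... | true | _ = refl
... | false | true = refl
... | false | false rewrite p = refl

any₃-false : ∀ {f : F₃ → Bool} → (∀ a → f a ≡ false) → any f (L.allFin 3) ≡ false
any₃-false p = cong₂ _∨_ (p 0₃) (cong₂ _∨_ (p 1₃) (cong (_∨ false) (p 2₃)))

-- The two types of minihypers

module Points (𝓕 : Multiset) (total-𝓕 : total 𝓕 ≡ 70) (D : Arc) (F-vec : ∀ P → 𝓕 P ≡ Arc.F D (vec P))
  (H₀ : Hyperplane) (b-H₀ : Arc.b D (vec H₀) ≡ 0) where
  open Arc D
  open Dual D
  open Geometry D
  open Triangles D
  open Outcome D

  mass-𝓕 : ∀ H → mass 𝓕 (hyperplanePts H) ≡ 22 + 3 * b (vec H)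
  mass-𝓕 H = *-cancelˡ-≡ _ _ 2 (begin
    2 * mass 𝓕 (hyperplanePts H)              ≡⟨ sym (+-identityʳ _) ⟩
    2 * mass 𝓕 (hyperplanePts H) + 0          ≡⟨ cong (2 * mass 𝓕 (hyperplanePts H) +_) (sym F-0) ⟩
    2 * mass 𝓕 (hyperplanePts H) + F 0ᵥ       ≡⟨ sym (M-even {𝓕} F F-⊖ F-vec H) ⟩
    M F (vec H)                               ≡⟨ M-F (vec H) ⟩
    44 + 6 * b (vec H)                        ≡⟨ lemma (b (vec H)) ⟩
    2 * (22 + 3 * b (vec H))                  ∎)
    where
    open ≡-Reasoning
    lemma : ∀ m → 44 + 6 * m ≡ 2 * (22 + 3 * m)
    lemma = solve-∀

  module Remove (Q : PointSet) (Q≤𝓕 : ∀ P → Q P ≡ true → 1 ≤ 𝓕 P) where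
    rest : Multiset
    rest P = 𝓕 P ∸ χ Q P

    split : ∀ P → 𝓕 P ≡ χ Q P + rest P
    split P = sym (m+[n∸m]≡n (at (Q P) refl))
      where
      at : ∀ t → Q P ≡ t → (if t then 1 else 0) ≤ 𝓕 P
      at true q = Q≤𝓕 P q
      at false _ = z≤n

    total-rest : total (χ Q) + total rest ≡ 70
    total-rest = trans (sym (total-sum {𝓕} {χ Q} {rest} split)) total-𝓕

    mass-rest : ∀ H → mass (χ Q) (hyperplanePts H) + mass rest (hyperplanePts H) ≡ 22 + 3 * b (vec H)
    mass-rest H = trans (sym (mass-sum {𝓕} {χ Q} {rest} split (hyperplanePts H))) (mass-𝓕 H)

    -- The counts are doubled, with the origin included.
    remainder : ∀ {n m} (g : V₅ → ℕ) k → (∀ v → g (⊖ v) ≡ g v) → (∀ P → χ Q P ≡ g (vec P)) → g 0ᵥ ≡ 1 → ∑ g ≡ 2 * k + 1 → k + n ≡ 70 →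
      (∀ H → (M g (vec H) ≡ 2 * k + 1 × k + m ≤ 22 + 3 * b (vec H)) ⊎ (M g (vec H) + 2 * m ≡ 45)) → M g (vec H₀) + 2 * m ≡ 45 →
      IsMinihyper n m rest
    remainder {n} {m} g k even χ≡g g-0 ∑-g k+n masses at-H₀ = size , low , H₀ , touch
      where
      total-χ : ∑ g ≡ 2 * total (χ Q) + g 0ᵥ
      total-χ = ∑-even {χ Q} g even χ≡g
      mass-χ : ∀ H → M g (vec H) ≡ 2 * mass (χ Q) (hyperplanePts H) + g 0ᵥ
      mass-χ = M-even {χ Q} g even χ≡g
      half-of : ∀ {s o} t k → s ≡ 2 * t + o → o ≡ 1 → s ≡ 2 * k + 1 → t ≡ k
      half-of t k p refl q = *-cancelˡ-≡ t k 2 (+-cancelʳ-≡ 1 (2 * t) (2 * k) (trans (sym p) q))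
      size : total rest ≡ n
      size = +-cancelˡ-≡ k _ _ (trans (cong (_+ total rest) (sym (half-of (total (χ Q)) k total-χ g-0 ∑-g))) (trans total-rest (sym k+n)))
      low : ∀ H → m ≤ mass rest (hyperplanePts H)
      low H = at (masses H)
        where
        at : (M g (vec H) ≡ 2 * k + 1 × k + m ≤ 22 + 3 * b (vec H)) ⊎ (M g (vec H) + 2 * m ≡ 45) → m ≤ mass rest (hyperplanePts H)
        at (inj₁ (p , q)) = +-cancelˡ-≤ k _ _ (≤-trans q (≤-of (trans (sym (mass-rest H))
          (cong (_+ mass rest (hyperplanePts H)) (half-of (mass (χ Q) (hyperplanePts H)) k (mass-χ H) g-0 p)))))
        at (inj₂ p) = by-contra λ r → farkas {ρ = m ∷ M g (vec H) ∷ mass (χ Q) (hyperplanePts H) ∷ mass rest (hyperplanePts H) ∷ b (vec H) ∷ g 0ᵥ ∷ []}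
          ( hyp 2 (con 1 :+ v3) v0 r ∷ hyp 1 (v1 :+ 2 :* v0) (con 45) (≤-of p) ∷ hyp 2 (con 22 :+ 3 :* v4) (v2 :+ v3) (≥-of (mass-rest H))
          ∷ hyp 1 (2 :* v2 :+ v5) v1 (≥-of (mass-χ H)) ∷ hyp 1 (con 1) v5 (≥-of g-0) ∷ [])
      touch : mass rest (hyperplanePts H₀) ≡ m
      touch = ≤-antisym
        (by-contra λ r → farkas {ρ = ρ} ( hyp 2 (con 1 :+ v0) v3 r ∷ hyp 1 (con 45) (v1 :+ 2 :* v0) (≥-of at-H₀)
          ∷ hyp 2 (v2 :+ v3) (con 22 :+ 3 :* v4) (≤-of (mass-rest H₀)) ∷ hyp 1 v1 (2 :* v2 :+ v5) (≤-of (mass-χ H₀)) ∷ hyp 1 v5 (con 1) (≤-of g-0) ∷ hyp 6 v4 (con 0) (≤-of b-H₀) ∷ []))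
        (low H₀)
        where
        ρ : Vec ℕ 6
        ρ = m ∷ M g (vec H₀) ∷ mass (χ Q) (hyperplanePts H₀) ∷ mass rest (hyperplanePts H₀) ∷ b (vec H₀) ∷ g 0ᵥ ∷ []

  ⊥⇒dot : ∀ {u v : V₅} → does (dot u v F.≟ 0₃) ≡ true → u · v ≡ 0₃
  ⊥⇒dot {u} {v} p = at (dot u v F.≟ 0₃) p
    where
    at : (d : Dec (u · v ≡ 0₃)) → does d ≡ true → u · v ≡ 0₃
    at (yes q) _ = q
    at (no _) ()

  module SolidSummand (S : Solid) (9≤b : 9 ≤ b (vec S)) where
    full : ∀ P → hyperplanePts S P ≡ true → 1 ≤ 𝓕 P
    full P p = ≤-trans (n≢0⇒n>0 λ z → 1+n≰n (≤-trans (≤-trans (n≤1+n 8) 9≤b) (b-y≤7 (hole z)))) (≥-of (F-vec P))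
      where
      hole : F (vec P) ≡ 0 → Special (vec P)
      hole z = record { x≢0 = vec-≢0 P ; F≡0 = z ; y = vec S ; y≢0 = vec-≢0 S ; y⊥x = ⊥⇒dot {vec S} {vec P} p ; 3≤b-y = ≤-trans (≤ᵇ⇒≤ 3 9 tt) 9≤b }

    open Remove (hyperplanePts S) full public

    g : V₅ → ℕ
    g = on (vec S) one

    χ≡g : ∀ P → χ (hyperplanePts S) P ≡ g (vec P)
    χ≡g P = at (vec S · vec P)
      where
      at : ∀ t → (if does (t F.≟ 0₃) then 1 else 0) ≡ δ t * 1
      at 0₃ = refl
      at (F.suc t) = refl

    other : ∀ H → ¬ vec S ≡ vec H → M g (vec H) ≡ 27
    other H S≢H = M₂-one (independent-∷ (independent₁ (vec-≢0 H)) (∉-span₁ (vec-≢0 S) S≢H (vec-≢⊖ S H)))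

    -- Another hyperplane meets S in 13 points, and 22 - 13 = 9. On S itself all 40 points are
    -- removed, and 9 ≤ b(S) gives 22 + 27 - 40 = 9.
    minihyper : IsMinihyper 30 9 rest
    minihyper = remainder g 40 (on-⊖ (vec S) λ _ → refl) χ≡g (on-0 (vec S) {one}) (M-one (vec S) (vec-≢0 S)) refl
      (λ H → decide H (vec S ≟ᵥ vec H)) (cong (_+ 18) (other H₀ λ p → case ≤-trans 9≤b (≤-of (trans (cong b p) b-H₀)) of λ ()))
      where
      decide : ∀ H → Dec (vec S ≡ vec H) → (M g (vec H) ≡ 81 × 49 ≤ 22 + 3 * b (vec H)) ⊎ (M g (vec H) + 18 ≡ 45)
      decide H (yes p) = inj₁ (trans (cong (M g) (sym p)) (trans (∑-cong same) (M-one (vec S) (vec-≢0 S))) ,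
        +-monoʳ-≤ 22 (*-monoʳ-≤ 3 (≤-trans 9≤b (≤-of (cong b p)))))
        where
        same : ∀ x → on (vec S) g x ≡ on (vec S) one x
        same x = at (vec S · x)
          where
          at : ∀ t → δ t * (δ t * 1) ≡ δ t * 1
          at 0₃ = refl
          at (F.suc t) = refl
      decide H (no p) = inj₂ (cong (_+ 18) (other H p))

  module LineSummand (u v w : V₅) (ind : Independent (u ∷ v ∷ w ∷ [])) (pos : ∀ cs → 1 ≤ b (comb cs (u ∷ v ∷ w ∷ []))) where
    us : Vec V₅ 3
    us = u ∷ v ∷ w ∷ []

    Orthogonal : V₅ → Set
    Orthogonal x = ∀ i → lookup us i · x ≡ 0₃

    f : V₅ → ℕ
    f = on w (on v (on u one))

    f-bit : ∀ x → f x ≤ 1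
    f-bit x = at (u · x) (v · x) (w · x)
      where
      at : ∀ r s t → δ t * (δ s * (δ r * 1)) ≤ 1
      at _ _ (F.suc _) = z≤n
      at _ (F.suc _) 0₃ = z≤n
      at (F.suc _) 0₃ 0₃ = z≤n
      at 0₃ 0₃ 0₃ = ≤-refl

    orthogonal : ∀ x → 1 ≤ f x → Orthogonal x
    orthogonal x = at (u · x) (v · x) (w · x) refl refl refl
      where
      at : ∀ r s t → u · x ≡ r → v · x ≡ s → w · x ≡ t → 1 ≤ δ t * (δ s * (δ r * 1)) → Orthogonal x
      at 0₃ 0₃ 0₃ p q r _ = ⊥₃ {u = u} {v} {w} {x} p q r
      at _ _ (F.suc _) _ _ _ ()
      at _ (F.suc _) 0₃ _ _ _ ()
      at (F.suc _) 0₃ 0₃ _ _ _ ()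

    orthogonal-scale : ∀ c {x} → Orthogonal x → Orthogonal (scale c x)
    orthogonal-scale c {x} p i = trans (·-scaleʳ c (lookup us i) x) (trans (cong (c *₃_) (p i)) (*₃-zeroʳ c))

    orthogonal-point : ∀ {k} (xs : Vec V₅ k) → Independent xs → 3 ^ k ≤ 8 → ∃ λ P → Orthogonal (vec P) × ¬ InSpan xs (vec P)
    orthogonal-point xs ind-xs small = found (escape-span xs ind-xs f f-bit (≤-trans (s≤s small) (≥-of (M₃-one ind))))
      where
      found : (∃ λ x → 1 ≤ f x × ¬ InSpan xs x) → ∃ λ P → Orthogonal (vec P) × ¬ InSpan xs (vec P)
      found (x , p , x∉) = at (representative x λ q → x∉ (0ᵥ , trans q (sym (comb-0 xs))))
        where
        at : (∃ λ P → (x ≡ vec P) ⊎ (x ≡ ⊖ vec P)) → ∃ λ P → Orthogonal (vec P) × ¬ InSpan xs (vec P)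
        at (P , inj₁ q) = P , subst Orthogonal q (orthogonal x p) , λ i → x∉ (subst (InSpan xs) (sym q) i)
        at (P , inj₂ q) = P , subst Orthogonal (trans (cong ⊖_ q) (⊖⊖ (vec P))) (orthogonal-scale 2₃ (orthogonal x p)) ,
          λ i → x∉ (subst (InSpan xs) (sym q) (InSpan-scale 2₃ i))

    -- The span of `us` lies in the dual hyperplane of x and carries 16 at the origin and at least 1
    -- at 26 further vectors. The total 42 exceeds 36, the b-weight at a point of multiplicity zero.
    F-pos : ∀ x → ¬ x ≡ 0ᵥ → Orthogonal x → 1 ≤ F x
    F-pos x x≢0 p = by-contra λ r → farkas {ρ = F x ∷ M b x ∷ []} (hyp 18 (con 1 :+ v0) (con 1) r ∷ hyp 1 v1 (con 36 :+ 18 :* v0) (≤-of (M-b x x≢0)) ∷ hyp 1 (con 42) v1 42≤ ∷ [])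
      where
      42≤ : 42 ≤ M b x
      42≤ = begin
        42                                                    ≡⟨ sym (cong₂ _+_ (∑-const 3 1) (trans (∑-mult [] λ _ → 15) (∑-[] λ _ → 15))) ⟩
        ∑ {3} (λ _ → 1) + ∑ {3} (λ cs → mult [] cs * 15)      ≡⟨ sym (∑-+ {3} (λ _ → 1) (λ cs → mult [] cs * 15)) ⟩
        ∑ {3} (λ cs → 1 + mult [] cs * 15)                    ≤⟨ ∑-mono (λ cs → decide cs (cs ≟ᵥ 0ᵥ)) ⟩
        ∑ (λ cs → b (comb cs us))                             ≡⟨ sym (∑-mult us b) ⟩
        ∑ (λ v → mult us v * b v)                             ≤⟨ ∑-mono (λ v → *-monoˡ-≤ (b v) (below v (InSpan? us v))) ⟩
        M b x                                                 ∎
        where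
        open ≤-Reasoning
        decide : ∀ cs → Dec (cs ≡ 0ᵥ) → 1 + mult [] cs * 15 ≤ b (comb cs us)
        decide cs (yes q) = ≤-of (trans (cong (λ m → 1 + m * 15) (mult-∈ [] independent-[] ([] , q)))
          (sym (trans (cong b (trans (cong (λ cs → comb cs us) q) (comb-0 us))) b-0)))
        decide cs (no q) = ≤-trans (≤-of (cong (λ m → 1 + m * 15) (mult-∉ [] (∉-[] q)))) (pos cs)
        below : ∀ v → Dec (InSpan us v) → mult us v ≤ δ (x · v)
        below v (no i) = ≤-trans (≤-of (mult-∉ us i)) z≤n
        below v (yes i@(cs , q)) = ≤-of (trans (mult-∈ us ind i)
          (sym (cong δ (trans (·-comm x v) (trans (cong (_· x) q) (⊥-comb us x p cs))))))

    module Through (P Q : Point) (P⊥ : Orthogonal (vec P)) (Q⊥ : Orthogonal (vec Q)) (P∉Q : ¬ InSpan (vec Q ∷ []) (vec P)) where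
      ℓ : Vec V₅ 2
      ℓ = vec P ∷ vec Q ∷ []

      ind-ℓ : Independent ℓ
      ind-ℓ = independent-∷ (independent₁ (vec-≢0 Q)) P∉Q

      line : Line
      line = (P , Q) , λ p → P∉Q (subst (InSpan (vec Q ∷ [])) (sym p) (span₁-self (vec Q)))

      g : V₅ → ℕ
      g = mult ℓ

      on-line : ∀ R → InSpan ℓ (vec R) → linePts line R ≡ true
      on-line R (c ∷ d ∷ [] , p) = any₃-true {λ α → any (λ β → vec R ≟v vadd (scale α (vec P)) (scale β (vec Q))) (L.allFin 3)} c
        (any₃-true {λ β → vec R ≟v vadd (scale c (vec P)) (scale β (vec Q))} d
          (dec-true (≡-dec F._≟_ (vec R) (scale c (vec P) ⊕ scale d (vec Q))) (trans p (cong (scale c (vec P) ⊕_) (⊕-idʳ _)))))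

      off-line : ∀ R → ¬ InSpan ℓ (vec R) → linePts line R ≡ false
      off-line R i = any₃-false {λ α → any (λ β → vec R ≟v vadd (scale α (vec P)) (scale β (vec Q))) (L.allFin 3)} λ c →
        any₃-false {λ β → vec R ≟v vadd (scale c (vec P)) (scale β (vec Q))} λ d →
          dec-false (≡-dec F._≟_ (vec R) (scale c (vec P) ⊕ scale d (vec Q))) λ p → i (c ∷ d ∷ [] , trans p (cong (scale c (vec P) ⊕_) (sym (⊕-idʳ _))))

      span-orthogonal : ∀ {x} → InSpan ℓ x → Orthogonal x
      span-orthogonal (cs , p) i = trans (·-comm (lookup us i) _) (trans (cong (_· lookup us i) p)
        (⊥-comb ℓ (lookup us i) (⊥₂ {u = vec P} {vec Q} {lookup us i} (trans (·-comm (vec P) _) (P⊥ i)) (trans (·-comm (vec Q) _) (Q⊥ i))) cs))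

      full : ∀ R → linePts line R ≡ true → 1 ≤ 𝓕 R
      full R p = decide (InSpan? ℓ (vec R))
        where
        decide : Dec (InSpan ℓ (vec R)) → 1 ≤ 𝓕 R
        decide (yes i) = ≤-trans (F-pos (vec R) (vec-≢0 R) (span-orthogonal i)) (≥-of (F-vec R))
        decide (no i) = case trans (sym p) (off-line R i) of λ ()

      open Remove (linePts line) full public

      χ≡g : ∀ R → χ (linePts line) R ≡ g (vec R)
      χ≡g R = decide (InSpan? ℓ (vec R))
        where
        decide : Dec (InSpan ℓ (vec R)) → χ (linePts line) R ≡ g (vec R)
        decide (yes i) = trans (cong (λ t → if t then 1 else 0) (on-line R i)) (sym (mult-∈ ℓ ind-ℓ i))
        decide (no i) = trans (cong (λ t → if t then 1 else 0) (off-line R i)) (sym (mult-∉ ℓ i))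

      Contains : V₅ → Set
      Contains h = ∀ i → lookup ℓ i · h ≡ 0₃

      -- Exactly 27 forms vanish on the line, and the span of `us` already supplies 27 of them.
      in-plane : ∀ h → Contains h → InSpan us h
      in-plane h p = span-fills us ind (on (vec Q) (on (vec P) one)) (λ cs → ≥-of (at (comb cs us) (λ { F.zero → ⊥-span P⊥ cs ; (F.suc F.zero) → ⊥-span Q⊥ cs })))
        (≤-of (M₂-one ind-ℓ)) h (≥-of (at h p))
        where
        ⊥-span : ∀ {x} → Orthogonal x → ∀ cs → x · comb cs us ≡ 0₃
        ⊥-span {x} q cs = trans (·-comm x (comb cs us)) (⊥-comb us x q cs)
        at : ∀ h → Contains h → on (vec Q) (on (vec P) one) h ≡ 1
        at h p = cong₂ (λ s t → δ t * (δ s * 1)) (p F.zero) (p (F.suc F.zero))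

      b-pos : ∀ h → Contains h → 1 ≤ b h
      b-pos h p = at (in-plane h p)
        where
        at : InSpan us h → 1 ≤ b h
        at (cs , q) = ≤-trans (pos cs) (≥-of (cong b q))

      meets : ∀ h → ¬ Contains h → M g h ≡ 3
      meets h p = begin
        ∑ (λ v → δ (h · v) * mult ℓ v)          ≡⟨ ∑-cong (λ v → *-comm (δ (h · v)) (mult ℓ v)) ⟩
        ∑ (λ v → mult ℓ v * δ (h · v))          ≡⟨ ∑-mult ℓ (λ v → δ (h · v)) ⟩
        ∑ (λ cs → δ (h · comb cs ℓ))            ≡⟨ ∑-cong (λ cs → cong δ (·-comb h cs ℓ)) ⟩
        ∑ (λ cs → δ (cs · V.map (h ·_) ℓ))      ≡⟨ ∑-dot (V.map (h ·_) ℓ) (λ q → p λ { F.zero → trans (·-comm (vec P) h) (cong V.head q) ; (F.suc F.zero) → trans (·-comm (vec Q) h) (cong (V.head ∘ V.tail) q) }) δ ⟩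
        3                                       ∎
        where open ≡-Reasoning

      Contains? : ∀ h → Dec (Contains h)
      Contains? h = all? λ i → (lookup ℓ i · h) F.≟ 0₃

      -- A hyperplane containing the line has b ≥ 1 and loses 4 points: 25 - 4 = 21. Any other loses
      -- one point from at least 22. H₀ is of the second kind because b vanishes there.
      minihyper : IsMinihyper 66 21 rest
      minihyper = remainder g 4 (mult-⊖ ℓ ind-ℓ) χ≡g (mult-0 ind-ℓ) (∑-mult-one ℓ) refl
        (λ H → decide H (Contains? (vec H))) (cong (_+ 42) (meets (vec H₀) λ p → case ≤-trans (b-pos (vec H₀) p) (≤-of b-H₀) of λ ()))
        where
        decide : ∀ H → Dec (Contains (vec H)) → (M g (vec H) ≡ 9 × 25 ≤ 22 + 3 * b (vec H)) ⊎ (M g (vec H) + 42 ≡ 45)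
        decide H (yes p) = inj₁ (M-mult-⊥ ℓ (vec H) p , +-monoʳ-≤ 22 (*-monoʳ-≤ 3 (b-pos (vec H) p)))
        decide H (no p) = inj₂ (cong (_+ 42) (meets (vec H) p))

  decomposition : (∃ λ s → ¬ s ≡ 0ᵥ × 9 ≤ b s) ⊎ Plane →
    (Σ Solid λ S → Σ Multiset λ 𝓕′ → IsMinihyper 30 9 𝓕′ × (∀ P → 𝓕 P ≡ χ (hyperplanePts S) P + 𝓕′ P)) ⊎
    (Σ Multiset λ 𝓕″ → Σ Line λ Lₗ → IsMinihyper 66 21 𝓕″ × (∀ P → 𝓕 P ≡ 𝓕″ P + χ (linePts Lₗ) P))
  decomposition (inj₁ (s , s≢0 , 9≤b)) = inj₁ (at (representative s s≢0))
    where
    summand : ∀ S → 9 ≤ b (vec S) → Σ Solid λ S → Σ Multiset λ 𝓕′ → IsMinihyper 30 9 𝓕′ × (∀ P → 𝓕 P ≡ χ (hyperplanePts S) P + 𝓕′ P)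
    summand S r = S , rest , minihyper , split
      where open SolidSummand S r
    at : (∃ λ P → (s ≡ vec P) ⊎ (s ≡ ⊖ vec P)) → Σ Solid λ S → Σ Multiset λ 𝓕′ → IsMinihyper 30 9 𝓕′ × (∀ P → 𝓕 P ≡ χ (hyperplanePts S) P + 𝓕′ P)
    at (S , inj₁ q) = summand S (≤-trans 9≤b (≤-of (cong b q)))
    at (S , inj₂ q) = summand S (≤-trans 9≤b (≤-of (trans (cong b q) (b-⊖ (vec S)))))
  decomposition (inj₂ (u ∷ v ∷ w ∷ [] , ind , pos)) = inj₂ (start (orthogonal-point [] independent-[] (s≤s z≤n)))
    where
    open LineSummand u v w ind pos
    Goal : Set
    Goal = Σ Multiset λ 𝓕″ → Σ Line λ Lₗ → IsMinihyper 66 21 𝓕″ × (∀ P → 𝓕 P ≡ 𝓕″ P + χ (linePts Lₗ) P)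
    join : ∀ Q → Orthogonal (vec Q) → (∃ λ P → Orthogonal (vec P) × ¬ InSpan (vec Q ∷ []) (vec P)) → Goal
    join Q Q⊥ (P , P⊥ , P∉) = rest , line , minihyper , λ R → trans (split R) (+-comm (χ (linePts line) R) (rest R))
      where open Through P Q P⊥ Q⊥ P∉
    start : (∃ λ Q → Orthogonal (vec Q) × ¬ InSpan [] (vec Q)) → Goal
    start (Q , Q⊥ , _) = join Q Q⊥ (orthogonal-point (vec Q ∷ []) (independent₁ (vec-≢0 Q)) (s≤s (s≤s (s≤s z≤n))))

import Data.Bool.Properties as Boolₚ
open import Data.List.Properties using (map-∘; map-++; map-cong)
open import Data.Maybe using (Maybe; just; nothing; maybe′)
open import Data.Nat.ListAction using (sum)
open import Data.Nat.ListAction.Properties using (sum-++)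
open import Data.Bool.ListAction using (any)

-- From a minihyper to its dual multiset

module Masses (𝓕 : Multiset) (total-𝓕 : total 𝓕 ≡ 70) (low : ∀ H → 22 ≤ mass 𝓕 (hyperplanePts H)) (H₀ : Hyperplane) (at-H₀ : mass 𝓕 (hyperplanePts H₀) ≡ 22) where
  F : V₅ → ℕ
  F = lift 𝓕

  F-vec : ∀ P → 𝓕 P ≡ F (vec P)
  F-vec P = sym (lift-vec 𝓕 P)

  ∑-F : ∑ F ≡ 140
  ∑-F = trans (∑-even {𝓕} F (lift-⊖ 𝓕) F-vec) (cong₂ (λ m n → 2 * m + n) total-𝓕 (lift-0 𝓕))

  M-vec : ∀ H → M F (vec H) ≡ 2 * mass 𝓕 (hyperplanePts H)
  M-vec H = trans (M-even {𝓕} F (lift-⊖ 𝓕) F-vec H) (trans (cong (2 * mass 𝓕 (hyperplanePts H) +_) (lift-0 𝓕)) (+-identityʳ _))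

  excess : ∀ v → ∃ λ k → M F v ≡ 44 + 2 * k
  excess v = at (v ≟ᵥ 0ᵥ)
    where
    above : ∀ m → 22 ≤ m → 2 * m ≡ 44 + 2 * (m ∸ 22)
    above m p = trans (cong (2 *_) (sym (m+[n∸m]≡n p))) (*-distribˡ-+ 2 22 (m ∸ 22))
    hyperplane : ∀ H → M F (vec H) ≡ 44 + 2 * (mass 𝓕 (hyperplanePts H) ∸ 22)
    hyperplane H = trans (M-vec H) (above (mass 𝓕 (hyperplanePts H)) (low H))
    at : Dec (v ≡ 0ᵥ) → ∃ λ k → M F v ≡ 44 + 2 * k
    -- The zero form carries the whole doubled mass, 140 = 44 + 2 * 48.
    at (yes p) = 48 , trans (cong (M F) p) (trans (M-0ᵥ F) ∑-F)
    at (no p) = by (representative v p)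
      where
      by : (∃ λ P → (v ≡ vec P) ⊎ (v ≡ ⊖ vec P)) → ∃ λ k → M F v ≡ 44 + 2 * k
      by (P , inj₁ q) = mass 𝓕 (hyperplanePts P) ∸ 22 , trans (cong (M F) q) (hyperplane P)
      by (P , inj₂ q) = mass 𝓕 (hyperplanePts P) ∸ 22 , trans (cong (M F) q) (trans (M-⊖ F (vec P)) (hyperplane P))

  k-H₀ : proj₁ (excess (vec H₀)) ≡ 0
  k-H₀ = *-cancelˡ-≡ _ 0 2 (+-cancelˡ-≡ 44 _ 0 (trans (sym (proj₂ (excess (vec H₀)))) (trans (M-vec H₀) (cong (2 *_) at-H₀))))

  open Divisibility F (lift-⊖ 𝓕) (lift-0 𝓕) ∑-F (λ v → proj₁ (excess v)) (λ v → proj₂ (excess v)) (vec H₀) k-H₀ using (3∣k)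

  arc : Arc
  arc = record
    { F = F ; F-⊖ = lift-⊖ 𝓕 ; F-0 = lift-0 𝓕 ; ∑-F = ∑-F ; b = λ v → proj₁ (3∣k v)
    ; M-F = λ v → trans (proj₂ (excess v)) (cong (44 +_) (trans (cong (2 *_) (proj₂ (3∣k v))) (sym (*-assoc 2 3 (proj₁ (3∣k v))))))
    }

  b-H₀ : Arc.b arc (vec H₀) ≡ 0
  b-H₀ = *-cancelˡ-≡ _ 0 3 (trans (sym (proj₂ (3∣k (vec H₀)))) k-H₀)

theorem4p4 : (𝓕 : Multiset) → IsMinihyper 70 22 𝓕 →
  (Σ Solid (λ S → Σ Multiset (λ 𝓕′ →
     IsMinihyper 30 9 𝓕′ × ((P : Point) → 𝓕 P ≡ χ (hyperplanePts S) P + 𝓕′ P))))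
  ⊎
  (Σ Multiset (λ 𝓕″ → Σ Line (λ Lₗ →
     IsMinihyper 66 21 𝓕″ × ((P : Point) → 𝓕 P ≡ 𝓕″ P + χ (linePts Lₗ) P))))
theorem4p4 𝓕 (total-𝓕 , low , H₀ , at-H₀) = Points.decomposition 𝓕 total-𝓕 arc F-vec H₀ b-H₀ (Alternative.alternative arc)
  where open Masses 𝓕 total-𝓕 low H₀ at-H₀ using (arc; F-vec; b-H₀)
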